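{- Every $q$-matroid $\mathcal{M}=(E,\rho)$ is a direct sum of irreducible $q$-matroids, and the summands are unique up to equivalence: if $\mathcal{M}\approx\mathcal{M}_1\oplus\cdots\oplus\mathcal{M}_t$ and $\mathcal{M}\approx\mathcal{N}_1\oplus\cdots\oplus\mathcal{N}_s$ with all $\mathcal{M}_i,\mathcal{N}_j$ irreducible, then $s=t$ and, after reordering, $\mathcal{M}_i\approx\mathcal{N}_i$ for all $i$.
   Context: Let $\mathbb{F}=\mathbb{F}_q$. A $q$-matroid is $\mathcal{M}=(E,\rho)$, $E$ a finite-dimensional $\mathbb{F}$-vector space, $\rho$ defined on subspaces with $0\le\rho(V)\le\dim V$, monotone and submodular ($\rho(V+W)+\rho(V\cap W)\le\rho(V)+\rho(W)$). Two $q$-matroids $(E_1,\rho_1),(E_2,\rho_2)$ are equivalent ($\approx$) if there is an $\mathbb{F}$-isomorphism $\alpha:E_1\to E_2$ with $\rho_2(\alpha(V))=\rho_1(V)$ for all subspaces $V$. Direct sum: for $q$-matroids $\mathcal{M}_i=(E_i,\rho_i)$ and $E=E_1\oplus E_2$ with projections $\pi_i:E\to E_i$, $\mathcal{M}_1\oplus\mathcal{M}_2=(E,\rho)$ where $\rho(V)=\dim V+\min_{X\le V}(\rho_1(\pi_1(X))+\rho_2(\pi_2(X))-\dim X)$; this operation is associative, so iterated direct sums $\mathcal{M}_1\oplus\cdots\oplus\mathcal{M}_t$ are well defined. We write $\mathcal{M}=\mathcal{M}_1\oplus\mathcal{M}_2$ when $E$ is the internal direct sum of $E_1,E_2$ and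 the rank functions agree. A $q$-matroid is reducible if $\mathcal{M}=\mathcal{M}_1\oplus\mathcal{M}_2$ with both ground spaces nonzero, and irreducible otherwise.
   Formalization: All summands are required to have nonzero ground space (the zero q-matroid being the empty direct sum), since the q-matroid on the zero space is irreducible by the stated definition and M ≈ M ⊕ 0 would violate s = t. -}

module Defs where

open import Algebra.Bundles using (CommutativeRing; CommutativeMonoid)
open import Algebra.Module.Bundles using (LeftModule)
import Algebra.Module.Construct.DirectProduct as DirectProduct
import Algebra.Module.Construct.Zero as Zero
open import Algebra.Module.Morphism.Structures using (module LeftModuleMorphisms)
import Algebra.Module.Properties.LeftModule as LeftModuleProperties
import Algebra.Properties.CommutativeMonoid.Sum as Sum
import Algebra.Properties.CommutativeSemigroup as CommutativeSemigroupProperties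
open import Data.Fin.Base as Fin using (Fin; zero; suc; _↑ˡ_; _↑ʳ_; splitAt; finToFun; funToFin; combine)
import Data.Fin.Properties as Fin
open import Data.Integer.Base as ℤ using (ℤ; 0ℤ)
import Data.Integer.Properties as ℤ
open import Data.Integer.Solver using (module +-*-Solver)
open import Data.List.Base as List using (List; []; _∷_)
open import Data.List.Extrema ℤ.≤-totalOrder using (argmin; argmin-all; f[argmin]≤f[xs])
open import Data.List.Membership.Propositional using () renaming (_∈_ to _∈ᴸ_)
import Data.List.Membership.Propositional.Properties as ∈ᴸ
open import Data.List.Relation.Unary.All as All using (All; []; _∷_)
import Data.List.Relation.Unary.All.Properties as All
open import Data.List.Relation.Unary.Any as Any using (Any; here; there)
import Data.List.Relation.Unary.Any.Properties as Any
open import Data.Nat.Base as ℕ using (ℕ; zero; suc; _^_)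
import Data.Nat.Properties as ℕ
open import Data.Product.Base using (Σ; ∃; ∃₂; _×_; _,_; proj₁; proj₂)
open import Data.Sum.Base using (_⊎_; inj₁; inj₂; [_,_]′)
open import Data.Unit.Polymorphic.Base using (tt)
open import Data.Vec.Functional as Vector using (Vector)
open import Function.Base using (_∘_; id)
open import Function.Bundles using (Inverse)
open import Level using (Level) renaming (suc to lsuc)
open import Relation.Binary.Definitions using (_Respects_) renaming (Decidable to Decidable₂)
open import Relation.Binary.PropositionalEquality as ≡ using (_≡_)
import Relation.Binary.Reasoning.Setoid as SetoidReasoning
open import Relation.Nullary using (¬_; Dec; yes; no; contradiction)
import Relation.Nullary.Decidable as Dec
open import Relation.Nullary.Decidable using (_×-dec_)
open import Relation.Unary using (Pred; Decidable)

private module ℤ+ = CommutativeSemigroupProperties ℤ.+-commutativeSemigroup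

record FiniteField (ℓ : Level) : Set (lsuc ℓ) where
  field
    commutativeRing : CommutativeRing ℓ ℓ
  open CommutativeRing commutativeRing public renaming (Carrier to K)
  field
    1≉0         : ¬ (1# ≈ 0#)
    invertible  : ∀ x → ¬ (x ≈ 0#) → ∃ λ y → x * y ≈ 1#
    order       : ℕ
    enumeration : Inverse setoid (≡.setoid (Fin order))

module Linear {ℓ} (F : FiniteField ℓ) (V : LeftModule (FiniteField.ring F) ℓ ℓ) where
  open FiniteField F using (K; _≈_; 0#)
  open LeftModule V
  open Sum +ᴹ-commutativeMonoid using (sum)

  linComb : ∀ {n} → Vector K n → Vector Carrierᴹ n → Carrierᴹ
  linComb a b = sum (λ i → a i *ₗ b i)

  LinearlyIndependent : ∀ {n} → Vector Carrierᴹ n → Set ℓ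
  LinearlyIndependent b = ∀ a → linComb a b ≈ᴹ 0ᴹ → ∀ i → a i ≈ 0#

-- Vectors are compared by the setoid equality of the module.
record FiniteDimensionalSpace {ℓ} (F : FiniteField ℓ) : Set (lsuc ℓ) where
  field
    leftModule : LeftModule (FiniteField.ring F) ℓ ℓ
  open LeftModule leftModule public
  open Linear F leftModule public
  field
    dimension         : ℕ
    basis             : Vector Carrierᴹ dimension
    basis-independent : LinearlyIndependent basis
    basis-spans       : ∀ v → ∃ λ a → v ≈ᴹ linComb a basis

-- Membership is decidable: classically this is no restriction, as the space
-- is finite, and it makes dimensions and minima computable.
record Subspace {ℓ} {F : FiniteField ℓ} (E : FiniteDimensionalSpace F) : Set (lsuc ℓ) where
  open FiniteDimensionalSpace E
  field
    Member    : Pred Carrierᴹ ℓ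
    member?   : Decidable Member
    respects  : Member Respects _≈ᴹ_
    0-closed  : Member 0ᴹ
    +-closed  : ∀ {v w} → Member v → Member w → Member (v +ᴹ w)
    *ₗ-closed : ∀ c {v} → Member v → Member (c *ₗ v)

module _ {ℓ} {F : FiniteField ℓ} {E : FiniteDimensionalSpace F} where
  open FiniteDimensionalSpace E using (Carrierᴹ)

  infix 4 _∈_ _⊆_

  _∈_ : Carrierᴹ → Subspace E → Set ℓ
  v ∈ V = Subspace.Member V v

  _⊆_ : Subspace E → Subspace E → Set ℓ
  V ⊆ W = ∀ {v} → v ∈ V → v ∈ W

record Basis {ℓ} {F : FiniteField ℓ} {E : FiniteDimensionalSpace F} (V : Subspace E) : Set ℓ where
  open FiniteDimensionalSpace E
  field
    size        : ℕ
    vectors     : Vector Carrierᴹ size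
    vectors∈    : ∀ i → vectors i ∈ V
    independent : LinearlyIndependent vectors
    spans       : ∀ v → v ∈ V → ∃ λ a → v ≈ᴹ linComb a vectors

module Field {ℓ} (F : FiniteField ℓ) where
  open FiniteField F hiding (zero)
  open Inverse enumeration using (to; from; strictlyInverseˡ; strictlyInverseʳ; to-cong; from-cong)

  to-injective : ∀ {x y} → to x ≡ to y → x ≈ y
  to-injective {x} {y} eq =
    trans (sym (strictlyInverseʳ x)) (trans (from-cong eq) (strictlyInverseʳ y))

  _≟_ : Decidable₂ _≈_
  x ≟ y = Dec.map′ to-injective to-cong (to x Fin.≟ to y)

  any? : ∀ {p} {P : Pred K p} → P Respects _≈_ → Decidable P → Dec (∃ P)
  any? resp P? = Dec.map′
    (λ (i , p) → from i , p)
    (λ (x , p) → to x , resp (sym (strictlyInverseʳ x)) p)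
    (Fin.any? (P? ∘ from))

  1<order : 1 ℕ.< order
  1<order = go order to to-injective
    where
    go : ∀ n (f : K → Fin n) → (∀ {x y} → f x ≡ f y → x ≈ y) → 1 ℕ.< n
    go zero          f inj = contradiction (f 0#) Fin.¬Fin0
    go (suc zero)    f inj with f 1# in p | f 0# in q
    ... | zero | zero = contradiction (inj (≡.trans p (≡.sym q))) 1≉0
    go (suc (suc n)) f inj = ℕ.s≤s (ℕ.s≤s ℕ.z≤n)

  cancel : ∀ {x y} → x * y ≈ 1# → y * x ≈ 1#
  cancel {x} {y} = trans (*-comm y x)

  funToFin-cong : ∀ {m n} {f g : Fin m → Fin n} → (∀ i → f i ≡ g i) → funToFin f ≡ funToFin g
  funToFin-cong {zero}  eq = ≡.refl
  funToFin-cong {suc m} eq = ≡.cong₂ combine (eq zero) (funToFin-cong (eq ∘ suc))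

  vectorOf : ∀ {n} → Fin (order ^ n) → Vector K n
  vectorOf i = from ∘ finToFun i

  indexOf : ∀ {n} → Vector K n → Fin (order ^ n)
  indexOf a = funToFin (to ∘ a)

  vectorOf-indexOf : ∀ {n} (a : Vector K n) i → vectorOf (indexOf a) i ≈ a i
  vectorOf-indexOf a i =
    trans (from-cong (Fin.finToFun-funToFin (to ∘ a) i)) (strictlyInverseʳ (a i))

  vectorOf-injective : ∀ {n} (i j : Fin (order ^ n)) →
                       (∀ k → vectorOf {n} i k ≈ vectorOf j k) → i ≡ j
  vectorOf-injective {n} i j eq = ≡.trans (≡.sym (Fin.funToFin-finToFin {n} i)) (≡.trans
    (funToFin-cong (λ k → ≡.trans (≡.sym (strictlyInverseˡ _))
      (≡.trans (to-cong (eq k)) (strictlyInverseˡ _))))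
    (Fin.funToFin-finToFin {n} j))

  indexOf-injective : ∀ {n} (a b : Vector K n) → indexOf a ≡ indexOf b → ∀ i → a i ≈ b i
  indexOf-injective a b eq i = trans (sym (vectorOf-indexOf a i))
    (trans (from-cong (≡.cong (λ k → finToFun k i) eq)) (vectorOf-indexOf b i))

module LinearProperties {ℓ} (F : FiniteField ℓ) (V : LeftModule (FiniteField.ring F) ℓ ℓ) where
  open FiniteField F using (K; _≈_; _+_; _*_; -_; 0#; 1#; -‿inverseˡ; -‿inverseʳ)
  open LeftModule V
  open Linear F V
  open Sum +ᴹ-commutativeMonoid using (sum; sum-cong-≋; ∑-distrib-+)
  open LeftModuleProperties V
  open SetoidReasoning ≈ᴹ-setoid

  linComb-cong : ∀ {n} {a a′ : Vector K n} (b : Vector Carrierᴹ n) →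
                 (∀ i → a i ≈ a′ i) → linComb a b ≈ᴹ linComb a′ b
  linComb-cong b eq = sum-cong-≋ (λ i → *ₗ-congʳ (eq i))

  sum-zero : ∀ {n} (f : Vector Carrierᴹ n) → (∀ i → f i ≈ᴹ 0ᴹ) → sum f ≈ᴹ 0ᴹ
  sum-zero {zero}  f eq = ≈ᴹ-refl
  sum-zero {suc n} f eq =
    ≈ᴹ-trans (+ᴹ-cong (eq zero) (sum-zero (f ∘ suc) (eq ∘ suc))) (+ᴹ-identityˡ 0ᴹ)

  linComb-zero : ∀ {n} {a : Vector K n} (b : Vector Carrierᴹ n) →
                 (∀ i → a i ≈ 0#) → linComb a b ≈ᴹ 0ᴹ
  linComb-zero b eq = sum-zero _ (λ i → ≈ᴹ-trans (*ₗ-congʳ (eq i)) (*ₗ-zeroˡ (b i)))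

  sum-*ₗ : ∀ {n} c (f : Vector Carrierᴹ n) → c *ₗ sum f ≈ᴹ sum (λ i → c *ₗ f i)
  sum-*ₗ {zero}  c f = *ₗ-zeroʳ c
  sum-*ₗ {suc n} c f = ≈ᴹ-trans (*ₗ-distribˡ c _ _) (+ᴹ-congˡ (sum-*ₗ c (f ∘ suc)))

  linComb-+ : ∀ {n} (a a′ : Vector K n) (b : Vector Carrierᴹ n) →
              linComb (λ i → a i + a′ i) b ≈ᴹ linComb a b +ᴹ linComb a′ b
  linComb-+ a a′ b = ≈ᴹ-trans
    (sum-cong-≋ (λ i → *ₗ-distribʳ (b i) (a i) (a′ i)))
    (∑-distrib-+ (λ i → a i *ₗ b i) (λ i → a′ i *ₗ b i))

  linComb-* : ∀ {n} c (a : Vector K n) (b : Vector Carrierᴹ n) →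
              linComb (λ i → c * a i) b ≈ᴹ c *ₗ linComb a b
  linComb-* c a b = ≈ᴹ-trans
    (sum-cong-≋ (λ i → *ₗ-assoc c (a i) (b i)))
    (≈ᴹ-sym (sum-*ₗ c (λ i → a i *ₗ b i)))

  sum-split : ∀ m {n} (f : Vector Carrierᴹ (m ℕ.+ n)) →
              sum f ≈ᴹ sum (λ i → f (i ↑ˡ n)) +ᴹ sum (λ j → f (m ↑ʳ j))
  sum-split zero    f = ≈ᴹ-sym (+ᴹ-identityˡ _)
  sum-split (suc m) f =
    ≈ᴹ-trans (+ᴹ-congˡ (sum-split m (f ∘ suc))) (≈ᴹ-sym (+ᴹ-assoc _ _ _))

  -1*v≈-v : ∀ v → (- 1#) *ₗ v ≈ᴹ -ᴹ v
  -1*v≈-v v = inverseˡ-uniqueᴹ _ v (begin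
    (- 1#) *ₗ v +ᴹ v        ≈⟨ +ᴹ-congˡ (*ₗ-identityˡ v) ⟨
    (- 1#) *ₗ v +ᴹ 1# *ₗ v  ≈⟨ *ₗ-distribʳ v (- 1#) 1# ⟨
    ((- 1#) + 1#) *ₗ v      ≈⟨ *ₗ-congʳ (-‿inverseˡ 1#) ⟩
    0# *ₗ v                 ≈⟨ *ₗ-zeroˡ v ⟩
    0ᴹ                      ∎)

  v-v≈0 : ∀ {v w} → v ≈ᴹ w → v +ᴹ -ᴹ w ≈ᴹ 0ᴹ
  v-v≈0 eq = ≈ᴹ-trans (+ᴹ-congʳ eq) (-ᴹ‿inverseʳ _)

  v-w≈0⇒v≈w : ∀ {v w} → v +ᴹ -ᴹ w ≈ᴹ 0ᴹ → v ≈ᴹ w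
  v-w≈0⇒v≈w {v} {w} eq = begin
    v                  ≈⟨ +ᴹ-identityʳ v ⟨
    v +ᴹ 0ᴹ            ≈⟨ +ᴹ-congˡ (-ᴹ‿inverseˡ w) ⟨
    v +ᴹ (-ᴹ w +ᴹ w)   ≈⟨ +ᴹ-assoc v (-ᴹ w) w ⟨
    (v +ᴹ -ᴹ w) +ᴹ w   ≈⟨ +ᴹ-congʳ eq ⟩
    0ᴹ +ᴹ w            ≈⟨ +ᴹ-identityˡ w ⟩
    w                  ∎

  cancelˡ : ∀ {u w v} → u +ᴹ w ≈ᴹ v → w ≈ᴹ -ᴹ u +ᴹ v
  cancelˡ {u} {w} {v} eq = begin
    w                  ≈⟨ +ᴹ-identityˡ w ⟨
    0ᴹ +ᴹ w            ≈⟨ +ᴹ-congʳ (-ᴹ‿inverseˡ u) ⟨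
    (-ᴹ u +ᴹ u) +ᴹ w   ≈⟨ +ᴹ-assoc (-ᴹ u) u w ⟩
    -ᴹ u +ᴹ (u +ᴹ w)   ≈⟨ +ᴹ-congˡ eq ⟩
    -ᴹ u +ᴹ v          ∎

  independent⇒coefficients : ∀ {n} {b : Vector Carrierᴹ n} → LinearlyIndependent b →
    ∀ a a′ → linComb a b ≈ᴹ linComb a′ b → ∀ i → a i ≈ a′ i
  independent⇒coefficients {b = b} ind a a′ eq i = diff (ind d (begin
    linComb d b                                   ≈⟨ linComb-+ a (λ j → (- 1#) * a′ j) b ⟩
    linComb a b +ᴹ linComb (λ j → (- 1#) * a′ j) b ≈⟨ +ᴹ-congˡ (linComb-* (- 1#) a′ b) ⟩
    linComb a b +ᴹ (- 1#) *ₗ linComb a′ b          ≈⟨ +ᴹ-congˡ (-1*v≈-v _) ⟩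
    linComb a b +ᴹ -ᴹ linComb a′ b                 ≈⟨ v-v≈0 eq ⟩
    0ᴹ                                            ∎) i)
    where
    module R = FiniteField F
    open import Algebra.Properties.Ring R.ring using (-1*x≈-x)
    open import Algebra.Properties.AbelianGroup R.+-abelianGroup using (x∙y⁻¹≈ε⇒x≈y)
    d : Vector K _
    d j = a j + (- 1#) * a′ j
    diff : d i ≈ 0# → a i ≈ a′ i
    diff p = x∙y⁻¹≈ε⇒x≈y (a i) (a′ i) (R.trans (R.+-congˡ (R.sym (-1*x≈-x (a′ i)))) p)

module SpaceProperties {ℓ} {F : FiniteField ℓ} (E : FiniteDimensionalSpace F) where
  open FiniteField F using (K; _≈_; _+_; _*_; -_; 0#; 1#; order)
  open FiniteDimensionalSpace E
  open LinearProperties F leftModule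
  private
    module R = FiniteField F
    module K = Field F

  vector : Fin (order ^ dimension) → Carrierᴹ
  vector i = linComb (K.vectorOf i) basis

  vector-surjective : ∀ v → ∃ λ i → vector i ≈ᴹ v
  vector-surjective v with basis-spans v
  ... | a , eq = K.indexOf a ,
    ≈ᴹ-trans (linComb-cong basis (K.vectorOf-indexOf a)) (≈ᴹ-sym eq)

  any? : ∀ {p} {P : Pred Carrierᴹ p} → P Respects _≈ᴹ_ → Decidable P → Dec (∃ P)
  any? resp P? = Dec.map′
    (λ (i , p) → vector i , p)
    (λ (v , p) → let i , eq = vector-surjective v in i , resp (≈ᴹ-sym eq) p)
    (Fin.any? (P? ∘ vector))

  ≈0? : Decidable (_≈ᴹ 0ᴹ)
  ≈0? v with basis-spans v
  ... | a , eq = Dec.map′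
    (λ z → ≈ᴹ-trans eq (linComb-zero basis z))
    (λ z → basis-independent a (≈ᴹ-trans (≈ᴹ-sym eq) z))
    (Fin.all? (λ i → a i K.≟ 0#))

  _≟ᴹ_ : Decidable₂ _≈ᴹ_
  v ≟ᴹ w = Dec.map′ v-w≈0⇒v≈w v-v≈0 (≈0? (v +ᴹ -ᴹ w))

  elements : List Carrierᴹ
  elements = List.tabulate vector

  elements-complete : ∀ v → Any (_≈ᴹ_ v) elements
  elements-complete v with vector-surjective v
  ... | i , eq = Any.tabulate⁺ i (≈ᴹ-sym eq)

module _ {ℓ} {F : FiniteField ℓ} {E : FiniteDimensionalSpace F} where
  open FiniteField F using (K; _≈_; _+_; _*_; -_; 0#; 1#; order)
  open FiniteDimensionalSpace E
  open LinearProperties F leftModule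
  open SpaceProperties E
  open Subspace
  private
    module R = FiniteField F
    module K = Field F
    module +ᴹ = CommutativeSemigroupProperties
      (CommutativeMonoid.commutativeSemigroup +ᴹ-commutativeMonoid)

  0ˢ : Subspace E
  0ˢ = record
    { Member    = _≈ᴹ 0ᴹ
    ; member?   = ≈0?
    ; respects  = λ eq p → ≈ᴹ-trans (≈ᴹ-sym eq) p
    ; 0-closed  = ≈ᴹ-refl
    ; +-closed  = λ p q → ≈ᴹ-trans (+ᴹ-cong p q) (+ᴹ-identityˡ 0ᴹ)
    ; *ₗ-closed = λ c p → ≈ᴹ-trans (*ₗ-congˡ p) (*ₗ-zeroʳ c)
    }

  infixl 6 _+ˢ_
  infixl 7 _∩_

  _+ˢ_ : Subspace E → Subspace E → Subspace E
  V +ˢ W = record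
    { Member    = λ v → ∃₂ λ x y → x ∈ V × y ∈ W × x +ᴹ y ≈ᴹ v
    ; member?   = λ v → any?
        (λ eq (y , x∈V , y∈W , s) →
          y , respects V eq x∈V , y∈W , ≈ᴹ-trans (+ᴹ-congʳ (≈ᴹ-sym eq)) s)
        (λ x → any?
          (λ eq (x∈V , y∈W , s) →
            x∈V , respects W eq y∈W , ≈ᴹ-trans (+ᴹ-congˡ (≈ᴹ-sym eq)) s)
          (λ y → member? V x ×-dec member? W y ×-dec (x +ᴹ y) ≟ᴹ v))
    ; respects  = λ eq (x , y , x∈V , y∈W , s) → x , y , x∈V , y∈W , ≈ᴹ-trans s eq
    ; 0-closed  = 0ᴹ , 0ᴹ , 0-closed V , 0-closed W , +ᴹ-identityˡ 0ᴹ
    ; +-closed  = λ (x , y , x∈V , y∈W , s) (x′ , y′ , x′∈V , y′∈W , s′) →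
        x +ᴹ x′ , y +ᴹ y′ , +-closed V x∈V x′∈V , +-closed W y∈W y′∈W ,
        ≈ᴹ-trans (+ᴹ.interchange x x′ y y′) (+ᴹ-cong s s′)
    ; *ₗ-closed = λ c (x , y , x∈V , y∈W , s) →
        c *ₗ x , c *ₗ y , *ₗ-closed V c x∈V , *ₗ-closed W c y∈W ,
        ≈ᴹ-trans (≈ᴹ-sym (*ₗ-distribˡ c x y)) (*ₗ-congˡ s)
    }

  _∩_ : Subspace E → Subspace E → Subspace E
  V ∩ W = record
    { Member    = λ v → v ∈ V × v ∈ W
    ; member?   = λ v → member? V v ×-dec member? W v
    ; respects  = λ eq (p , q) → respects V eq p , respects W eq q
    ; 0-closed  = 0-closed V , 0-closed W
    ; +-closed  = λ (p , q) (p′ , q′) → +-closed V p p′ , +-closed W q q′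
    ; *ₗ-closed = λ c (p , q) → *ₗ-closed V c p , *ₗ-closed W c q
    }

  ⟨_⟩ : Carrierᴹ → Subspace E
  ⟨ x ⟩ = record
    { Member    = λ v → ∃ λ c → c *ₗ x ≈ᴹ v
    ; member?   = λ v → K.any? (λ eq p → ≈ᴹ-trans (*ₗ-congʳ (R.sym eq)) p) (λ c → (c *ₗ x) ≟ᴹ v)
    ; respects  = λ eq (c , p) → c , ≈ᴹ-trans p eq
    ; 0-closed  = 0# , *ₗ-zeroˡ x
    ; +-closed  = λ (c , p) (d , q) → c + d , ≈ᴹ-trans (*ₗ-distribʳ x c d) (+ᴹ-cong p q)
    ; *ₗ-closed = λ a (c , p) → a * c , ≈ᴹ-trans (*ₗ-assoc a c x) (*ₗ-congˡ p)
    }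

  span : List Carrierᴹ → Subspace E
  span []       = 0ˢ
  span (x ∷ xs) = ⟨ x ⟩ +ˢ span xs

  -ᴹ-closed : ∀ (V : Subspace E) {v} → v ∈ V → -ᴹ v ∈ V
  -ᴹ-closed V p = respects V (-1*v≈-v _) (*ₗ-closed V (- 1#) p)

  linComb-closed : ∀ (V : Subspace E) {n} (a : Vector K n) {b} →
                   (∀ i → b i ∈ V) → linComb a b ∈ V
  linComb-closed V {zero}  a p = 0-closed V
  linComb-closed V {suc n} a p =
    +-closed V (*ₗ-closed V (a zero) (p zero)) (linComb-closed V (a ∘ suc) (p ∘ suc))

  0ˢ⊆ : ∀ (V : Subspace E) → 0ˢ ⊆ V
  0ˢ⊆ V eq = respects V (≈ᴹ-sym eq) (0-closed V)

  ⊆-+ˡ : ∀ (V W : Subspace E) → V ⊆ V +ˢ W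
  ⊆-+ˡ V W {v} p = v , 0ᴹ , p , 0-closed W , +ᴹ-identityʳ v

  ⊆-+ʳ : ∀ (V W : Subspace E) → W ⊆ V +ˢ W
  ⊆-+ʳ V W {v} p = 0ᴹ , v , 0-closed V , p , +ᴹ-identityˡ v

  +-lub : ∀ {V W} (Z : Subspace E) → V ⊆ Z → W ⊆ Z → V +ˢ W ⊆ Z
  +-lub Z f g (x , y , p , q , s) = respects Z s (+-closed Z (f p) (g q))

  x∈⟨x⟩ : ∀ x → x ∈ ⟨ x ⟩
  x∈⟨x⟩ x = 1# , *ₗ-identityˡ x

  ⟨⟩⊆ : ∀ (V : Subspace E) {x} → x ∈ V → ⟨ x ⟩ ⊆ V
  ⟨⟩⊆ V p (c , s) = respects V s (*ₗ-closed V c p)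

  span⊆ : ∀ (V : Subspace E) {xs} → All (_∈ V) xs → span xs ⊆ V
  span⊆ V []       = 0ˢ⊆ V
  span⊆ V {x ∷ xs} (p ∷ ps) = +-lub {⟨ x ⟩} {span xs} V (⟨⟩⊆ V p) (span⊆ V ps)

  ∈-span : ∀ {v xs} → Any (v ≈ᴹ_) xs → v ∈ span xs
  ∈-span {v} {x ∷ xs} (here eq)  =
    ⊆-+ˡ ⟨ x ⟩ (span xs) (respects ⟨ x ⟩ (≈ᴹ-sym eq) (x∈⟨x⟩ x))
  ∈-span {v} {x ∷ xs} (there p) = ⊆-+ʳ ⟨ x ⟩ (span xs) (∈-span p)

  -- Chain U V k: V is obtained from U by successively adjoining k vectors,
  -- each outside the subspace reached so far.
  data Chain : Subspace E → Subspace E → ℕ → Set (lsuc ℓ) where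
    done : ∀ {U V} → U ⊆ V → V ⊆ U → Chain U V 0
    step : ∀ {U V k} x → x ∈ V → ¬ (x ∈ U) → Chain (U +ˢ ⟨ x ⟩) V k → Chain U V (suc k)

  Chain-respˡ : ∀ {U U′ V k} → U ⊆ U′ → U′ ⊆ U → Chain U V k → Chain U′ V k
  Chain-respˡ f g (done p q) = done (λ z → p (g z)) (λ z → f (q z))
  Chain-respˡ {U} {U′} f g (step x x∈V x∉U c) = step x x∈V (λ z → x∉U (g z)) (Chain-respˡ
    (+-lub {U} {⟨ x ⟩} (U′ +ˢ ⟨ x ⟩) (λ z → ⊆-+ˡ U′ ⟨ x ⟩ (f z)) (⊆-+ʳ U′ ⟨ x ⟩))
    (+-lub {U′} {⟨ x ⟩} (U +ˢ ⟨ x ⟩) (λ z → ⊆-+ˡ U ⟨ x ⟩ (g z)) (⊆-+ʳ U ⟨ x ⟩))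
    c)

  chain : ∀ U V → U ⊆ V → ∃ (Chain U V)
  chain U V U⊆V = go elements U U⊆V (λ v _ → inj₂ (elements-complete v))
    where
    go : ∀ xs U → U ⊆ V → (∀ v → v ∈ V → v ∈ U ⊎ Any (v ≈ᴹ_) xs) → ∃ (Chain U V)
    go [] U U⊆V cover = 0 , done U⊆V (λ {v} p → [ id , (λ ()) ]′ (cover v p))
    go (x ∷ xs) U U⊆V cover with member? V x | member? U x
    ... | yes x∈V | no x∉U =
      let k , c = go xs (U +ˢ ⟨ x ⟩) (+-lub {U} {⟨ x ⟩} V U⊆V (⟨⟩⊆ V x∈V)) cover′
      in suc k , step x x∈V x∉U c
      where
      cover′ : ∀ v → v ∈ V → v ∈ (U +ˢ ⟨ x ⟩) ⊎ Any (v ≈ᴹ_) xs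
      cover′ v p with cover v p
      ... | inj₁ q          = inj₁ (⊆-+ˡ U ⟨ x ⟩ q)
      ... | inj₂ (here eq)  = inj₁ (⊆-+ʳ U ⟨ x ⟩ (respects ⟨ x ⟩ (≈ᴹ-sym eq) (x∈⟨x⟩ x)))
      ... | inj₂ (there q)  = inj₂ q
    ... | no x∉V | _ = go xs U U⊆V cover′
      where
      cover′ : ∀ v → v ∈ V → v ∈ U ⊎ Any (v ≈ᴹ_) xs
      cover′ v p with cover v p
      ... | inj₁ q         = inj₁ q
      ... | inj₂ (here eq) = contradiction (respects V eq p) x∉V
      ... | inj₂ (there q) = inj₂ q
    ... | yes _ | yes x∈U = go xs U U⊆V cover′
      where
      cover′ : ∀ v → v ∈ V → v ∈ U ⊎ Any (v ≈ᴹ_) xs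
      cover′ v p with cover v p
      ... | inj₁ q         = inj₁ q
      ... | inj₂ (here eq) = inj₁ (respects U (≈ᴹ-sym eq) x∈U)
      ... | inj₂ (there q) = inj₂ q

  basis-0ˢ : Basis 0ˢ
  basis-0ˢ = record
    { size = 0 ; vectors = λ () ; vectors∈ = λ () ; independent = λ _ _ ()
    ; spans = λ v v≈0 → (λ ()) , v≈0 }

  basis-resp : ∀ {U V : Subspace E} → U ⊆ V → V ⊆ U → Basis U → Basis V
  basis-resp U⊆V V⊆U B = record
    { size = size ; vectors = vectors ; vectors∈ = λ i → U⊆V (vectors∈ i)
    ; independent = independent ; spans = λ v p → spans v (V⊆U p) }
    where open Basis B

  basis-adjoin : ∀ {U} (B : Basis U) x → ¬ (x ∈ U) →
                 Σ (Basis (U +ˢ ⟨ x ⟩)) λ C → Basis.size C ≡ suc (Basis.size B)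
  basis-adjoin {U} B x x∉U = record
    { size        = suc size
    ; vectors     = x Vector.∷ vectors
    ; vectors∈    = λ { zero → ⊆-+ʳ U ⟨ x ⟩ (x∈⟨x⟩ x) ; (suc i) → ⊆-+ˡ U ⟨ x ⟩ (vectors∈ i) }
    ; independent = ind
    ; spans       = λ v (u , w , u∈U , (c , cx≈w) , s) →
        let a , eq = spans u u∈U in
        (c Vector.∷ a) , ≈ᴹ-trans (≈ᴹ-sym s)
          (≈ᴹ-trans (+ᴹ-comm u w) (+ᴹ-cong (≈ᴹ-sym cx≈w) eq))
    } , ≡.refl
    where
    open Basis B
    ind : LinearlyIndependent (x Vector.∷ vectors)
    ind a eq with a zero K.≟ 0#
    ... | yes a₀≈0 = λ { zero → a₀≈0 ; (suc i) → independent (a ∘ suc) rest i }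
      where
      rest : linComb (a ∘ suc) vectors ≈ᴹ 0ᴹ
      rest = ≈ᴹ-trans (≈ᴹ-sym (≈ᴹ-trans
        (+ᴹ-congʳ (≈ᴹ-trans (*ₗ-congʳ a₀≈0) (*ₗ-zeroˡ x))) (+ᴹ-identityˡ _))) eq
    ... | no a₀≉0 = contradiction x∈U x∉U
      where
      rest : Carrierᴹ
      rest = linComb (a ∘ suc) vectors
      y : K
      y = proj₁ (R.invertible (a zero) a₀≉0)
      a₀x∈U : a zero *ₗ x ∈ U
      a₀x∈U = respects U
        (≈ᴹ-sym (≈ᴹ-trans (cancelˡ (≈ᴹ-trans (+ᴹ-comm rest _) eq)) (+ᴹ-identityʳ _)))
        (-ᴹ-closed U (linComb-closed U (a ∘ suc) vectors∈))
      x∈U : x ∈ U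
      x∈U = respects U
        (≈ᴹ-trans (≈ᴹ-sym (*ₗ-assoc y (a zero) x))
          (≈ᴹ-trans (*ₗ-congʳ (K.cancel (proj₂ (R.invertible (a zero) a₀≉0)))) (*ₗ-identityˡ x)))
        (*ₗ-closed U y a₀x∈U)

  basis-chain : ∀ {U V k} (B : Basis U) → Chain U V k →
                Σ (Basis V) λ C → Basis.size C ≡ k ℕ.+ Basis.size B
  basis-chain {U} {V} B (done p q) = basis-resp {U} {V} p q B , ≡.refl
  basis-chain B (step {k = k} x x∈V x∉U c) =
    let C , eq = basis-adjoin B x x∉U
        D , eq′ = basis-chain C c
    in D , ≡.trans eq′ (≡.trans (≡.cong (k ℕ.+_) eq) (ℕ.+-suc k (Basis.size B)))

  abstract
    basisOf : (V : Subspace E) → Basis V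
    basisOf V = proj₁ (basis-chain basis-0ˢ (proj₂ (chain 0ˢ V (0ˢ⊆ V))))

  -- By size-unique below, this is the size of every basis of V.
  dim : Subspace E → ℕ
  dim V = Basis.size (basisOf V)

  size-mono : ∀ {V W} → V ⊆ W → (B : Basis V) (C : Basis W) → Basis.size B ℕ.≤ Basis.size C
  size-mono {V} {W} V⊆W B C with Basis.size B ℕ.≤? Basis.size C
  ... | yes m≤n = m≤n
  ... | no  m≰n = contradiction
    (Fin.injective⇒≤ {f = φ} (λ {i} {j} → φ-injective i j))
    (ℕ.<⇒≱ (ℕ.^-monoʳ-< order K.1<order (ℕ.≰⇒> m≰n)))
    where
    module B = Basis B
    module C = Basis C
    lc : Fin (order ^ B.size) → Carrierᴹ
    lc i = linComb (K.vectorOf i) B.vectors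
    coords : ∀ i → ∃ λ a → lc i ≈ᴹ linComb a C.vectors
    coords i = C.spans (lc i) (V⊆W (linComb-closed V (K.vectorOf i) B.vectors∈))
    φ : Fin (order ^ B.size) → Fin (order ^ C.size)
    φ i = K.indexOf (proj₁ (coords i))
    φ-injective : ∀ i j → φ i ≡ φ j → i ≡ j
    φ-injective i j eq = K.vectorOf-injective i j
      (independent⇒coefficients B.independent _ _
        (≈ᴹ-trans (proj₂ (coords i)) (≈ᴹ-trans
          (linComb-cong C.vectors
            (K.indexOf-injective (proj₁ (coords i)) (proj₁ (coords j)) eq))
          (≈ᴹ-sym (proj₂ (coords j))))))

  size-unique : ∀ {V} (B : Basis V) → Basis.size B ≡ dim V
  size-unique {V} B = ℕ.≤-antisym (size-mono {V} id B (basisOf V)) (size-mono {V} id (basisOf V) B)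

  dim-mono : ∀ {V W} → V ⊆ W → dim V ℕ.≤ dim W
  dim-mono {V} {W} p = size-mono {V} {W} p (basisOf V) (basisOf W)

  dim-cong : ∀ {V W} → V ⊆ W → W ⊆ V → dim V ≡ dim W
  dim-cong {V} {W} p q = ℕ.≤-antisym (dim-mono {V} {W} p) (dim-mono {W} {V} q)

  dim-0ˢ : dim 0ˢ ≡ 0
  dim-0ˢ = ≡.sym (size-unique basis-0ˢ)

  dim-chain : ∀ {U V k} → Chain U V k → dim V ≡ k ℕ.+ dim U
  dim-chain {U} c = let C , eq = basis-chain (basisOf U) c in ≡.trans (≡.sym (size-unique C)) eq

  chain-+ : ∀ {U V k} (W : Subspace E) → V ∩ W ⊆ U → U ⊆ V → Chain U V k →
            Chain (U +ˢ W) (V +ˢ W) k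
  chain-+ {U} {V} W p q (done f g) = done
    (+-lub {U} {W} (V +ˢ W) (λ z → ⊆-+ˡ V W (f z)) (⊆-+ʳ V W))
    (+-lub {V} {W} (U +ˢ W) (λ z → ⊆-+ˡ U W (g z)) (⊆-+ʳ U W))
  chain-+ {U} {V} W p q (step {k = k} x x∈V x∉U c) = step x (⊆-+ˡ V W x∈V) x∉
    (Chain-respˡ
      (+-lub {U +ˢ ⟨ x ⟩} {W} UWx
        (+-lub {U} {⟨ x ⟩} UWx (λ z → ⊆-+ˡ (U +ˢ W) ⟨ x ⟩ (⊆-+ˡ U W z)) (⊆-+ʳ (U +ˢ W) ⟨ x ⟩))
        (λ z → ⊆-+ˡ (U +ˢ W) ⟨ x ⟩ (⊆-+ʳ U W z)))
      (+-lub {U +ˢ W} {⟨ x ⟩} UxW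
        (+-lub {U} {W} UxW (λ z → ⊆-+ˡ (U +ˢ ⟨ x ⟩) W (⊆-+ˡ U ⟨ x ⟩ z)) (⊆-+ʳ (U +ˢ ⟨ x ⟩) W))
        (λ z → ⊆-+ˡ (U +ˢ ⟨ x ⟩) W (⊆-+ʳ U ⟨ x ⟩ z)))
      (chain-+ W (λ z → ⊆-+ˡ U ⟨ x ⟩ (p z)) (+-lub {U} {⟨ x ⟩} V q (⟨⟩⊆ V x∈V)) c))
    where
    UWx UxW : Subspace E
    UWx = (U +ˢ W) +ˢ ⟨ x ⟩
    UxW = (U +ˢ ⟨ x ⟩) +ˢ W
    x∉ : ¬ (x ∈ U +ˢ W)
    x∉ (u , w , u∈U , w∈W , s) = x∉U (respects U s (+-closed U u∈U (p (w∈V , w∈W))))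
      where
      w∈V : w ∈ V
      w∈V = respects V (≈ᴹ-sym (cancelˡ s)) (+-closed V (-ᴹ-closed V (q u∈U)) x∈V)

  dim-modular : ∀ V W → dim (V +ˢ W) ℕ.+ dim (V ∩ W) ≡ dim V ℕ.+ dim W
  dim-modular V W with chain (V ∩ W) V proj₁
  ... | k , c = begin
    dim (V +ˢ W) ℕ.+ dim (V ∩ W)      ≡⟨ ≡.cong (ℕ._+ dim (V ∩ W)) eq ⟩
    (k ℕ.+ dim W) ℕ.+ dim (V ∩ W)     ≡⟨ ℕ.+-assoc k (dim W) _ ⟩
    k ℕ.+ (dim W ℕ.+ dim (V ∩ W))     ≡⟨ ≡.cong (k ℕ.+_) (ℕ.+-comm (dim W) _) ⟩
    k ℕ.+ (dim (V ∩ W) ℕ.+ dim W)     ≡⟨ ℕ.+-assoc k _ _ ⟨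
    (k ℕ.+ dim (V ∩ W)) ℕ.+ dim W     ≡⟨ ≡.cong (ℕ._+ dim W) (dim-chain c) ⟨
    dim V ℕ.+ dim W                   ∎
    where
    open ≡.≡-Reasoning
    eq : dim (V +ˢ W) ≡ k ℕ.+ dim W
    eq = ≡.trans (dim-chain (chain-+ W id proj₁ c)) (≡.cong (k ℕ.+_)
      (dim-cong {(V ∩ W) +ˢ W} {W} (+-lub {V ∩ W} {W} W proj₂ id) (⊆-+ʳ (V ∩ W) W)))

  sublists : ∀ {a} {A : Set a} → List A → List (List A)
  sublists []       = [] ∷ []
  sublists (x ∷ xs) = List.map (x ∷_) (sublists xs) List.++ sublists xs

  filter∈sublists : ∀ {a p} {A : Set a} {P : Pred A p} (P? : Decidable P) xs →
                    List.filter P? xs ∈ᴸ sublists xs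
  filter∈sublists P? [] = here ≡.refl
  filter∈sublists P? (x ∷ xs) with P? x
  ... | yes _ = ∈ᴸ.∈-++⁺ˡ (∈ᴸ.∈-map⁺ (x ∷_) (filter∈sublists P? xs))
  ... | no  _ = ∈ᴸ.∈-++⁺ʳ (List.map (x ∷_) (sublists xs)) (filter∈sublists P? xs)

  sublists-All : ∀ {a p} {A : Set a} {P : Pred A p} {xs} → All P xs → All (All P) (sublists xs)
  sublists-All []       = [] ∷ []
  sublists-All (p ∷ ps) =
    All.++⁺ (All.map⁺ (All.map (p ∷_) (sublists-All ps))) (sublists-All ps)

  abstract
    minimiser : (g : Subspace E → ℤ) → (∀ {X Y} → X ⊆ Y → Y ⊆ X → g X ≡ g Y) → ∀ V →
                ∃ λ X → X ⊆ V × (∀ Y → Y ⊆ V → g X ℤ.≤ g Y)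
    minimiser g g-cong V = X , X⊆V , least
      where
      inV : List Carrierᴹ
      inV = List.filter (member? V) elements
      candidates : List (Subspace E)
      candidates = List.map span (sublists inV)
      X : Subspace E
      X = argmin g 0ˢ candidates
      X⊆V : X ⊆ V
      X⊆V {v} = argmin-all g {P = λ Y → v ∈ Y → v ∈ V} (0ˢ⊆ V)
        (All.map⁺ (All.map (λ ps → span⊆ V ps) (sublists-All (All.all-filter (member? V) elements))))
      least : ∀ Y → Y ⊆ V → g X ℤ.≤ g Y
      least Y Y⊆V = ≡.subst (g X ℤ.≤_) (g-cong {span ys} {Y} Y′⊆Y Y⊆Y′)
        (All.lookup (f[argmin]≤f[xs] {f = g} 0ˢ candidates)
          (∈ᴸ.∈-map⁺ span (filter∈sublists (member? Y) inV)))
        where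
        ys : List Carrierᴹ
        ys = List.filter (member? Y) inV
        Y′⊆Y : span ys ⊆ Y
        Y′⊆Y = span⊆ Y (All.all-filter (member? Y) inV)
        keep : ∀ (Z : Subspace E) {v xs} → v ∈ Z → Any (v ≈ᴹ_) xs →
               Any (v ≈ᴹ_) (List.filter (member? Z) xs)
        keep Z {xs = x ∷ xs} v∈Z p with member? Z x
        keep Z v∈Z (here eq) | yes _  = here eq
        keep Z v∈Z (there p) | yes _  = there (keep Z v∈Z p)
        keep Z v∈Z (here eq) | no x∉Z = contradiction (respects Z eq v∈Z) x∉Z
        keep Z v∈Z (there p) | no _   = keep Z v∈Z p
        Y⊆Y′ : Y ⊆ span ys
        Y⊆Y′ {v} v∈Y = ∈-span (keep Y v∈Y (keep V (Y⊆V v∈Y) (elements-complete v)))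

module _ {ℓ} {F : FiniteField ℓ} where
  open FiniteField F using (K; ring; _≈_; 0#)
  open FiniteDimensionalSpace hiding (linComb; LinearlyIndependent)
  private
    module R = FiniteField F
    module K = Field F

  IsLinear IsLinearIsomorphism : ∀ (E₁ E₂ : FiniteDimensionalSpace F) →
                                 (Carrierᴹ E₁ → Carrierᴹ E₂) → Set ℓ
  IsLinear E₁ E₂ = LeftModuleMorphisms.IsLeftModuleHomomorphism
    (LeftModule.rawLeftModule (leftModule E₁)) (LeftModule.rawLeftModule (leftModule E₂))
  IsLinearIsomorphism E₁ E₂ = LeftModuleMorphisms.IsLeftModuleIsomorphism
    (LeftModule.rawLeftModule (leftModule E₁)) (LeftModule.rawLeftModule (leftModule E₂))

  linear : ∀ (E₁ E₂ : FiniteDimensionalSpace F) {f : Carrierᴹ E₁ → Carrierᴹ E₂} →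
           (∀ {v w} → _≈ᴹ_ E₁ v w → _≈ᴹ_ E₂ (f v) (f w)) →
           (∀ v w → _≈ᴹ_ E₂ (f (_+ᴹ_ E₁ v w)) (_+ᴹ_ E₂ (f v) (f w))) →
           (∀ c v → _≈ᴹ_ E₂ (f (_*ₗ_ E₁ c v)) (_*ₗ_ E₂ c (f v))) →
           IsLinear E₁ E₂ f
  linear E₁ E₂ {f} cong + * = record
    { +ᴹ-isGroupHomomorphism = record
      { isMonoidHomomorphism = record
        { isMagmaHomomorphism = record
          { isRelHomomorphism = record { cong = cong }
          ; homo = +
          }
        ; ε-homo = E₂.≈ᴹ-trans (cong (E₁.≈ᴹ-sym (E₁.*ₗ-zeroˡ E₁.0ᴹ)))
            (E₂.≈ᴹ-trans (* 0# E₁.0ᴹ) (E₂.*ₗ-zeroˡ _))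
        }
      ; ⁻¹-homo = λ v → E₂.≈ᴹ-trans (cong (E₁.≈ᴹ-sym (-1*v≈-v E₁ v)))
          (E₂.≈ᴹ-trans (* (R.- R.1#) v) (-1*v≈-v E₂ (f v)))
      }
    ; *ₗ-homo = *
    }
    where
    module E₁ = FiniteDimensionalSpace E₁
    module E₂ = FiniteDimensionalSpace E₂
    -1*v≈-v : ∀ E v → _≈ᴹ_ E (_*ₗ_ E (R.- R.1#) v) (-ᴹ_ E v)
    -1*v≈-v E = LinearProperties.-1*v≈-v F (leftModule E)

  image : ∀ {E₁ E₂ : FiniteDimensionalSpace F} {f : Carrierᴹ E₁ → Carrierᴹ E₂} →
          IsLinear E₁ E₂ f → Subspace E₁ → Subspace E₂
  image {E₁} {E₂} {f} lin V = record
    { Member    = λ w → ∃ λ v → v ∈ V × f v E₂.≈ᴹ w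
    ; member?   = λ w → SpaceProperties.any? E₁
        (λ eq (p , q) → V.respects eq p , E₂.≈ᴹ-trans (⟦⟧-cong (E₁.≈ᴹ-sym eq)) q)
        (λ v → V.member? v ×-dec SpaceProperties._≟ᴹ_ E₂ (f v) w)
    ; respects  = λ eq (v , p , q) → v , p , E₂.≈ᴹ-trans q eq
    ; 0-closed  = E₁.0ᴹ , V.0-closed , 0ᴹ-homo
    ; +-closed  = λ (v , p , q) (v′ , p′ , q′) →
        v E₁.+ᴹ v′ , V.+-closed p p′ , E₂.≈ᴹ-trans (+ᴹ-homo v v′) (E₂.+ᴹ-cong q q′)
    ; *ₗ-closed = λ c (v , p , q) →
        c E₁.*ₗ v , V.*ₗ-closed c p , E₂.≈ᴹ-trans (*ₗ-homo c v) (E₂.*ₗ-congˡ q)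
    }
    where
    module E₁ = FiniteDimensionalSpace E₁
    module E₂ = FiniteDimensionalSpace E₂
    module V = Subspace V
    open LeftModuleMorphisms.IsLeftModuleHomomorphism lin

  infixr 6 _⊕ˢ_

  _⊕ˢ_ : FiniteDimensionalSpace F → FiniteDimensionalSpace F → FiniteDimensionalSpace F
  E₁ ⊕ˢ E₂ = record
    { leftModule        = P
    ; dimension         = m ℕ.+ n
    ; basis             = b
    ; basis-independent = independent
    ; basis-spans       = spans
    }
    where
    module E₁ = FiniteDimensionalSpace E₁
    module E₂ = FiniteDimensionalSpace E₂
    module L₁ = LinearProperties F E₁.leftModule
    module L₂ = LinearProperties F E₂.leftModule
    P : LeftModule ring ℓ ℓ
    P = DirectProduct.leftModule E₁.leftModule E₂.leftModule
    module P = LeftModule P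
    module LP = LinearProperties F P
    open Linear F P using (linComb; LinearlyIndependent)
    open Sum P.+ᴹ-commutativeMonoid using (sum; sum-cong-≋)
    m n : ℕ
    m = E₁.dimension
    n = E₂.dimension
    b : Vector P.Carrierᴹ (m ℕ.+ n)
    b k = [ (λ i → E₁.basis i , E₂.0ᴹ) , (λ j → E₁.0ᴹ , E₂.basis j) ]′ (splitAt m k)
    sum-left : ∀ {k} (a : Vector K k) (c : Vector E₁.Carrierᴹ k) →
               sum (λ i → a i P.*ₗ (c i , E₂.0ᴹ)) P.≈ᴹ (E₁.linComb a c , E₂.0ᴹ)
    sum-left {zero}  a c = P.≈ᴹ-refl
    sum-left {suc k} a c = P.≈ᴹ-trans (P.+ᴹ-congˡ (sum-left (a ∘ suc) (c ∘ suc)))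
      (E₁.≈ᴹ-refl , E₂.≈ᴹ-trans (E₂.+ᴹ-identityʳ _) (E₂.*ₗ-zeroʳ _))
    sum-right : ∀ {k} (a : Vector K k) (c : Vector E₂.Carrierᴹ k) →
                sum (λ i → a i P.*ₗ (E₁.0ᴹ , c i)) P.≈ᴹ (E₁.0ᴹ , E₂.linComb a c)
    sum-right {zero}  a c = P.≈ᴹ-refl
    sum-right {suc k} a c = P.≈ᴹ-trans (P.+ᴹ-congˡ (sum-right (a ∘ suc) (c ∘ suc)))
      (E₁.≈ᴹ-trans (E₁.+ᴹ-identityʳ _) (E₁.*ₗ-zeroʳ _) , E₂.≈ᴹ-refl)
    linComb-split : ∀ (a : Vector K (m ℕ.+ n)) →
      linComb a b P.≈ᴹ (E₁.linComb (λ i → a (i ↑ˡ n)) E₁.basis ,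
                        E₂.linComb (λ j → a (m ↑ʳ j)) E₂.basis)
    linComb-split a = P.≈ᴹ-trans (LP.sum-split m (λ k → a k P.*ₗ b k)) (P.≈ᴹ-trans
      (P.+ᴹ-cong
        (P.≈ᴹ-trans (sum-cong-≋ (λ i → P.≈ᴹ-reflexive (≡.cong (λ z → a (i ↑ˡ n) P.*ₗ
          [ (λ i → E₁.basis i , E₂.0ᴹ) , (λ j → E₁.0ᴹ , E₂.basis j) ]′ z) (Fin.splitAt-↑ˡ m i n))))
          (sum-left (λ i → a (i ↑ˡ n)) E₁.basis))
        (P.≈ᴹ-trans (sum-cong-≋ (λ j → P.≈ᴹ-reflexive (≡.cong (λ z → a (m ↑ʳ j) P.*ₗ
          [ (λ i → E₁.basis i , E₂.0ᴹ) , (λ j → E₁.0ᴹ , E₂.basis j) ]′ z) (Fin.splitAt-↑ʳ m n j))))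
          (sum-right (λ j → a (m ↑ʳ j)) E₂.basis)))
      (E₁.+ᴹ-identityʳ _ , E₂.+ᴹ-identityˡ _))
    independent : LinearlyIndependent b
    independent a eq k = ≡.subst (λ z → a z ≈ 0#) (Fin.join-splitAt m n k) (go (splitAt m k))
      where
      eq′ : (E₁.linComb (λ i → a (i ↑ˡ n)) E₁.basis ,
             E₂.linComb (λ j → a (m ↑ʳ j)) E₂.basis) P.≈ᴹ P.0ᴹ
      eq′ = P.≈ᴹ-trans (P.≈ᴹ-sym (linComb-split a)) eq
      go : ∀ s → a (Fin.join m n s) ≈ 0#
      go (inj₁ i) = E₁.basis-independent (λ i → a (i ↑ˡ n)) (proj₁ eq′) i
      go (inj₂ j) = E₂.basis-independent (λ j → a (m ↑ʳ j)) (proj₂ eq′) j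
    spans : ∀ v → ∃ λ a → v P.≈ᴹ linComb a b
    spans (v , w) with E₁.basis-spans v | E₂.basis-spans w
    ... | a , p | c , q = d , P.≈ᴹ-sym (P.≈ᴹ-trans (linComb-split d)
      ( E₁.≈ᴹ-trans (L₁.linComb-cong E₁.basis (λ i →
          R.reflexive (≡.cong [ a , c ]′ (Fin.splitAt-↑ˡ m i n)))) (E₁.≈ᴹ-sym p)
      , E₂.≈ᴹ-trans (L₂.linComb-cong E₂.basis (λ j →
          R.reflexive (≡.cong [ a , c ]′ (Fin.splitAt-↑ʳ m n j)))) (E₂.≈ᴹ-sym q)))
      where
      d : Vector K (m ℕ.+ n)
      d k = [ a , c ]′ (splitAt m k)

  proj₁-linear : ∀ (E₁ E₂ : FiniteDimensionalSpace F) → IsLinear (E₁ ⊕ˢ E₂) E₁ proj₁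
  proj₁-linear E₁ E₂ = linear (E₁ ⊕ˢ E₂) E₁ proj₁ (λ _ _ → ≈ᴹ-refl E₁) (λ _ _ → ≈ᴹ-refl E₁)

  proj₂-linear : ∀ (E₁ E₂ : FiniteDimensionalSpace F) → IsLinear (E₁ ⊕ˢ E₂) E₂ proj₂
  proj₂-linear E₁ E₂ = linear (E₁ ⊕ˢ E₂) E₂ proj₂ (λ _ _ → ≈ᴹ-refl E₂) (λ _ _ → ≈ᴹ-refl E₂)

  zeroSpace : FiniteDimensionalSpace F
  zeroSpace = record
    { leftModule        = Zero.leftModule
    ; dimension         = 0
    ; basis             = λ ()
    ; basis-independent = λ _ _ ()
    ; basis-spans       = λ _ → (λ ()) , tt
    }

  ⌊_⌋ : ∀ {E : FiniteDimensionalSpace F} → Subspace E → FiniteDimensionalSpace F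
  ⌊_⌋ {E} V = record
    { leftModule        = S
    ; dimension         = B.size
    ; basis             = λ i → B.vectors i , B.vectors∈ i
    ; basis-independent = λ a eq → B.independent a
        (E.≈ᴹ-trans (E.≈ᴹ-reflexive (≡.sym (linComb-proj₁ a (λ i → B.vectors i , B.vectors∈ i)))) eq)
    ; basis-spans       = λ (v , p) → let a , eq = B.spans v p in
        a , E.≈ᴹ-trans eq (E.≈ᴹ-reflexive
          (≡.sym (linComb-proj₁ a (λ i → B.vectors i , B.vectors∈ i))))
    }
    where
    module E = FiniteDimensionalSpace E
    module V = Subspace V
    module B = Basis (basisOf V)
    S : LeftModule ring ℓ ℓ
    S = record
      { Carrierᴹ = ∃ λ v → v ∈ V
      ; _≈ᴹ_ = λ v w → proj₁ v E.≈ᴹ proj₁ w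
      ; _+ᴹ_ = λ (v , p) (w , q) → v E.+ᴹ w , V.+-closed p q
      ; _*ₗ_ = λ c (v , p) → c E.*ₗ v , V.*ₗ-closed c p
      ; 0ᴹ = E.0ᴹ , V.0-closed
      ; -ᴹ_ = λ (v , p) → E.-ᴹ v , -ᴹ-closed V p
      ; isLeftModule = record
        { isLeftSemimodule = record
          { +ᴹ-isCommutativeMonoid = record
            { isMonoid = record
              { isSemigroup = record
                { isMagma = record
                  { isEquivalence = record
                    { refl = E.≈ᴹ-refl ; sym = E.≈ᴹ-sym ; trans = E.≈ᴹ-trans }
                  ; ∙-cong = E.+ᴹ-cong
                  }
                ; assoc = λ u v w → E.+ᴹ-assoc _ _ _
                }
              ; identity = (λ _ → E.+ᴹ-identityˡ _) , (λ _ → E.+ᴹ-identityʳ _)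
              }
            ; comm = λ _ _ → E.+ᴹ-comm _ _
            }
          ; isPreleftSemimodule = record
            { *ₗ-cong      = E.*ₗ-cong
            ; *ₗ-zeroˡ     = λ _ → E.*ₗ-zeroˡ _
            ; *ₗ-distribʳ  = λ _ _ _ → E.*ₗ-distribʳ _ _ _
            ; *ₗ-identityˡ = λ _ → E.*ₗ-identityˡ _
            ; *ₗ-assoc     = λ _ _ _ → E.*ₗ-assoc _ _ _
            ; *ₗ-zeroʳ     = λ _ → E.*ₗ-zeroʳ _
            ; *ₗ-distribˡ  = λ _ _ _ → E.*ₗ-distribˡ _ _ _
            }
          }
        ; -ᴹ‿cong = E.-ᴹ‿cong
        ; -ᴹ‿inverse = (λ _ → E.-ᴹ‿inverseˡ _) , (λ _ → E.-ᴹ‿inverseʳ _)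
        }
      }
    linComb-proj₁ : ∀ {n} (a : Vector K n) (b : Vector (∃ λ v → v ∈ V) n) →
                    proj₁ (Linear.linComb F S a b) ≡ E.linComb a (proj₁ ∘ b)
    linComb-proj₁ {zero}  a b = ≡.refl
    linComb-proj₁ {suc n} a b =
      ≡.cong (a zero E.*ₗ proj₁ (b zero) E.+ᴹ_) (linComb-proj₁ (a ∘ suc) (b ∘ suc))

  Nonzero : FiniteDimensionalSpace F → Set ℓ
  Nonzero E = ∃ λ v → ¬ (_≈ᴹ_ E v (0ᴹ E))

record QMatroid {ℓ} {F : FiniteField ℓ} (E : FiniteDimensionalSpace F) : Set (lsuc ℓ) where
  field
    rank       : Subspace E → ℤ
    0≤rank     : ∀ V → 0ℤ ℤ.≤ rank V
    rank≤dim   : ∀ V → rank V ℤ.≤ ℤ.+ dim V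
    monotone   : ∀ {V W} → V ⊆ W → rank V ℤ.≤ rank W
    submodular : ∀ V W → rank (V +ˢ W) ℤ.+ rank (V ∩ W) ℤ.≤ rank V ℤ.+ rank W

  rank-cong : ∀ {V W} → V ⊆ W → W ⊆ V → rank V ≡ rank W
  rank-cong {V} {W} p q = ℤ.≤-antisym (monotone {V} {W} p) (monotone {W} {V} q)

  rank-0ˢ : rank 0ˢ ≡ 0ℤ
  rank-0ˢ = ℤ.≤-antisym
    (ℤ.≤-trans (rank≤dim 0ˢ) (ℤ.≤-reflexive (≡.cong ℤ.+_ (dim-0ˢ {E = E})))) (0≤rank 0ˢ)

module _ {ℓ} {F : FiniteField ℓ} where
  open FiniteDimensionalSpace using (Carrierᴹ; ≈ᴹ-refl; ≈ᴹ-sym; ≈ᴹ-trans; 0ᴹ; _+ᴹ_)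
  open QMatroid

  zeroMatroid : QMatroid (zeroSpace {F = F})
  zeroMatroid = record
    { rank       = λ _ → 0ℤ
    ; 0≤rank     = λ _ → ℤ.≤-refl
    ; rank≤dim   = λ _ → ℤ.+≤+ ℕ.z≤n
    ; monotone   = λ _ → ℤ.≤-refl
    ; submodular = λ _ _ → ℤ.≤-refl
    }

  module _ {E₁ E₂ : FiniteDimensionalSpace F} (M₁ : QMatroid E₁) (M₂ : QMatroid E₂) where
    private
      π₁ : Subspace (E₁ ⊕ˢ E₂) → Subspace E₁
      π₁ = image {E₁ = E₁ ⊕ˢ E₂} {E₂ = E₁} (proj₁-linear E₁ E₂)
      π₂ : Subspace (E₁ ⊕ˢ E₂) → Subspace E₂
      π₂ = image {E₁ = E₁ ⊕ˢ E₂} {E₂ = E₂} (proj₂-linear E₁ E₂)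

    ⊕-excess : Subspace (E₁ ⊕ˢ E₂) → ℤ
    ⊕-excess X = rank M₁ (π₁ X) ℤ.+ rank M₂ (π₂ X) ℤ.- ℤ.+ dim X

    ⊕-excess-cong : ∀ {X Y} → X ⊆ Y → Y ⊆ X → ⊕-excess X ≡ ⊕-excess Y
    ⊕-excess-cong {X} {Y} p q = ≡.cong₂ ℤ._-_
      (≡.cong₂ ℤ._+_
        (rank-cong M₁ {π₁ X} {π₁ Y} (λ (v , a , b) → v , p a , b) (λ (v , a , b) → v , q a , b))
        (rank-cong M₂ {π₂ X} {π₂ Y} (λ (v , a , b) → v , p a , b) (λ (v , a , b) → v , q a , b)))
      (≡.cong ℤ.+_ (dim-cong {V = X} {Y} p q))

    ⊕-minimiser : ∀ V → ∃ λ X → X ⊆ V × (∀ Y → Y ⊆ V → ⊕-excess X ℤ.≤ ⊕-excess Y)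
    ⊕-minimiser = minimiser ⊕-excess (λ {X} {Y} → ⊕-excess-cong {X} {Y})

    ⊕-rank : Subspace (E₁ ⊕ˢ E₂) → ℤ
    ⊕-rank V = ℤ.+ dim V ℤ.+ ⊕-excess (proj₁ (⊕-minimiser V))

    private
      r₁ r₂ d : Subspace (E₁ ⊕ˢ E₂) → ℤ
      r₁ X = rank M₁ (π₁ X)
      r₂ X = rank M₂ (π₂ X)
      d X  = ℤ.+ dim X

      d-mono : ∀ {X Y} → X ⊆ Y → d X ℤ.≤ d Y
      d-mono {X} {Y} p = ℤ.+≤+ (dim-mono {V = X} {Y} p)

      d-modular : ∀ X Y → d (X +ˢ Y) ℤ.+ d (X ∩ Y) ≡ d X ℤ.+ d Y
      d-modular X Y = ≡.cong ℤ.+_ (dim-modular X Y)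

      r₁-mono : ∀ {X Y} → X ⊆ Y → r₁ X ℤ.≤ r₁ Y
      r₁-mono {X} {Y} p = monotone M₁ {π₁ X} {π₁ Y} (λ (v , a , b) → v , p a , b)

      r₂-mono : ∀ {X Y} → X ⊆ Y → r₂ X ℤ.≤ r₂ Y
      r₂-mono {X} {Y} p = monotone M₂ {π₂ X} {π₂ Y} (λ (v , a , b) → v , p a , b)

      r₁-submodular : ∀ X Y → r₁ (X +ˢ Y) ℤ.+ r₁ (X ∩ Y) ℤ.≤ r₁ X ℤ.+ r₁ Y
      r₁-submodular X Y = ℤ.≤-trans
        (ℤ.+-mono-≤
          (monotone M₁ {π₁ (X +ˢ Y)} {π₁ X +ˢ π₁ Y} (λ (v , (x , y , p , q , s) , eq) →
            proj₁ x , proj₁ y , (x , p , ≈ᴹ-refl E₁) , (y , q , ≈ᴹ-refl E₁) ,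
            ≈ᴹ-trans E₁ (proj₁ s) eq))
          (monotone M₁ {π₁ (X ∩ Y)} {π₁ X ∩ π₁ Y} (λ (v , (p , q) , eq) →
            (v , p , eq) , (v , q , eq))))
        (submodular M₁ (π₁ X) (π₁ Y))

      r₂-submodular : ∀ X Y → r₂ (X +ˢ Y) ℤ.+ r₂ (X ∩ Y) ℤ.≤ r₂ X ℤ.+ r₂ Y
      r₂-submodular X Y = ℤ.≤-trans
        (ℤ.+-mono-≤
          (monotone M₂ {π₂ (X +ˢ Y)} {π₂ X +ˢ π₂ Y} (λ (v , (x , y , p , q , s) , eq) →
            proj₂ x , proj₂ y , (x , p , ≈ᴹ-refl E₂) , (y , q , ≈ᴹ-refl E₂) ,
            ≈ᴹ-trans E₂ (proj₂ s) eq))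
          (monotone M₂ {π₂ (X ∩ Y)} {π₂ X ∩ π₂ Y} (λ (v , (p , q) , eq) →
            (v , p , eq) , (v , q , eq))))
        (submodular M₂ (π₂ X) (π₂ Y))

      excess-submodular : ∀ X Y →
        ⊕-excess (X +ˢ Y) ℤ.+ ⊕-excess (X ∩ Y) ℤ.≤ ⊕-excess X ℤ.+ ⊕-excess Y
      excess-submodular X Y = begin
        ⊕-excess (X +ˢ Y) ℤ.+ ⊕-excess (X ∩ Y)
          ≡⟨ shuffle (r₁ (X +ˢ Y)) (r₂ (X +ˢ Y)) (d (X +ˢ Y)) (r₁ (X ∩ Y)) (r₂ (X ∩ Y)) (d (X ∩ Y)) ⟩
        (r₁ (X +ˢ Y) ℤ.+ r₁ (X ∩ Y)) ℤ.+ (r₂ (X +ˢ Y) ℤ.+ r₂ (X ∩ Y)) ℤ.- (d (X +ˢ Y) ℤ.+ d (X ∩ Y))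
          ≤⟨ ℤ.+-mono-≤ (ℤ.+-mono-≤ (r₁-submodular X Y) (r₂-submodular X Y))
               (ℤ.≤-reflexive (≡.cong ℤ.-_ (d-modular X Y))) ⟩
        (r₁ X ℤ.+ r₁ Y) ℤ.+ (r₂ X ℤ.+ r₂ Y) ℤ.- (d X ℤ.+ d Y)
          ≡⟨ shuffle (r₁ X) (r₂ X) (d X) (r₁ Y) (r₂ Y) (d Y) ⟨
        ⊕-excess X ℤ.+ ⊕-excess Y ∎
        where
        open ℤ.≤-Reasoning
        shuffle : ∀ a b c a′ b′ c′ → (a ℤ.+ b ℤ.- c) ℤ.+ (a′ ℤ.+ b′ ℤ.- c′) ≡
                  (a ℤ.+ a′) ℤ.+ (b ℤ.+ b′) ℤ.- (c ℤ.+ c′)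
        shuffle a b c a′ b′ c′ = ≡.trans
          (ℤ+.interchange (a ℤ.+ b) (ℤ.- c) (a′ ℤ.+ b′) (ℤ.- c′))
          (≡.cong₂ ℤ._+_ (ℤ+.interchange a b a′ b′) (≡.sym (ℤ.neg-distrib-+ c c′)))

      rank≥0 : ∀ V → 0ℤ ℤ.≤ ⊕-rank V
      rank≥0 V = begin
        0ℤ                                            ≡⟨ ℤ.+-inverseʳ (d X) ⟨
        d X ℤ.- d X                                   ≤⟨ ℤ.+-monoˡ-≤ (ℤ.- d X) (d-mono {X} {V} X⊆V) ⟩
        d V ℤ.- d X                                   ≡⟨ ≡.cong (ℤ._+_ (d V)) (ℤ.+-identityˡ (ℤ.- d X)) ⟨
        d V ℤ.+ (0ℤ ℤ.- d X)
          ≤⟨ ℤ.+-monoʳ-≤ (d V) (ℤ.+-monoˡ-≤ (ℤ.- d X)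
               (ℤ.+-mono-≤ (0≤rank M₁ (π₁ X)) (0≤rank M₂ (π₂ X)))) ⟩
        d V ℤ.+ ⊕-excess X                            ∎
        where
        open ℤ.≤-Reasoning
        X : Subspace (E₁ ⊕ˢ E₂)
        X = proj₁ (⊕-minimiser V)
        X⊆V : X ⊆ V
        X⊆V = proj₁ (proj₂ (⊕-minimiser V))

      excess-0ˢ : ⊕-excess 0ˢ ≡ 0ℤ
      excess-0ˢ = ≡.cong₂ ℤ._-_
        (≡.cong₂ ℤ._+_
          (≡.trans (rank-cong M₁ {π₁ 0ˢ} {0ˢ}
            (λ (v , p , q) → ≈ᴹ-trans E₁ (≈ᴹ-sym E₁ q) (proj₁ p)) (0ˢ⊆ (π₁ 0ˢ))) (rank-0ˢ M₁))
          (≡.trans (rank-cong M₂ {π₂ 0ˢ} {0ˢ}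
            (λ (v , p , q) → ≈ᴹ-trans E₂ (≈ᴹ-sym E₂ q) (proj₂ p)) (0ˢ⊆ (π₂ 0ˢ))) (rank-0ˢ M₂)))
        (≡.cong ℤ.+_ (dim-0ˢ {E = E₁ ⊕ˢ E₂}))

      rank≤d : ∀ V → ⊕-rank V ℤ.≤ d V
      rank≤d V = begin
        ⊕-rank V             ≤⟨ ℤ.+-monoʳ-≤ (d V) (proj₂ (proj₂ (⊕-minimiser V)) 0ˢ (0ˢ⊆ V)) ⟩
        d V ℤ.+ ⊕-excess 0ˢ  ≡⟨ ≡.cong (ℤ._+_ (d V)) excess-0ˢ ⟩
        d V ℤ.+ 0ℤ           ≡⟨ ℤ.+-identityʳ (d V) ⟩
        d V                  ∎
        where open ℤ.≤-Reasoning

      rank-mono : ∀ {V W} → V ⊆ W → ⊕-rank V ℤ.≤ ⊕-rank W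
      rank-mono {V} {W} V⊆W = begin
        ⊕-rank V
          ≤⟨ ℤ.+-monoʳ-≤ (d V) (proj₂ (proj₂ (⊕-minimiser V)) (V ∩ Y) proj₁) ⟩
        d V ℤ.+ (r₁ (V ∩ Y) ℤ.+ r₂ (V ∩ Y) ℤ.- d (V ∩ Y))
          ≤⟨ ℤ.+-monoʳ-≤ (d V) (ℤ.+-monoˡ-≤ (ℤ.- d (V ∩ Y))
               (ℤ.+-mono-≤ (r₁-mono {V ∩ Y} {Y} proj₂) (r₂-mono {V ∩ Y} {Y} proj₂))) ⟩
        d V ℤ.+ (r₁ Y ℤ.+ r₂ Y ℤ.- d (V ∩ Y))
          ≡⟨ shuffle (d V) (d Y) (r₁ Y ℤ.+ r₂ Y) (d (V ∩ Y)) ⟩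
        (d V ℤ.+ d Y) ℤ.+ (r₁ Y ℤ.+ r₂ Y ℤ.- d Y ℤ.- d (V ∩ Y))
          ≡⟨ ≡.cong (ℤ._+ (r₁ Y ℤ.+ r₂ Y ℤ.- d Y ℤ.- d (V ∩ Y))) (d-modular V Y) ⟨
        (d (V +ˢ Y) ℤ.+ d (V ∩ Y)) ℤ.+ (r₁ Y ℤ.+ r₂ Y ℤ.- d Y ℤ.- d (V ∩ Y))
          ≡⟨ shuffle′ (d (V +ˢ Y)) (d (V ∩ Y)) (⊕-excess Y) ⟩
        d (V +ˢ Y) ℤ.+ ⊕-excess Y
          ≤⟨ ℤ.+-monoˡ-≤ (⊕-excess Y) (d-mono {V +ˢ Y} {W} (+-lub {V = V} {Y} W V⊆W Y⊆W)) ⟩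
        d W ℤ.+ ⊕-excess Y ∎
        where
        open ℤ.≤-Reasoning
        open +-*-Solver
        Y : Subspace (E₁ ⊕ˢ E₂)
        Y = proj₁ (⊕-minimiser W)
        Y⊆W : Y ⊆ W
        Y⊆W = proj₁ (proj₂ (⊕-minimiser W))
        shuffle : ∀ v y r i → v ℤ.+ (r ℤ.- i) ≡ (v ℤ.+ y) ℤ.+ (r ℤ.- y ℤ.- i)
        shuffle = solve 4 (λ v y r i → v :+ (r :- i) := (v :+ y) :+ (r :- y :- i)) ≡.refl
        shuffle′ : ∀ s i e → (s ℤ.+ i) ℤ.+ (e ℤ.- i) ≡ s ℤ.+ e
        shuffle′ = solve 3 (λ s i e → (s :+ i) :+ (e :- i) := s :+ e) ≡.refl

      rank-submodular : ∀ V W → ⊕-rank (V +ˢ W) ℤ.+ ⊕-rank (V ∩ W) ℤ.≤ ⊕-rank V ℤ.+ ⊕-rank W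
      rank-submodular V W = begin
        (d (V +ˢ W) ℤ.+ ⊕-excess S) ℤ.+ (d (V ∩ W) ℤ.+ ⊕-excess I)
          ≡⟨ shuffle (d (V +ˢ W)) (⊕-excess S) (d (V ∩ W)) (⊕-excess I) ⟩
        (d (V +ˢ W) ℤ.+ d (V ∩ W)) ℤ.+ (⊕-excess S ℤ.+ ⊕-excess I)
          ≤⟨ ℤ.+-mono-≤ (ℤ.≤-reflexive (d-modular V W)) (ℤ.≤-trans
               (ℤ.+-mono-≤
                 (proj₂ (proj₂ (⊕-minimiser (V +ˢ W))) (X +ˢ Y) (+-lub {V = X} {Y} (V +ˢ W)
                   (λ z → ⊆-+ˡ V W (X⊆V z)) (λ z → ⊆-+ʳ V W (Y⊆W z))))
                 (proj₂ (proj₂ (⊕-minimiser (V ∩ W))) (X ∩ Y) (λ (p , q) → X⊆V p , Y⊆W q)))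
               (excess-submodular X Y)) ⟩
        (d V ℤ.+ d W) ℤ.+ (⊕-excess X ℤ.+ ⊕-excess Y)
          ≡⟨ shuffle (d V) (⊕-excess X) (d W) (⊕-excess Y) ⟨
        (d V ℤ.+ ⊕-excess X) ℤ.+ (d W ℤ.+ ⊕-excess Y) ∎
        where
        open ℤ.≤-Reasoning
        S I X Y : Subspace (E₁ ⊕ˢ E₂)
        S = proj₁ (⊕-minimiser (V +ˢ W))
        I = proj₁ (⊕-minimiser (V ∩ W))
        X = proj₁ (⊕-minimiser V)
        Y = proj₁ (⊕-minimiser W)
        X⊆V : X ⊆ V
        X⊆V = proj₁ (proj₂ (⊕-minimiser V))
        Y⊆W : Y ⊆ W
        Y⊆W = proj₁ (proj₂ (⊕-minimiser W))
        shuffle : ∀ a b c e → (a ℤ.+ b) ℤ.+ (c ℤ.+ e) ≡ (a ℤ.+ c) ℤ.+ (b ℤ.+ e)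
        shuffle = ℤ+.interchange

    infixr 6 _⊕_

    _⊕_ : QMatroid (E₁ ⊕ˢ E₂)
    _⊕_ = record
      { rank       = ⊕-rank
      ; 0≤rank     = rank≥0
      ; rank≤dim   = rank≤d
      ; monotone   = λ {V} {W} → rank-mono {V} {W}
      ; submodular = rank-submodular
      }

  record IsEquivalence {E₁ E₂ : FiniteDimensionalSpace F} (M₁ : QMatroid E₁) (M₂ : QMatroid E₂)
                       (α : Carrierᴹ E₁ → Carrierᴹ E₂) : Set (lsuc ℓ) where
    field
      isomorphism : IsLinearIsomorphism E₁ E₂ α
    linearity : IsLinear E₁ E₂ α
    linearity = LeftModuleMorphisms.IsLeftModuleIsomorphism.isLeftModuleHomomorphism isomorphism
    field
      rank-preserving : ∀ V → rank M₂ (image {E₁ = E₁} {E₂ = E₂} linearity V) ≡ rank M₁ V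

  infix 4 _≃_

  _≃_ : ∀ {E₁ E₂ : FiniteDimensionalSpace F} → QMatroid E₁ → QMatroid E₂ → Set (lsuc ℓ)
  M₁ ≃ M₂ = ∃ (IsEquivalence M₁ M₂)

  -- That addition ⌊ E₁ ⌋ ⊕ˢ ⌊ E₂ ⌋ → E is a linear isomorphism says that E is
  -- the internal direct sum of E₁ and E₂; that it preserves ranks says that M
  -- agrees with M₁ ⊕ M₂ under the resulting identification.
  Reducible : ∀ {E : FiniteDimensionalSpace F} → QMatroid E → Set (lsuc ℓ)
  Reducible {E} M = ∃₂ λ (E₁ E₂ : Subspace E) →
    ∃₂ λ (M₁ : QMatroid ⌊ E₁ ⌋) (M₂ : QMatroid ⌊ E₂ ⌋) →
    Nonzero ⌊ E₁ ⌋ × Nonzero ⌊ E₂ ⌋ ×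
    IsEquivalence (M₁ ⊕ M₂) M (λ (v , w) → _+ᴹ_ E (proj₁ v) (proj₁ w))

  -- A q-matroid on the zero space is irreducible in this sense and is neutral
  -- for ⊕, so uniqueness of a decomposition is only about nonzero summands.
  Irreducible : ∀ {E : FiniteDimensionalSpace F} → QMatroid E → Set (lsuc ℓ)
  Irreducible M = ¬ Reducible M

  -- The empty sum is the q-matroid on the zero space.
  ⨁ˢ : ∀ {t} → (Fin t → FiniteDimensionalSpace F) → FiniteDimensionalSpace F
  ⨁ˢ {zero}  E = zeroSpace
  ⨁ˢ {suc t} E = E zero ⊕ˢ ⨁ˢ (E ∘ suc)

  ⨁ : ∀ {t} {E : Fin t → FiniteDimensionalSpace F} → (∀ i → QMatroid (E i)) → QMatroid (⨁ˢ E)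
  ⨁ {zero}  M = zeroMatroid
  ⨁ {suc t} M = M zero ⊕ ⨁ (M ∘ suc)

  total : ∀ {E : FiniteDimensionalSpace F} {t} (D : Fin t → Subspace E) →
          Carrierᴹ (⨁ˢ (λ i → ⌊ D i ⌋)) → Carrierᴹ E
  total {E} {zero}  D _        = 0ᴹ E
  total {E} {suc t} D (v , vs) = _+ᴹ_ E (proj₁ v) (total (D ∘ suc) vs)

  -- M is the internal direct sum of the Mᵢ, on subspaces Dᵢ of its ground space.
  IsInternalDirectSum : ∀ {E : FiniteDimensionalSpace F} {t} (M : QMatroid E)
                        {D : Fin t → Subspace E} → (∀ i → QMatroid ⌊ D i ⌋) → Set (lsuc ℓ)
  IsInternalDirectSum M {D} Ms = IsEquivalence (⨁ Ms) M (total D)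

{-# OPTIONS --safe #-}
module Submission where

-- Call a subspace V cyclic if every proper subspace of V has smaller nullity
-- dim - ρ. Every subspace contains a cyclic one of the same nullity, so M is the
-- direct sum of its restrictions to A and B, where E = A ⊕ B, if and only if
-- ρ V = ρ (π₁ V) + ρ (π₂ V) for all cyclic V. Splittings are thereby decidable,
-- and induction on the dimension decomposes M into irreducible parts.
-- Uniqueness rests on an exchange property: if A, A′ and G, G′ split E, A and G are
-- irreducible, and the G-component of some vector of A lies outside A′, then G
-- and A′ split E. Indeed, an irreducible A is a line containing no cyclic subspace
-- except 0, a line spanned by a loop, or cyclic without loops; in the last case A
-- is split by its intersections with G and G′ taken modulo loops, so A and G agree
-- modulo loops. Two complements of the same summand are equivalent by projection
-- along it, whence A ≃ G and A′ ≃ G′, and one concludes by induction on the number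
-- of summands.

open import Defs
open import Algebra.Bundles using (CommutativeMonoid)
open import Algebra.Module.Morphism.Structures using (module LeftModuleMorphisms)
import Algebra.Properties.CommutativeSemigroup as CommutativeSemigroupProperties
open import Data.Fin.Base using (Fin; zero; suc; punchIn)
open import Data.Fin.Permutation as Permutation using (Permutation; _⟨$⟩ʳ_)
open import Data.Integer.Base as ℤ using (ℤ; 0ℤ; 1ℤ; _+_; _-_; _≤_; -_)
import Data.Integer.Properties as ℤ
open import Data.Integer.Tactic.RingSolver using (solve-∀)
open import Data.Nat.Base as ℕ using (ℕ; zero; suc)
import Data.Nat.Properties as ℕ
open import Data.Product.Base using (Σ; ∃; ∃₂; ∃-syntax; _×_; _,_; proj₁; proj₂)
open import Data.Unit.Polymorphic.Base using (tt) renaming (⊤ to Unit)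
import Data.Vec.Functional as Vector
open import Function.Base using (_∘_; id)
open import Level using (Lift; lift; lower) renaming (suc to lsuc)
open import Relation.Binary.PropositionalEquality as ≡ using (_≡_)
open import Relation.Nullary using (¬_; Dec; yes; no; contradiction)
import Relation.Nullary.Decidable as Dec
open import Relation.Nullary.Decidable using (_×-dec_; _→-dec_; ¬?)
open import Relation.Unary using (Pred; Decidable)

-- In a direct sum the minimum that defines the rank of a cyclic subspace is attained at that
-- subspace itself, which is why additivity on cyclic subspaces can stand for the rank formula; all
-- other ranks are recovered from cyclic cores. Nullity is monotone and supermodular, which also
-- gives every subspace a largest cyclic subspace.
--
-- The obstacle to uniqueness is that the summands are not determined as subspaces: a line
-- containing no cyclic subspace except zero may be tilted into other summands, and vectors of a
-- summand may be altered by loops of the others. The exchange therefore compares summands only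
-- modulo loops, and treats lines separately.
--
-- Inequalities between ranks and dimensions are proved in a uniform way: those needed are added up,
-- and `≤-shift` with a ring identity cancels what they share.

-- a ≤ b follows from p ≤ q as soon as b - a = q - p; subtraction-free so that
-- the premise is a ring identity.
≤-shift : ∀ {p q} a b → p ≤ q → a + q ≡ b + p → a ≤ b
≤-shift {p} {q} a b p≤q eq = begin
  a          ≡⟨ i+j-j≡i a q ⟨
  a + q - q  ≡⟨ ≡.cong (_- q) eq ⟩
  b + p - q  ≤⟨ ℤ.+-monoˡ-≤ (- q) (ℤ.+-monoʳ-≤ b p≤q) ⟩
  b + q - q  ≡⟨ i+j-j≡i b q ⟩
  b          ∎
  where
  open ℤ.≤-Reasoning
  i+j-j≡i : ∀ i j → i + j - j ≡ i
  i+j-j≡i = solve-∀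

-- The subspace lattice: complements and decidable quantification

module _ {ℓ} {F : FiniteField ℓ} {E : FiniteDimensionalSpace F} where
  open FiniteField F using (K; _≈_; _*_; 0#; 1#; invertible)
  open FiniteDimensionalSpace E
  open LinearProperties F leftModule
  open SpaceProperties E
  open Subspace
  private
    module K = Field F
    module +ᴹ = CommutativeSemigroupProperties
      (CommutativeMonoid.commutativeSemigroup +ᴹ-commutativeMonoid)

  infix 4 _⊑_ _≋_

  -- _⊆_ wrapped in a record, so that both subspaces can be inferred.
  record _⊑_ (V W : Subspace E) : Set ℓ where
    constructor incl
    field
      at : ∀ {v} → v ∈ V → v ∈ W
  open _⊑_ public

  _≋_ : Subspace E → Subspace E → Set ℓ
  V ≋ W = V ⊑ W × W ⊑ V

  ⊑-refl : ∀ {V} → V ⊑ V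
  ⊑-refl = incl id

  ⊑-trans : ∀ {U V W} → U ⊑ V → V ⊑ W → U ⊑ W
  ⊑-trans p q = incl (λ x → at q (at p x))

  ≋-sym : ∀ {V W} → V ≋ W → W ≋ V
  ≋-sym (p , q) = q , p

  0⊑ : ∀ {V} → 0ˢ ⊑ V
  0⊑ {V} = incl (0ˢ⊆ V)

  infixl 6 _⊔_
  infixl 7 _⊓_

  -- Opaque copies of _+ˢ_, _∩_ and ⟨_⟩: the originals unfold to records, from
  -- which unification cannot recover the operands.
  opaque
    _⊔_ _⊓_ : Subspace E → Subspace E → Subspace E
    V ⊔ W = V +ˢ W
    V ⊓ W = V ∩ W

    line : Carrierᴹ → Subspace E
    line x = ⟨ x ⟩

    ∈⊔⁺ : ∀ {V W x y} → x ∈ V → y ∈ W → x +ᴹ y ∈ V ⊔ W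
    ∈⊔⁺ p q = _ , _ , p , q , ≈ᴹ-refl

    ∈⊔⁻ : ∀ {V W v} → v ∈ V ⊔ W → ∃₂ λ x y → x ∈ V × y ∈ W × x +ᴹ y ≈ᴹ v
    ∈⊔⁻ = id

    ⊔-incˡ : ∀ {V W} → V ⊑ V ⊔ W
    ⊔-incˡ {V} {W} = incl (⊆-+ˡ V W)

    ⊔-incʳ : ∀ {V W} → W ⊑ V ⊔ W
    ⊔-incʳ {V} {W} = incl (⊆-+ʳ V W)

    ⊔-least : ∀ {V W Z} → V ⊑ Z → W ⊑ Z → V ⊔ W ⊑ Z
    ⊔-least {V} {W} {Z} p q = incl (+-lub {V = V} {W} Z (at p) (at q))

    ∈⊓⁺ : ∀ {V W v} → v ∈ V → v ∈ W → v ∈ V ⊓ W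
    ∈⊓⁺ = _,_

    ⊓-incˡ : ∀ {V W} → V ⊓ W ⊑ V
    ⊓-incˡ = incl proj₁

    ⊓-incʳ : ∀ {V W} → V ⊓ W ⊑ W
    ⊓-incʳ = incl proj₂

    ∈line : ∀ x → x ∈ line x
    ∈line = x∈⟨x⟩ {E = E}

    ∈line⁻ : ∀ {x v} → v ∈ line x → ∃ λ c → c *ₗ x ≈ᴹ v
    ∈line⁻ = id

    line⊑ : ∀ {V x} → x ∈ V → line x ⊑ V
    line⊑ {V} p = incl (⟨⟩⊆ V p)

    dim-modular′ : ∀ V W → dim (V ⊔ W) ℕ.+ dim (V ⊓ W) ≡ dim V ℕ.+ dim W
    dim-modular′ = dim-modular

  ⊔-monotone : ∀ {V V′ W W′} → V ⊑ V′ → W ⊑ W′ → V ⊔ W ⊑ V′ ⊔ W′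
  ⊔-monotone p q = ⊔-least (⊑-trans p ⊔-incˡ) (⊑-trans q ⊔-incʳ)

  ⊔-swap : ∀ {V W} → V ⊔ W ⊑ W ⊔ V
  ⊔-swap = ⊔-least ⊔-incʳ ⊔-incˡ

  ⊓-greatest : ∀ {U V W} → U ⊑ V → U ⊑ W → U ⊑ V ⊓ W
  ⊓-greatest p q = incl (λ x → ∈⊓⁺ (at p x) (at q x))

  ⊓-swap : ∀ {V W} → V ⊓ W ⊑ W ⊓ V
  ⊓-swap = ⊓-greatest ⊓-incʳ ⊓-incˡ

  ⊓-zero : ∀ {A A′ B B′} → A′ ⊑ A → B′ ⊑ B → A ⊓ B ⊑ 0ˢ → A′ ⊓ B′ ⊑ 0ˢ
  ⊓-zero p q dis = ⊑-trans (⊓-greatest (⊑-trans ⊓-incˡ p) (⊑-trans ⊓-incʳ q)) dis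

  ⊤ˢ : Subspace E
  ⊤ˢ = record
    { Member    = λ _ → Unit
    ; member?   = λ _ → yes tt
    ; respects  = λ _ _ → tt
    ; 0-closed  = tt
    ; +-closed  = λ _ _ → tt
    ; *ₗ-closed = λ _ _ → tt
    }

  ⊑⊤ : ∀ {V} → V ⊑ ⊤ˢ
  ⊑⊤ = incl (λ _ → tt)

  x+-x+y≈y : ∀ x y → -ᴹ x +ᴹ (x +ᴹ y) ≈ᴹ y
  x+-x+y≈y x y = ≈ᴹ-sym (cancelˡ ≈ᴹ-refl)

  x+y-y≈x : ∀ x y → (x +ᴹ y) +ᴹ -ᴹ y ≈ᴹ x
  x+y-y≈x x y = ≈ᴹ-trans (+ᴹ-assoc x y (-ᴹ y))
    (≈ᴹ-trans (+ᴹ-congˡ (-ᴹ‿inverseʳ y)) (+ᴹ-identityʳ x))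

  ∈-cancelˡ : ∀ (V : Subspace E) {u w} → u ∈ V → u +ᴹ w ∈ V → w ∈ V
  ∈-cancelˡ V p q = respects V (x+-x+y≈y _ _) (+-closed V (-ᴹ-closed V p) q)

  ∈-cancelʳ : ∀ (V : Subspace E) {u w} → w ∈ V → u +ᴹ w ∈ V → u ∈ V
  ∈-cancelʳ V p q = respects V (x+y-y≈x _ _) (+-closed V q (-ᴹ-closed V p))

  ∈-cancel-*ₗ : ∀ (V : Subspace E) {c v} → ¬ (c ≈ 0#) → c *ₗ v ∈ V → v ∈ V
  ∈-cancel-*ₗ V {c} {v} c≉0 p with invertible c c≉0
  ... | y , cy≈1 = respects V
    (≈ᴹ-trans (≈ᴹ-sym (*ₗ-assoc y c v))
      (≈ᴹ-trans (*ₗ-congʳ (K.cancel cy≈1)) (*ₗ-identityˡ v)))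
    (*ₗ-closed V y p)

  components-unique : ∀ {A B : Subspace E} {a b a′ b′} → A ⊓ B ⊑ 0ˢ →
    a ∈ A → b ∈ B → a′ ∈ A → b′ ∈ B → a +ᴹ b ≈ᴹ a′ +ᴹ b′ → a ≈ᴹ a′
  components-unique {A} {B} {a} {b} {a′} {b′} dis a∈A b∈B a′∈A b′∈B eq =
    v-w≈0⇒v≈w (at dis (∈⊓⁺ x∈A (∈-cancelʳ B b∈B (respects B (≈ᴹ-sym x+b≈b′) b′∈B))))
    where
    x∈A : a +ᴹ -ᴹ a′ ∈ A
    x∈A = +-closed A a∈A (-ᴹ-closed A a′∈A)
    x+b≈b′ : (a +ᴹ -ᴹ a′) +ᴹ b ≈ᴹ b′
    x+b≈b′ = ≈ᴹ-trans (+ᴹ.xy∙z≈y∙xz a (-ᴹ a′) b) (≈ᴹ-trans (+ᴹ-congˡ eq) (x+-x+y≈y a′ b′))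

  _⊑?_ : ∀ V W → Dec (V ⊑ W)
  V ⊑? W = Dec.map′
    (λ none → incl (λ {v} p → Dec.decidable-stable (member? W v) (λ q → none (v , p , q))))
    (λ V⊑W (v , p , q) → q (at V⊑W p))
    (¬? (any? (λ eq (p , q) → respects V eq p , λ r → q (respects W (≈ᴹ-sym eq) r))
              (λ v → member? V v ×-dec ¬? (member? W v))))

  NonzeroSubspace : Subspace E → Set ℓ
  NonzeroSubspace V = ∃ λ v → v ∈ V × ¬ (v ≈ᴹ 0ᴹ)

  nonzero? : ∀ V → Dec (NonzeroSubspace V)
  nonzero? V = any? (λ eq (p , q) → respects V eq p , λ r → q (≈ᴹ-trans eq r))
                    (λ v → member? V v ×-dec ¬? (≈0? v))

  ¬nonzero⇒⊑0 : ∀ {V} → ¬ NonzeroSubspace V → V ⊑ 0ˢ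
  ¬nonzero⇒⊑0 none = incl (λ {v} p → Dec.decidable-stable (≈0? v) (λ q → none (v , p , q)))

  d : Subspace E → ℤ
  d V = ℤ.+ dim V

  d-mono : ∀ {V W} → V ⊑ W → d V ≤ d W
  d-mono {V} {W} p = ℤ.+≤+ (dim-mono {V = V} {W} (at p))

  d-modular : ∀ V W → d (V ⊔ W) + d (V ⊓ W) ≡ d V + d W
  d-modular V W = ≡.cong ℤ.+_ (dim-modular′ V W)

  d-disjoint : ∀ {V W} → V ⊓ W ⊑ 0ˢ → d (V ⊔ W) ≡ d V + d W
  d-disjoint {V} {W} p = begin
    d (V ⊔ W)              ≡⟨ ℤ.+-identityʳ _ ⟨
    d (V ⊔ W) + 0ℤ         ≡⟨ ≡.cong (λ n → d (V ⊔ W) + ℤ.+ n) (dim-0ˢ {E = E}) ⟨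
    d (V ⊔ W) + d 0ˢ       ≡⟨ ≡.cong (λ n → d (V ⊔ W) + n) (ℤ.≤-antisym (d-mono 0⊑) (d-mono p)) ⟩
    d (V ⊔ W) + d (V ⊓ W)  ≡⟨ d-modular V W ⟩
    d V + d W              ∎
    where open ≡.≡-Reasoning

  d-⊔≤ : ∀ V W → d (V ⊔ W) ≤ d V + d W
  d-⊔≤ V W = ℤ.≤-trans (ℤ.i≤i+j (d (V ⊔ W)) (d (V ⊓ W))) (ℤ.≤-reflexive (d-modular V W))

  dim-strict : ∀ {W V} → W ⊑ V → ¬ (V ⊑ W) → dim W ℕ.< dim V
  dim-strict {W} {V} W⊑V V⋢W with chain W V (at W⊑V)
  ... | zero  , done _ V⊆W = contradiction (incl V⊆W) V⋢W
  ... | suc k , c = ≡.subst (dim W ℕ.<_) (≡.sym (dim-chain c)) (ℕ.s≤s (ℕ.m≤n+m (dim W) k))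

  ∈line⇒≈0 : ∀ {V x v} → ¬ (x ∈ V) → v ∈ line x → v ∈ V → v ≈ᴹ 0ᴹ
  ∈line⇒≈0 {V} {x} x∉V p v∈V with ∈line⁻ p
  ... | c , cx≈v with c K.≟ 0#
  ...   | yes c≈0 = ≈ᴹ-trans (≈ᴹ-sym cx≈v) (≈ᴹ-trans (*ₗ-congʳ c≈0) (*ₗ-zeroˡ x))
  ...   | no  c≉0 = contradiction (∈-cancel-*ₗ V c≉0 (respects V (≈ᴹ-sym cx≈v) v∈V)) x∉V

  Complement : (U V K : Subspace E) → Set ℓ
  Complement U V K = K ⊑ V × U ⊓ K ⊑ 0ˢ × V ⊑ U ⊔ K

  opaque
    unfolding _⊔_

    -- A chain from `U` to `V` lists vectors, each outside the subspace reached so far; their lines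
    -- together span a complement.
    complement : ∀ {U V} → U ⊑ V → ∃ (Complement U V)
    complement {U} {V} U⊑V = go (proj₂ (chain U V (at U⊑V)))
      where
      go : ∀ {U k} → Chain U V k → ∃ (Complement U V)
      go {U} (done U⊆V V⊆U) = 0ˢ , 0⊑ , ⊓-incʳ {U} {0ˢ} , ⊑-trans (incl V⊆U) (⊔-incˡ {U} {0ˢ})
      go {U} (step x x∈V x∉U c) with go c
      ... | K′ , K′⊑V , dis , cover =
        line x ⊔ K′ , ⊔-least {line x} {K′} (line⊑ {V} x∈V) K′⊑V , incl disjoint ,
        ⊑-trans cover (⊔-least {U ⊔ line x} {K′}
          (⊔-monotone {U} {U} {line x} {line x ⊔ K′} ⊑-refl (⊔-incˡ {line x} {K′}))
          (⊑-trans (⊔-incʳ {line x} {K′}) (⊔-incʳ {U} {line x ⊔ K′})))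
        where
        -- In `v = y + k` the vector `k` lies in `U ⊔ line x`, so the recursive disjointness makes
        -- it zero; then `y` lies in `U`, and `x` does not.
        disjoint : ∀ {v} → v ∈ U ⊓ (line x ⊔ K′) → v ≈ᴹ 0ᴹ
        disjoint {v} (v∈U , (y , k , y∈⟨x⟩ , k∈K′ , y+k≈v)) =
          ≈ᴹ-trans (≈ᴹ-sym y+k≈v) (≈ᴹ-trans
            (+ᴹ-cong (∈line⇒≈0 {U} {x} x∉U y∈⟨x⟩ y∈U) k≈0) (+ᴹ-identityˡ 0ᴹ))
          where
          k≈0 : k ≈ᴹ 0ᴹ
          k≈0 = at {V = (U ⊔ line x) ⊓ K′} {0ˢ} dis
            (∈-cancelˡ (U ⊔ line x) (at (⊔-incʳ {U} {line x}) {y} y∈⟨x⟩)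
              (respects (U ⊔ line x) (≈ᴹ-sym y+k≈v) (at (⊔-incˡ {U} {line x}) v∈U)) , k∈K′)
          y∈U : y ∈ U
          y∈U = respects U
            (≈ᴹ-trans (≈ᴹ-sym y+k≈v) (≈ᴹ-trans (+ᴹ-congˡ k≈0) (+ᴹ-identityʳ y))) v∈U

  module _ {p} {P : Pred (Subspace E) p} (resp : ∀ {V W} → V ≋ W → P V → P W)
           (P? : Decidable P) where

    -- The enumeration of all subspaces is only available through minimiser, so
    -- minimise the indicator function of the complement of P.
    anyˢ? : Dec (∃ P)
    anyˢ? with minimiser cost cost-cong ⊤ˢ
      where
      cost : Subspace E → ℤ
      cost V with P? V
      ... | yes _ = 0ℤ
      ... | no  _ = 1ℤ
      cost-cong : ∀ {V W} → V ⊆ W → W ⊆ V → cost V ≡ cost W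
      cost-cong {V} {W} V⊆W W⊆V with P? V | P? W
      ... | yes _ | yes _ = ≡.refl
      ... | no  _ | no  _ = ≡.refl
      ... | yes p | no ¬q = contradiction (resp (incl V⊆W , incl W⊆V) p) ¬q
      ... | no ¬p | yes q = contradiction (resp (incl W⊆V , incl V⊆W) q) ¬p
    ... | X , _ , least with P? X
    ...   | yes p = yes (X , p)
    ...   | no ¬p = no none
      where
      none : ¬ ∃ P
      none (V , q) with P? V | least V (λ _ → tt)
      ... | yes _ | ℤ.+≤+ ()
      ... | no ¬q | _ = ¬q q

  allˢ? : ∀ {p} {P : Pred (Subspace E) p} → (∀ {V W} → V ≋ W → P V → P W) →
          Decidable P → Dec (∀ V → P V)
  allˢ? resp P? = Dec.map′
    (λ none V → Dec.decidable-stable (P? V) (λ q → none (V , q)))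
    (λ all (V , q) → q (all V))
    (¬? (anyˢ? (λ V≋W q r → q (resp (≋-sym V≋W) r)) (λ V → ¬? (P? V))))

-- Cyclic subspaces and splittings

module _ {ℓ} {F : FiniteField ℓ} {E : FiniteDimensionalSpace F} (M : QMatroid E) where
  open FiniteDimensionalSpace E
  open Subspace

  opaque
    unfolding _⊔_

    ρ : Subspace E → ℤ
    ρ = QMatroid.rank M

    0≤ρ : ∀ V → 0ℤ ≤ ρ V
    0≤ρ = QMatroid.0≤rank M

    ρ≤d : ∀ V → ρ V ≤ d V
    ρ≤d = QMatroid.rank≤dim M

    ρ-0ˢ : ρ 0ˢ ≡ 0ℤ
    ρ-0ˢ = QMatroid.rank-0ˢ M

    ρ-mono : ∀ {V W} → V ⊑ W → ρ V ≤ ρ W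
    ρ-mono {V} {W} p = QMatroid.monotone M {V} {W} (at p)

    ρ-submodular : ∀ V W → ρ (V ⊔ W) + ρ (V ⊓ W) ≤ ρ V + ρ W
    ρ-submodular = QMatroid.submodular M

    ρ≡rank : ∀ V → ρ V ≡ QMatroid.rank M V
    ρ≡rank V = ≡.refl

  ρ-cong : ∀ {V W} → V ≋ W → ρ V ≡ ρ W
  ρ-cong (p , q) = ℤ.≤-antisym (ρ-mono p) (ρ-mono q)

  ρ-⊔≤ : ∀ V W → ρ (V ⊔ W) ≤ ρ V + ρ W
  ρ-⊔≤ V W = begin
    ρ (V ⊔ W)              ≡⟨ ℤ.+-identityʳ _ ⟨
    ρ (V ⊔ W) + 0ℤ         ≤⟨ ℤ.+-monoʳ-≤ (ρ (V ⊔ W)) (0≤ρ (V ⊓ W)) ⟩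
    ρ (V ⊔ W) + ρ (V ⊓ W)  ≤⟨ ρ-submodular V W ⟩
    ρ V + ρ W              ∎
    where open ℤ.≤-Reasoning

  ρ-⊔-rank0 : ∀ V {L} → ρ L ≤ 0ℤ → ρ (V ⊔ L) ≤ ρ V
  ρ-⊔-rank0 V {L} ρL≤0 = ℤ.≤-trans (ρ-⊔≤ V L)
    (ℤ.≤-trans (ℤ.+-monoʳ-≤ (ρ V) ρL≤0) (ℤ.≤-reflexive (ℤ.+-identityʳ (ρ V))))

  -- Equivalently dim W - ρ W ≥ dim V - ρ V; for W ⊑ V this is an equality.
  FullNullity : Subspace E → Subspace E → Set
  FullNullity W V = ρ W + d V ≤ ρ V + d W

  -- The analogue of a union of circuits in a matroid. For a hyperplane `W` of `V` the condition
  -- excludes `ρ W < ρ V`: the restriction of `M` to `V` has no coloops.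
  Cyclic : Subspace E → Set (lsuc ℓ)
  Cyclic V = ∀ W → W ⊑ V → FullNullity W V → V ⊑ W

  -- A complement `K` of `W` in `V` raises the rank by at most `ρ K`, hence by at most `d K`, which
  -- is what it adds to the dimension.
  nullity-mono : ∀ {W V} → W ⊑ V → ρ V + d W ≤ ρ W + d V
  nullity-mono {W} {V} W⊑V with complement W⊑V
  ... | K , K⊑V , dis , cover = ≤-shift (ρ V + d W) (ρ W + d V)
    (ℤ.+-mono-≤
      (ℤ.≤-trans (ρ-mono cover) (ℤ.≤-trans (ρ-⊔≤ W K) (ℤ.+-monoʳ-≤ (ρ W) (ρ≤d K))))
      (ℤ.≤-trans (ℤ.≤-reflexive (≡.sym (d-disjoint dis))) (d-mono (⊔-least W⊑V K⊑V))))
    (ring (ρ V) (ρ W) (d W) (d V) (d K))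
    where
    ring : ∀ rv rw w v k → rv + w + (rw + k + v) ≡ rw + v + (rv + (w + k))
    ring = solve-∀

  Cyclic-resp : ∀ {V V′} → V ≋ V′ → Cyclic V → Cyclic V′
  Cyclic-resp {V} {V′} (p , q) cyc W W⊑V′ full = ⊑-trans q (cyc W (⊑-trans W⊑V′ q)
    (≡.subst₂ (λ r n → ρ W + n ≤ r + d W)
      (ρ-cong (q , p)) (ℤ.≤-antisym (d-mono q) (d-mono p)) full))

  private
    Shrinks : Subspace E → Subspace E → Set ℓ
    Shrinks V W = W ⊑ V × FullNullity W V × ¬ (V ⊑ W)

    shrinks? : ∀ V → Dec (∃ (Shrinks V))
    shrinks? V = anyˢ?
      (λ {W} {W′} (p , q) (W⊑V , full , V⋢W) →
        ⊑-trans q W⊑V ,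
        ≡.subst₂ (λ r n → r + d V ≤ ρ V + n) (ρ-cong (p , q))
          (ℤ.≤-antisym (d-mono p) (d-mono q)) full ,
        λ V⊑W′ → V⋢W (⊑-trans V⊑W′ q))
      (λ W → (W ⊑? V) ×-dec (ρ W + d V ℤ.≤? ρ V + d W) ×-dec ¬? (V ⊑? W))

    ¬shrinks⇒cyclic : ∀ {V} → ¬ ∃ (Shrinks V) → Cyclic V
    ¬shrinks⇒cyclic {V} none W W⊑V full =
      Dec.decidable-stable (V ⊑? W) (λ V⋢W → none (W , W⊑V , full , V⋢W))

  Cyclic? : ∀ V → Dec (Cyclic V)
  Cyclic? V = Dec.map′ ¬shrinks⇒cyclic
    (λ cyc (W , W⊑V , full , V⋢W) → V⋢W (cyc W W⊑V full))
    (¬? (shrinks? V))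

  opaque
    -- A subspace that is not cyclic has a proper subspace of the same nullity; the descent stops
    -- because the dimension, bounded by the fuel `n`, falls.
    cyclicCore : ∀ V → ∃ λ K → K ⊑ V × Cyclic K × FullNullity K V
    cyclicCore V = go (dim V) V ℕ.≤-refl
      where
      go : ∀ n V → dim V ℕ.≤ n → ∃ λ K → K ⊑ V × Cyclic K × FullNullity K V
      go n V dimV≤n with shrinks? V
      ... | no none = V , ⊑-refl , ¬shrinks⇒cyclic none , ℤ.≤-refl
      go zero V dimV≤0 | yes (W , W⊑V , _ , V⋢W) =
        contradiction (ℕ.≤-trans (dim-strict W⊑V V⋢W) dimV≤0) (λ ())
      go (suc n) V dimV≤n | yes (W , W⊑V , full , V⋢W)
        with go n W (ℕ.s≤s⁻¹ (ℕ.≤-trans (dim-strict W⊑V V⋢W) dimV≤n))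
      ... | K , K⊑W , cyc , full′ = K , ⊑-trans K⊑W W⊑V , cyc ,
        ≤-shift (ρ K + d V) (ρ V + d K) (ℤ.+-mono-≤ full full′) (ring (ρ K) (ρ W) (ρ V) (d K) (d W) (d V))
        where
        ring : ∀ rk rw rv k w v → rk + v + (rv + w + (rw + k)) ≡ rv + k + (rw + v + (rk + w))
        ring = solve-∀

  -- Submodularity of `ρ` makes the nullity supermodular. As `X ⊔ K` has no more nullity than `K`,
  -- the nullity of `X` is already attained on `X ⊓ K`, and cyclicity applies. Thus the cyclic core
  -- of `G` is its largest cyclic subspace.
  cyclic⊑full : ∀ {X K G} → Cyclic X → X ⊑ G → K ⊑ G → FullNullity K G → X ⊑ K
  cyclic⊑full {X} {K} {G} cyc X⊑G K⊑G full = ⊑-trans (cyc (X ⊓ K) ⊓-incˡ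
    (≤-shift (ρ (X ⊓ K) + d X) (ρ X + d (X ⊓ K))
      (ℤ.+-mono-≤ (ρ-submodular X K) (ℤ.+-mono-≤ (nullity-mono (⊔-least X⊑G K⊑G))
        (ℤ.+-mono-≤ full (ℤ.≤-reflexive (≡.sym (d-modular X K))))))
      (ring (ρ X) (ρ K) (ρ G) (ρ (X ⊓ K)) (ρ (X ⊔ K)) (d X) (d K) (d G) (d (X ⊓ K)) (d (X ⊔ K)))))
    ⊓-incʳ
    where
    ring : ∀ rx rk rg ri rs x k g i s →
      ri + x + (rx + rk + (rs + g + (rg + k + (s + i)))) ≡
      rx + i + (rs + ri + (rg + s + (rk + g + (x + k))))
    ring = solve-∀

  -- The projection of V to A along B.
  pr : (A B V : Subspace E) → Subspace E
  pr A B V = (V ⊔ B) ⊓ A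

  pr⊑ : ∀ {A B V} → pr A B V ⊑ A
  pr⊑ = ⊓-incʳ

  pr-mono : ∀ {A A′ B B′ V V′} → A ⊑ A′ → B ⊑ B′ → V ⊑ V′ → pr A B V ⊑ pr A′ B′ V′
  pr-mono p q r = ⊓-greatest (⊑-trans ⊓-incˡ (⊔-monotone r q)) (⊑-trans ⊓-incʳ p)

  ∈pr⁺ : ∀ {A B V : Subspace E} {a b} → a ∈ A → b ∈ B → a +ᴹ b ∈ V → a ∈ pr A B V
  ∈pr⁺ {A} {B} {V} {a} {b} p q r = ∈⊓⁺ (respects (V ⊔ B) (x+y-y≈x {E = E} a b) (∈⊔⁺ r (-ᴹ-closed B q))) p

  ∈pr⁻ : ∀ {A B V : Subspace E} {a} → a ∈ pr A B V → a ∈ A × ∃ λ b → b ∈ B × a +ᴹ b ∈ V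
  ∈pr⁻ {A} {B} {V} {a} p with ∈⊔⁻ (at ⊓-incˡ p)
  ... | v , b , v∈V , b∈B , v+b≈a = at ⊓-incʳ p , -ᴹ b , -ᴹ-closed B b∈B ,
    respects V (≈ᴹ-trans (≈ᴹ-sym (x+y-y≈x {E = E} v b)) (+ᴹ-congʳ v+b≈a)) v∈V

  ⊑pr⊔pr : ∀ {U A B V} → U ⊑ A ⊔ B → V ⊑ U → V ⊑ pr A B V ⊔ pr B A V
  ⊑pr⊔pr {U} {A} {B} {V} cover V⊑U = incl λ {v} v∈V →
    let a , b , a∈A , b∈B , a+b≈v = ∈⊔⁻ (at cover (at V⊑U v∈V))
        a+b∈V = respects V (≈ᴹ-sym a+b≈v) v∈V
    in respects (pr A B V ⊔ pr B A V) a+b≈v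
         (∈⊔⁺ (∈pr⁺ a∈A b∈B a+b∈V) (∈pr⁺ b∈B a∈A (respects V (+ᴹ-comm a b) a+b∈V)))

  -- M restricted to U is the direct sum of its restrictions to A and B: a
  -- minimiser in the rank formula can be taken cyclic, so additivity is only
  -- required of cyclic subspaces.
  record Splits (U A B : Subspace E) : Set (lsuc ℓ) where
    field
      left     : A ⊑ U
      right    : B ⊑ U
      cover    : U ⊑ A ⊔ B
      disjoint : A ⊓ B ⊑ 0ˢ
      additive : ∀ V → V ⊑ U → Cyclic V → ρ (pr A B V) + ρ (pr B A V) ≤ ρ V
  open Splits

  splits-swap : ∀ {U A B} → Splits U A B → Splits U B A
  splits-swap s = record
    { left     = right s
    ; right    = left s
    ; cover    = ⊑-trans (cover s) ⊔-swap
    ; disjoint = ⊑-trans ⊓-swap (disjoint s)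
    ; additive = λ V p c → ℤ.≤-trans (ℤ.≤-reflexive (ℤ.+-comm (ρ (pr _ _ V)) (ρ (pr _ _ V)))) (additive s V p c)
    }

  splits-resp : ∀ {U U′ A A′ B B′} → U ≋ U′ → A ≋ A′ → B ≋ B′ → Splits U A B → Splits U′ A′ B′
  splits-resp (u , u′) (a , a′) (b , b′) s = record
    { left     = ⊑-trans a′ (⊑-trans (left s) u)
    ; right    = ⊑-trans b′ (⊑-trans (right s) u)
    ; cover    = ⊑-trans u′ (⊑-trans (cover s) (⊔-monotone a b))
    ; disjoint = ⊑-trans (⊓-greatest (⊑-trans ⊓-incˡ a′) (⊑-trans ⊓-incʳ b′)) (disjoint s)
    ; additive = λ V p c → ℤ.≤-trans
        (ℤ.+-mono-≤ (ρ-mono (pr-mono a′ b′ ⊑-refl)) (ρ-mono (pr-mono b′ a′ ⊑-refl)))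
        (additive s V (⊑-trans p u′) c)
    }

  opaque
    splits? : ∀ U A B → Dec (Splits U A B)
    splits? U A B = Dec.map′
      (λ (l , r , c , d , a) → record { left = l ; right = r ; cover = c ; disjoint = d ; additive = a })
      (λ s → left s , right s , cover s , disjoint s , additive s)
      ((A ⊑? U) ×-dec (B ⊑? U) ×-dec (U ⊑? (A ⊔ B)) ×-dec ((A ⊓ B) ⊑? 0ˢ) ×-dec
       allˢ?
         (λ {V} {V′} (p , q) add V′⊑U cyc → ℤ.≤-trans
           (ℤ.+-mono-≤ (ρ-mono (pr-mono ⊑-refl ⊑-refl q)) (ρ-mono (pr-mono ⊑-refl ⊑-refl q)))
           (ℤ.≤-trans (add (⊑-trans p V′⊑U) (Cyclic-resp (q , p) cyc)) (ρ-mono p)))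
         (λ V → (V ⊑? U) →-dec (Cyclic? V →-dec (ρ (pr A B V) + ρ (pr B A V) ℤ.≤? ρ V))))

  Reduces : Subspace E → Set (lsuc ℓ)
  Reduces U = ∃₂ λ A B → NonzeroSubspace A × NonzeroSubspace B × Splits U A B

  opaque
    reduces? : ∀ U → Dec (Reduces U)
    reduces? U = anyˢ?
      (λ p (B , (v , v∈A , v≉0) , B≠0 , s) →
        B , (v , at (proj₁ p) v∈A , v≉0) , B≠0 , splits-resp (⊑-refl , ⊑-refl) p (⊑-refl , ⊑-refl) s)
      (λ A → anyˢ?
        (λ p (A≠0 , (v , v∈B , v≉0) , s) →
          A≠0 , (v , at (proj₁ p) v∈B , v≉0) , splits-resp (⊑-refl , ⊑-refl) (⊑-refl , ⊑-refl) p s)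
        (λ B → nonzero? A ×-dec nonzero? B ×-dec splits? U A B))

  reduces-resp : ∀ {U U′} → U ≋ U′ → Reduces U → Reduces U′
  reduces-resp p (A , B , A≠0 , B≠0 , s) =
    A , B , A≠0 , B≠0 , splits-resp p (⊑-refl , ⊑-refl) (⊑-refl , ⊑-refl) s

  irreducible⇒ : ∀ {U A B} → ¬ Reduces U → Splits U A B → NonzeroSubspace A → B ⊑ 0ˢ
  irreducible⇒ irr s A≠0 = ¬nonzero⇒⊑0 (λ B≠0 → irr (_ , _ , A≠0 , B≠0 , s))

  pr⊑⇒⊑ : ∀ {A B V W} → A ⊓ B ⊑ 0ˢ → W ⊑ A → V ⊑ W ⊔ B → pr A B V ⊑ W
  pr⊑⇒⊑ {A} {B} {V} {W} dis W⊑A V⊑W⊔B = incl λ {a} p →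
    let a∈A , b , b∈B , a+b∈V = ∈pr⁻ p
        w , b′ , w∈W , b′∈B , eq = ∈⊔⁻ (at V⊑W⊔B a+b∈V)
    in respects W (components-unique dis (at W⊑A w∈W) b′∈B a∈A b∈B eq) w∈W

  -- Let `W` have full nullity in the projection, and let `X` be the part of `V` that projects into
  -- `W`. By additivity on `V`, the rank drops from `V` to `X` by at least as much as from the
  -- projection to `W`, while the codimension of `X` in `V` is no larger than that of `W`. So `X`
  -- has full nullity in `V` and equals it.
  cyclic-pr : ∀ {U A B V} → Splits U A B → V ⊑ U → Cyclic V → Cyclic (pr A B V)
  cyclic-pr {U} {A} {B} {V} s V⊑U cyc W W⊑A full =
    pr⊑⇒⊑ (disjoint s) (⊑-trans W⊑A pr⊑) (⊑-trans (cyc X ⊓-incˡ full′) ⊓-incʳ)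
    where
    X = V ⊓ (W ⊔ B)
    X⊑ : X ⊑ W ⊔ pr B A V
    X⊑ = incl λ {x} x∈X →
      let w , b , w∈W , b∈B , eq = ∈⊔⁻ (at ⊓-incʳ x∈X)
      in respects (W ⊔ pr B A V) eq (∈⊔⁺ w∈W (∈pr⁺ b∈B (at pr⊑ (at W⊑A w∈W))
           (respects V (≈ᴹ-trans (≈ᴹ-sym eq) (+ᴹ-comm w b)) (at ⊓-incˡ x∈X))))
    -- Both `V` and `W` are joined with `B`: `V ⊔ (W ⊔ B)` lies in `pr A B V ⊔ B`, and the modular
    -- law brings in `X`.
    dV+dW : d V + d W ≤ d X + d (pr A B V)
    dV+dW = ≤-shift (d V + d W) (d X + d (pr A B V))
      (ℤ.+-mono-≤ (ℤ.≤-reflexive (≡.sym (d-modular V (W ⊔ B))))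
        (ℤ.+-mono-≤ (ℤ.≤-reflexive (≡.sym (d-disjoint (⊓-zero (⊑-trans W⊑A pr⊑) ⊑-refl (disjoint s)))))
        (ℤ.+-mono-≤ (d-mono join) (d-⊔≤ (pr A B V) B))))
      (ring (d V) (d W) (d B) (d (pr A B V)) (d X) (d (W ⊔ B)) (d (V ⊔ (W ⊔ B))) (d (pr A B V ⊔ B)))
      where
      join : V ⊔ (W ⊔ B) ⊑ pr A B V ⊔ B
      join = ⊔-least (⊑-trans (⊑pr⊔pr (cover s) V⊑U) (⊔-monotone ⊑-refl pr⊑)) (⊔-monotone W⊑A ⊑-refl)
      ring : ∀ v w b p x wb vwb pb →
        v + w + (vwb + x + (wb + (pb + (p + b)))) ≡ x + p + (v + wb + (w + b + (vwb + pb)))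
      ring = solve-∀
    full′ : FullNullity X V
    full′ = ≤-shift (ρ X + d V) (ρ V + d X)
      (ℤ.+-mono-≤ (ℤ.≤-trans (ρ-mono X⊑) (ρ-⊔≤ W (pr B A V)))
        (ℤ.+-mono-≤ full (ℤ.+-mono-≤ (additive s V V⊑U cyc) dV+dW)))
      (ring (ρ X) (ρ V) (ρ W) (ρ (pr A B V)) (ρ (pr B A V)) (d X) (d V) (d W) (d (pr A B V)))
      where
      ring : ∀ rx rv rw ra rb x v w a →
        rx + v + (rw + rb + (ra + w + (rv + (x + a)))) ≡ rv + x + (rx + (rw + a + (ra + rb + (v + w))))
      ring = solve-∀

  -- The second additivity applies to `pr B A V`, which is cyclic by `cyclic-pr`. The projections of
  -- `V` to the regrouped summands are then covered by those to `A`, `S` and `T`.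
  splits-assoc : ∀ {U A B S T} → Splits U A B → Splits B S T → Splits U S (A ⊔ T)
  splits-assoc {U} {A} {B} {S} {T} s t = record
    { left     = ⊑-trans (left t) (right s)
    ; right    = ⊔-least (left s) (⊑-trans (right t) (right s))
    ; cover    = ⊑-trans (cover s) (⊔-least (⊑-trans ⊔-incˡ ⊔-incʳ)
                   (⊑-trans (cover t) (⊔-monotone ⊑-refl ⊔-incʳ)))
    ; disjoint = incl λ {x} p →
        let a , y , a∈A , y∈T , a+y≈x = ∈⊔⁻ (at ⊓-incʳ p)
            x∈S = at ⊓-incˡ p
            a∈B = ∈-cancelʳ B (at (right t) y∈T) (respects B (≈ᴹ-sym a+y≈x) (at (left t) x∈S))
            a≈0 = at (disjoint s) (∈⊓⁺ a∈A a∈B)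
            y≈x = ≈ᴹ-trans (≈ᴹ-trans (≈ᴹ-sym (+ᴹ-identityˡ y)) (+ᴹ-congʳ (≈ᴹ-sym a≈0))) a+y≈x
        in at (disjoint t) (∈⊓⁺ x∈S (respects T y≈x y∈T))
    ; additive = λ V V⊑U cyc → ≤-shift (ρ (pr S (A ⊔ T) V) + ρ (pr (A ⊔ T) S V)) (ρ V)
        (ℤ.+-mono-≤ (additive s V V⊑U cyc)
        (ℤ.+-mono-≤ (additive t (pr B A V) pr⊑ (cyclic-pr (splits-swap s) V⊑U cyc))
        (ℤ.+-mono-≤ (ρ-mono (small V)) (ℤ.≤-trans (ρ-mono (large V)) (ρ-⊔≤ _ _)))))
        (ring (ρ V) (ρ (pr A B V)) (ρ (pr B A V)) (ρ (pr S T (pr B A V))) (ρ (pr T S (pr B A V)))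
              (ρ (pr S (A ⊔ T) V)) (ρ (pr (A ⊔ T) S V)))
    }
    where
    ring : ∀ v a b x y p q →
      p + q + (v + (b + (x + (a + y)))) ≡ v + (a + b + (x + y + (p + q)))
    ring = solve-∀
    small : ∀ V → pr S (A ⊔ T) V ⊑ pr S T (pr B A V)
    small V = incl λ {x} p →
      let x∈S , z , z∈ , x+z∈V = ∈pr⁻ p
          a , y , a∈A , y∈T , a+y≈z = ∈⊔⁻ z∈
      in ∈pr⁺ x∈S y∈T (∈pr⁺ (+-closed B (at (left t) x∈S) (at (right t) y∈T)) a∈A
           (respects V (≈ᴹ-trans (+ᴹ-congˡ (≈ᴹ-trans (≈ᴹ-sym a+y≈z) (+ᴹ-comm a y)))
             (≈ᴹ-sym (+ᴹ-assoc x y a))) x+z∈V))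
    large : ∀ V → pr (A ⊔ T) S V ⊑ pr A B V ⊔ pr T S (pr B A V)
    large V = incl λ {z} p →
      let z∈ , x , x∈S , z+x∈V = ∈pr⁻ p
          a , y , a∈A , y∈T , a+y≈z = ∈⊔⁻ z∈
          y+x∈B = +-closed B (at (right t) y∈T) (at (left t) x∈S)
          a+yx∈V = respects V (≈ᴹ-trans (+ᴹ-congʳ (≈ᴹ-sym a+y≈z)) (+ᴹ-assoc a y x)) z+x∈V
      in respects (pr A B V ⊔ pr T S (pr B A V)) a+y≈z (∈⊔⁺ (∈pr⁺ a∈A y+x∈B a+yx∈V)
           (∈pr⁺ y∈T x∈S (∈pr⁺ y+x∈B a∈A (respects V (+ᴹ-comm _ _) a+yx∈V))))

  -- `V ⊔ B` need not be cyclic, so additivity is used on its cyclic core `K`. It bounds the nullity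
  -- of `K` by those of its projections, which are at most those of `V` and `B`; dimensions add up
  -- because `V` and `B` are disjoint.
  splits-rank : ∀ {U A B V} → Splits U A B → V ⊑ A → ρ V + ρ B ≤ ρ (V ⊔ B)
  splits-rank {U} {A} {B} {V} s V⊑A with cyclicCore (V ⊔ B)
  ... | K , K⊑S , cyc , full = ≤-shift (ρ V + ρ B) (ρ (V ⊔ B))
    (ℤ.+-mono-≤ full (ℤ.+-mono-≤ (additive s K K⊑U cyc)
    (ℤ.+-mono-≤ (nullity-mono (pr⊑⇒⊑ (disjoint s) V⊑A K⊑S))
    (ℤ.+-mono-≤ (nullity-mono (pr⊑ {B} {A} {K}))
    (ℤ.+-mono-≤ (ℤ.≤-trans (d-mono (⊑pr⊔pr (cover s) K⊑U)) (d-⊔≤ (pr A B K) (pr B A K)))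
      (ℤ.≤-reflexive (≡.sym (d-disjoint (⊓-zero V⊑A ⊑-refl (disjoint s))))))))))
    (ring (ρ K) (ρ (V ⊔ B)) (ρ V) (ρ B) (ρ (pr A B K)) (ρ (pr B A K))
          (d K) (d (V ⊔ B)) (d V) (d B) (d (pr A B K)) (d (pr B A K)))
    where
    K⊑U : K ⊑ U
    K⊑U = ⊑-trans K⊑S (⊔-least (⊑-trans V⊑A (left s)) (right s))
    ring : ∀ rk rs rv rb rp rq k s v b p q →
      rv + rb + (rs + k + (rk + (rp + v + (rq + b + (p + q + s))))) ≡
      rs + (rk + s + (rp + rq + (rv + p + (rb + q + (k + (v + b))))))
    ring = solve-∀

  -- `ρ B` cancels from `ρ V + ρ B ≤ ρ (V ⊔ B) ≤ ρ (W ⊔ B) ≤ ρ W + ρ B`. Hence ranks inside a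
  -- summand survive corrections by vectors of the other one.
  splits-shift : ∀ {U A B V W} → Splits U A B → V ⊑ A → V ⊑ W ⊔ B → ρ V ≤ ρ W
  splits-shift {U} {A} {B} {V} {W} s V⊑A V⊑W⊔B = ≤-shift (ρ V) (ρ W)
    (ℤ.+-mono-≤ (splits-rank s V⊑A)
      (ℤ.≤-trans (ρ-mono (⊔-least V⊑W⊔B ⊔-incʳ)) (ρ-⊔≤ W B)))
    (ring (ρ V) (ρ B) (ρ W) (ρ (V ⊔ B)))
    where
    ring : ∀ v b w s → v + (s + (w + b)) ≡ w + (v + b + s)
    ring = solve-∀

  -- A cyclic `V` lies in `A`, so its projections lie in `V` and in `0ˢ`, whatever complement `B`
  -- was chosen.
  splits-cyclic : ∀ {U A B} → A ⊑ U → Complement A U B → (∀ V → V ⊑ U → Cyclic V → V ⊑ A) →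
                  Splits U A B
  splits-cyclic {U} {A} {B} A⊑U (B⊑U , dis , cov) cyc⊑A = record
    { left = A⊑U ; right = B⊑U ; cover = cov ; disjoint = dis
    ; additive = λ V V⊑U cyc → begin
        ρ (pr A B V) + ρ (pr B A V)
          ≤⟨ ℤ.+-mono-≤ (ρ-mono (inside V (cyc⊑A V V⊑U cyc))) (ρ-mono (vanish V (cyc⊑A V V⊑U cyc))) ⟩
        ρ V + ρ 0ˢ  ≡⟨ ≡.cong (ρ V +_) ρ-0ˢ ⟩
        ρ V + 0ℤ    ≡⟨ ℤ.+-identityʳ (ρ V) ⟩
        ρ V         ∎
    }
    where
    open ℤ.≤-Reasoning
    vanish : ∀ V → V ⊑ A → pr B A V ⊑ 0ˢ
    vanish V V⊑A = pr⊑⇒⊑ (⊑-trans ⊓-swap dis) 0⊑ (⊑-trans V⊑A ⊔-incʳ)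
    inside : ∀ V → V ⊑ A → pr A B V ⊑ V
    inside V V⊑A = pr⊑⇒⊑ dis V⊑A ⊔-incˡ

  -- The projection to `A` has rank 0, and projecting along `A` only joins `V` with a subspace of
  -- rank 0.
  splits-rank0 : ∀ {U A B} → A ⊑ U → Complement A U B → ρ A ≤ 0ℤ → Splits U A B
  splits-rank0 {U} {A} {B} A⊑U (B⊑U , dis , cov) ρA≤0 = record
    { left = A⊑U ; right = B⊑U ; cover = cov ; disjoint = dis
    ; additive = λ V V⊑U cyc → begin
        ρ (pr A B V) + ρ (pr B A V)
          ≤⟨ ℤ.+-mono-≤ (ℤ.≤-trans (ρ-mono pr⊑) ρA≤0) (ℤ.≤-trans (ρ-mono ⊓-incˡ) (ρ-⊔-rank0 V ρA≤0)) ⟩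
        0ℤ + ρ V  ≡⟨ ℤ.+-identityˡ (ρ V) ⟩
        ρ V       ∎
    }
    where open ℤ.≤-Reasoning

-- Loops and the exchange property

module _ {ℓ} {F : FiniteField ℓ} {E : FiniteDimensionalSpace F} (M : QMatroid E) where
  open FiniteField F using (_≈_; 0#)
  open FiniteDimensionalSpace E
  open Subspace
  open Splits
  private
    module +ᴹ = CommutativeSemigroupProperties
      (CommutativeMonoid.commutativeSemigroup +ᴹ-commutativeMonoid)

  loops : Subspace E
  loops = record
    { Member    = λ x → Lift ℓ (ρ M (line x) ≤ 0ℤ)
    ; member?   = λ x → Dec.map′ lift lower (ρ M (line x) ℤ.≤? 0ℤ)
    ; respects  = λ {x} {y} eq (lift p) → lift (ℤ.≤-trans
        (ρ-mono M (line⊑ (respects (line x) eq (∈line x)))) p)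
    ; 0-closed  = lift (ℤ.≤-trans (ρ-mono M {line 0ᴹ} {0ˢ} (line⊑ ≈ᴹ-refl))
        (ℤ.≤-reflexive (ρ-0ˢ M)))
    ; +-closed  = λ {x} {y} (lift p) (lift q) → lift (ℤ.≤-trans
        (ρ-mono M (line⊑ (∈⊔⁺ (∈line x) (∈line y))))
        (ℤ.≤-trans (ρ-⊔-rank0 M (line x) q) p))
    ; *ₗ-closed = λ c {x} (lift p) → lift (ℤ.≤-trans
        (ρ-mono M (line⊑ (*ₗ-closed (line x) c (∈line x)))) p)
    }

  ∈loops : ∀ {V x} → ρ M V ≤ 0ℤ → x ∈ V → x ∈ loops
  ∈loops ρV≤0 x∈V = lift (ℤ.≤-trans (ρ-mono M (line⊑ x∈V)) ρV≤0)

  opaque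
    unfolding _⊔_

    -- Along a chain from `0ˢ` to `loops` every step joins a line of rank 0.
    ρ-loops : ρ M loops ≤ 0ℤ
    ρ-loops = go (proj₂ (chain 0ˢ loops (0ˢ⊆ loops))) (ℤ.≤-reflexive (ρ-0ˢ M))
      where
      go : ∀ {U k} → Chain U loops k → ρ M U ≤ 0ℤ → ρ M loops ≤ 0ℤ
      go (done _ loops⊆U) ρU≤0 = ℤ.≤-trans (ρ-mono M (incl loops⊆U)) ρU≤0
      go {U} (step x (lift p) _ c) ρU≤0 = go c (ℤ.≤-trans (ρ-⊔-rank0 M U p) ρU≤0)

  -- In rank 0 the nullity is the dimension, and a proper subspace has a smaller one.
  rank0⇒cyclic : ∀ {V} → ρ M V ≤ 0ℤ → Cyclic M V
  rank0⇒cyclic {V} ρV≤0 W W⊑V full = Dec.decidable-stable (V ⊑? W) λ V⋢W →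
    ℕ.<⇒≱ (dim-strict W⊑V V⋢W) (ℤ.drop‿+≤+ (≤-shift (d V) (d W)
      (ℤ.+-mono-≤ full (ℤ.+-mono-≤ ρV≤0 (0≤ρ M W)))
      (ring (ρ M W) (d V) (ρ M V) (d W))))
    where
    ring : ∀ w v r e → v + (r + e + (0ℤ + w)) ≡ e + (w + v + (r + 0ℤ))
    ring = solve-∀

  -- `loops` is cyclic, having rank 0, so additivity forces its projection to `A` to have rank 0 as
  -- well.
  loops-component : ∀ {A B : Subspace E} {a b} → Splits M ⊤ˢ A B → a ∈ A → b ∈ B →
                    a +ᴹ b ∈ loops → a ∈ loops
  loops-component {A} {B} s a∈A b∈B p = ∈loops (begin
    ρ M (pr M A B loops)                             ≡⟨ ℤ.+-identityʳ _ ⟨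
    ρ M (pr M A B loops) + 0ℤ
      ≤⟨ ℤ.+-monoʳ-≤ (ρ M (pr M A B loops)) (0≤ρ M (pr M B A loops)) ⟩
    ρ M (pr M A B loops) + ρ M (pr M B A loops)
      ≤⟨ additive s loops ⊑⊤ (rank0⇒cyclic ρ-loops) ⟩
    ρ M loops                                        ≤⟨ ρ-loops ⟩
    0ℤ                                               ∎) (∈pr⁺ M a∈A b∈B p)
    where open ℤ.≤-Reasoning

  loops⊑complement : ∀ {A B} → Splits M ⊤ˢ A B → A ⊓ loops ⊑ 0ˢ → loops ⊑ B
  loops⊑complement {A} {B} s loopless = incl λ {l} l∈L →
    let a , b , a∈A , b∈B , a+b≈l = ∈⊔⁻ (at (cover s) {l} tt)
        a∈L = loops-component s a∈A b∈B (respects loops (≈ᴹ-sym a+b≈l) l∈L)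
        a≈0 = at loopless (∈⊓⁺ a∈A a∈L)
    in respects B (≈ᴹ-trans (≈ᴹ-trans (≈ᴹ-sym (+ᴹ-identityˡ b)) (+ᴹ-congʳ (≈ᴹ-sym a≈0))) a+b≈l) b∈B

  module _ {A A′ G G′ : Subspace E} (s : Splits M ⊤ˢ A A′) (t : Splits M ⊤ˢ G G′)
           (cyc : Cyclic M A) where

    -- The sum `S` of the projections of `A` contains `A` but, by additivity for the cyclic `A`, has
    -- no larger rank. Subtracting from `y` its component in `A` leaves a vector of `S` in `A′`; by
    -- `splits-rank` it would add to the rank of `A` unless it is a loop.
    component∈⊔loops : ∀ {x y z} → x ∈ A → y ∈ G → z ∈ G′ → y +ᴹ z ≈ᴹ x → y ∈ A ⊔ loops
    component∈⊔loops {x} {y} {z} x∈A y∈G z∈G′ y+z≈x =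
      let a , a′ , a∈A , a′∈A′ , a+a′≈y = ∈⊔⁻ (at (cover s) {y} tt)
          a′∈S = ∈-cancelˡ S (at (⊑pr⊔pr M (cover t) ⊑⊤) a∈A) (respects S (≈ᴹ-sym a+a′≈y) y∈S)
      in respects (A ⊔ loops) a+a′≈y (∈⊔⁺ a∈A (lift (small a′∈A′ a′∈S)))
      where
      S : Subspace E
      S = pr M G G′ A ⊔ pr M G′ G A
      y∈S : y ∈ S
      y∈S = at ⊔-incˡ (∈pr⁺ M y∈G z∈G′ (respects A (≈ᴹ-sym y+z≈x) x∈A))
      small : ∀ {a′} → a′ ∈ A′ → a′ ∈ S → ρ M (line a′) ≤ 0ℤ
      small {a′} a′∈A′ a′∈S = ≤-shift (ρ M (line a′)) 0ℤ
        (ℤ.+-mono-≤ (splits-rank M (splits-swap M s) (line⊑ a′∈A′))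
        (ℤ.+-mono-≤ (ρ-mono M (⊔-least (line⊑ a′∈S) (⊑pr⊔pr M (cover t) ⊑⊤)))
        (ℤ.+-mono-≤ (ρ-⊔≤ M (pr M G G′ A) (pr M G′ G A)) (additive t A ⊑⊤ cyc))))
        (ring (ρ M (line a′)) (ρ M A) (ρ M (line a′ ⊔ A)) (ρ M S) (ρ M (pr M G G′ A)) (ρ M (pr M G′ G A)))
        where
        ring : ∀ l a la s p q → l + (la + (s + (p + q + a))) ≡ 0ℤ + (l + a + (la + (s + (p + q))))
        ring = solve-∀

  -- Write `u = g + l` and `u′ = g′ + l′` with loops `l` and `l′`. The total error `l + l′` is
  -- decomposed along `G` and `G′`, and its component `h` in `G` is a loop. So `u` differs by loops
  -- from `g + h`, the component of `u + u′` in `G`.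
  pr⊑pr⊔loops : ∀ {A G G′ V} → Splits M ⊤ˢ G G′ →
    pr M (A ⊓ (G ⊔ loops)) (A ⊓ (G′ ⊔ loops)) V ⊑ pr M G G′ V ⊔ loops
  pr⊑pr⊔loops {A} {G} {G′} {V} t = incl λ {u} p →
    let u∈ , u′ , u′∈ , u+u′∈V = ∈pr⁻ M p
        g , l , g∈G , l∈L , g+l≈u = ∈⊔⁻ (at ⊓-incʳ u∈)
        g′ , l′ , g′∈G′ , l′∈L , g′+l′≈u′ = ∈⊔⁻ (at ⊓-incʳ u′∈)
        h , h′ , h∈G , h′∈G′ , h+h′≈ = ∈⊔⁻ (at (cover t) {l +ᴹ l′} tt)
        h∈L = loops-component t h∈G h′∈G′ (respects loops (≈ᴹ-sym h+h′≈) (+-closed loops l∈L l′∈L))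
        sum≈ = ≈ᴹ-trans (+ᴹ-cong (≈ᴹ-sym g+l≈u) (≈ᴹ-sym g′+l′≈u′))
          (≈ᴹ-trans (+ᴹ.interchange g l g′ l′)
          (≈ᴹ-trans (+ᴹ-congˡ (≈ᴹ-sym h+h′≈)) (+ᴹ.interchange g g′ h h′)))
        g+h∈ = ∈pr⁺ M (+-closed G g∈G h∈G) (+-closed G′ g′∈G′ h′∈G′) (respects V sum≈ u+u′∈V)
        P = pr M G G′ V ⊔ loops
    in respects P g+l≈u (+-closed P (∈-cancelʳ P (at ⊔-incʳ h∈L) (at ⊔-incˡ g+h∈)) (at ⊔-incʳ l∈L))

  module _ {A A′ G G′ : Subspace E} (s : Splits M ⊤ˢ A A′) (t : Splits M ⊤ˢ G G′)
           (cyc : Cyclic M A) (loopless : A ⊓ loops ⊑ 0ˢ) where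

    splits-loopless : Splits M A (A ⊓ (G ⊔ loops)) (A ⊓ (G′ ⊔ loops))
    splits-loopless = record
      { left     = ⊓-incˡ
      ; right    = ⊓-incˡ
      ; cover    = incl λ {x} x∈A →
          let y , z , y∈G , z∈G′ , y+z≈x = ∈⊔⁻ (at (cover t) {x} tt)
              a₁ , l₁ , a₁∈A , l₁∈L , a₁+l₁≈y = ∈⊔⁻ (component∈⊔loops s t cyc x∈A y∈G z∈G′ y+z≈x)
              a₂ , l₂ , a₂∈A , l₂∈L , a₂+l₂≈z =
                ∈⊔⁻ (component∈⊔loops s (splits-swap M t) cyc x∈A z∈G′ y∈G (≈ᴹ-trans (+ᴹ-comm z y) y+z≈x))
              a₁∈T = ∈-cancelʳ (G ⊔ loops) (at ⊔-incʳ l₁∈L)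
                (respects (G ⊔ loops) (≈ᴹ-sym a₁+l₁≈y) (at ⊔-incˡ y∈G))
              a₂∈T = ∈-cancelʳ (G′ ⊔ loops) (at ⊔-incʳ l₂∈L)
                (respects (G′ ⊔ loops) (≈ᴹ-sym a₂+l₂≈z) (at ⊔-incˡ z∈G′))
              a₁+a₂≈x = components-unique loopless (+-closed A a₁∈A a₂∈A) (+-closed loops l₁∈L l₂∈L)
                x∈A (0-closed loops) (≈ᴹ-trans (+ᴹ.interchange a₁ a₂ l₁ l₂)
                  (≈ᴹ-trans (+ᴹ-cong a₁+l₁≈y a₂+l₂≈z) (≈ᴹ-trans y+z≈x (≈ᴹ-sym (+ᴹ-identityʳ x)))))
          in respects (A ⊓ (G ⊔ loops) ⊔ A ⊓ (G′ ⊔ loops)) a₁+a₂≈x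
               (∈⊔⁺ (∈⊓⁺ a₁∈A a₁∈T) (∈⊓⁺ a₂∈A a₂∈T))
      ; disjoint = incl λ {x} p →
          let g , l , g∈G , l∈L , g+l≈x = ∈⊔⁻ (at ⊓-incʳ (at ⊓-incˡ p))
              g′ , l′ , g′∈G′ , l′∈L , g′+l′≈x = ∈⊔⁻ (at ⊓-incʳ (at ⊓-incʳ p))
              -- The two expressions for `x` make `g - g′` a loop, hence `g` a loop, hence `x` one
              -- too.
              eq : (g +ᴹ -ᴹ g′) +ᴹ l ≈ᴹ l′
              eq = ≈ᴹ-trans (+ᴹ.xy∙z≈xz∙y g (-ᴹ g′) l)
                (≈ᴹ-trans (+ᴹ-congʳ (≈ᴹ-trans g+l≈x (≈ᴹ-sym g′+l′≈x)))
                (≈ᴹ-trans (+ᴹ-comm _ _) (x+-x+y≈y {E = E} g′ l′)))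
              g∈L = loops-component t g∈G (-ᴹ-closed G′ g′∈G′)
                (∈-cancelʳ loops l∈L (respects loops (≈ᴹ-sym eq) l′∈L))
          in at loopless (∈⊓⁺ (at ⊓-incˡ (at ⊓-incˡ p)) (respects loops g+l≈x (+-closed loops g∈L l∈L)))
      ; additive = λ V _ cycV → ℤ.≤-trans
          (ℤ.+-mono-≤
            (ℤ.≤-trans (ρ-mono M (pr⊑pr⊔loops t)) (ρ-⊔-rank0 M (pr M G G′ V) ρ-loops))
            (ℤ.≤-trans (ρ-mono M (pr⊑pr⊔loops (splits-swap M t))) (ρ-⊔-rank0 M (pr M G′ G V) ρ-loops)))
          (additive t V ⊑⊤ cycV)
      }

    -- One of the two parts in splits-loopless vanishes, and it is not the one
    -- that g contributes to; hence A ⊑ G ⊔ loops.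
    component∈loops : ∀ {a g g′} → ¬ Reduces M A →
      a ∈ A → g ∈ G → g′ ∈ G′ → g +ᴹ g′ ≈ᴹ a → ¬ (g ∈ A′) →
      ∀ {x y z} → x ∈ A → y ∈ G → z ∈ G′ → y +ᴹ z ≈ᴹ x → z ∈ loops
    component∈loops {g = g} irr a∈A g∈G g′∈G′ g+g′≈a g∉A′ {x} {y} {z} x∈A y∈G z∈G′ y+z≈x =
      let a₁ , l₁ , a₁∈A , l₁∈L , a₁+l₁≈g = ∈⊔⁻ (component∈⊔loops s t cyc a∈A g∈G g′∈G′ g+g′≈a)
          a₁∈T = ∈-cancelʳ (G ⊔ loops) (at ⊔-incʳ l₁∈L)
            (respects (G ⊔ loops) (≈ᴹ-sym a₁+l₁≈g) (at ⊔-incˡ g∈G))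
          a₁≉0 = λ a₁≈0 → g∉A′ (at (loops⊑complement s loopless) (respects loops
            (≈ᴹ-trans (≈ᴹ-sym (+ᴹ-identityˡ l₁)) (≈ᴹ-trans (+ᴹ-congʳ (≈ᴹ-sym a₁≈0)) a₁+l₁≈g)) l₁∈L))
          T₂⊑0 = irreducible⇒ M irr splits-loopless (a₁ , ∈⊓⁺ a₁∈A a₁∈T , a₁≉0)
          a₂ , l₂ , a₂∈A , l₂∈L , a₂+l₂≈z =
            ∈⊔⁻ (component∈⊔loops s (splits-swap M t) cyc x∈A z∈G′ y∈G (≈ᴹ-trans (+ᴹ-comm z y) y+z≈x))
          a₂∈T = ∈-cancelʳ (G′ ⊔ loops) (at ⊔-incʳ l₂∈L)
            (respects (G′ ⊔ loops) (≈ᴹ-sym a₂+l₂≈z) (at ⊔-incˡ z∈G′))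
          a₂≈0 = at T₂⊑0 (∈⊓⁺ a₂∈A a₂∈T)
      in respects loops
           (≈ᴹ-trans (≈ᴹ-sym (+ᴹ-identityˡ l₂)) (≈ᴹ-trans (+ᴹ-congʳ (≈ᴹ-sym a₂≈0)) a₂+l₂≈z)) l₂∈L

  module _ {A : Subspace E} (irr : ¬ Reduces M A) where

    -- The cyclic core `K` of `A` contains every cyclic subspace of `A`, so it splits off.
    -- Irreducibility leaves `K` zero or `K = A`, and the latter would make `A` cyclic.
    noncyclic⇒cyclic⊑0 : ¬ Cyclic M A → ∀ V → V ⊑ A → Cyclic M V → V ⊑ 0ˢ
    noncyclic⇒cyclic⊑0 ¬cyc V V⊑A cycV with cyclicCore M A
    ... | K , K⊑A , cycK , full = ⊑-trans (cyclic⊑full M cycV V⊑A K⊑A full) (¬nonzero⇒⊑0 λ K≠0 →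
      let K′ , K′⊑A , dis , cov = complement K⊑A
          K′⊑0 = irreducible⇒ M irr (splits-cyclic M K⊑A (K′⊑A , dis , cov)
            (λ W W⊑A cycW → cyclic⊑full M cycW W⊑A K⊑A full)) K≠0
      in ¬cyc (Cyclic-resp M (K⊑A , ⊑-trans cov (⊔-least ⊑-refl (⊑-trans K′⊑0 0⊑))) cycK))

    ⊑line : ∀ {x} → x ∈ A → ¬ (x ≈ᴹ 0ᴹ) →
            (∀ {K} → Complement (line x) A K → Splits M A (line x) K) → A ⊑ line x
    ⊑line {x} x∈A x≉0 split with complement (line⊑ x∈A)
    ... | K , comp@(_ , _ , cov) = ⊑-trans cov
      (⊔-least ⊑-refl (⊑-trans (irreducible⇒ M irr (split comp) (x , ∈line x , x≉0)) 0⊑))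

    loop⇒⊑line : ∀ {x} → x ∈ A → ¬ (x ≈ᴹ 0ᴹ) → x ∈ loops → A ⊑ line x
    loop⇒⊑line x∈A x≉0 (lift p) = ⊑line x∈A x≉0 (λ comp → splits-rank0 M (line⊑ x∈A) comp p)

    -- With no cyclic subspace except zero, every complement of every line splits.
    noncyclic⇒⊑line : ∀ {x} → x ∈ A → ¬ (x ≈ᴹ 0ᴹ) → ¬ Cyclic M A → A ⊑ line x
    noncyclic⇒⊑line x∈A x≉0 ¬cyc = ⊑line x∈A x≉0 (λ comp → splits-cyclic M (line⊑ x∈A) comp
      (λ V V⊑A cycV → ⊑-trans (noncyclic⇒cyclic⊑0 ¬cyc V V⊑A cycV) 0⊑))

  -- Since `g` is outside `A′`, its component in `A` is a nonzero multiple of `a`, so `a` is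
  -- recovered from `g` and `A′`.
  complement-line : ∀ {A A′ G : Subspace E} {a g} → ⊤ˢ ⊑ A ⊔ A′ → A ⊑ line a → G ⊑ line g →
                    g ∈ G → ¬ (g ∈ A′) → Complement G ⊤ˢ A′
  complement-line {A} {A′} {G} {a} {g} cov A⊑a G⊑g g∈G g∉A′ =
    ⊑⊤ , incl (λ p → ∈line⇒≈0 {E = E} {A′} g∉A′ (at G⊑g (at ⊓-incˡ p)) (at ⊓-incʳ p)) ,
    ⊑-trans cov (⊔-least (⊑-trans A⊑a (line⊑ a∈)) ⊔-incʳ)
    where
    a∈ : a ∈ G ⊔ A′
    a∈ with ∈⊔⁻ (at cov {g} tt)
    ... | x , x′ , x∈A , x′∈A′ , x+x′≈g with ∈line⁻ (at A⊑a x∈A)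
    ... | c , ca≈x = ∈-cancel-*ₗ (G ⊔ A′) c≉0 (respects (G ⊔ A′) (≈ᴹ-sym ca≈x)
      (∈-cancelʳ (G ⊔ A′) (at ⊔-incʳ x′∈A′) (respects (G ⊔ A′) (≈ᴹ-sym x+x′≈g) (at ⊔-incˡ g∈G))))
      where
      c≉0 : ¬ (c ≈ 0#)
      c≉0 c≈0 = g∉A′ (respects A′ (≈ᴹ-trans (≈ᴹ-sym (+ᴹ-identityˡ x′)) (≈ᴹ-trans
        (+ᴹ-congʳ (≈ᴹ-trans (≈ᴹ-sym (*ₗ-zeroˡ a)) (≈ᴹ-trans (*ₗ-congʳ (FiniteField.sym F c≈0)) ca≈x)))
        x+x′≈g)) x′∈A′)

  module _ {A A′ G G′ : Subspace E} {a g g′} (s : Splits M ⊤ˢ A A′) (t : Splits M ⊤ˢ G G′)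
           (irrA : ¬ Reduces M A) (irrG : ¬ Reduces M G)
           (a∈A : a ∈ A) (g∈G : g ∈ G) (g′∈G′ : g′ ∈ G′) (g+g′≈a : g +ᴹ g′ ≈ᴹ a)
           (g∉A′ : ¬ (g ∈ A′)) where

    private
      g≉0 : ¬ (g ≈ᴹ 0ᴹ)
      g≉0 g≈0 = g∉A′ (0ˢ⊆ A′ g≈0)

      a≉0 : ¬ (a ≈ᴹ 0ᴹ)
      a≉0 a≈0 = g≉0 (components-unique (disjoint t) g∈G g′∈G′ (0-closed G) (0-closed G′)
        (≈ᴹ-trans g+g′≈a (≈ᴹ-trans a≈0 (≈ᴹ-sym (+ᴹ-identityʳ 0ᴹ)))))

      -- Every cyclic subspace projects to a cyclic subspace of `A`, that is to zero, and so lies in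
      -- `A′`; any complement of `A′` then splits. As `G` is not contained in `A′`, it is not cyclic
      -- and is a line too.
      exchange-noncyclic : ¬ Cyclic M A → Splits M ⊤ˢ G A′
      exchange-noncyclic ¬cyc = splits-swap M (splits-cyclic M ⊑⊤
          (⊑⊤ , ⊑-trans ⊓-swap dis , ⊑-trans cov ⊔-swap) cyclic⊑A′)
        where
        cyclic⊑A′ : ∀ V → V ⊑ ⊤ˢ → Cyclic M V → V ⊑ A′
        cyclic⊑A′ V V⊑⊤ cycV = ⊑-trans (⊑pr⊔pr M (cover s) V⊑⊤)
          (⊔-least (⊑-trans (noncyclic⇒cyclic⊑0 irrA ¬cyc _ (pr⊑ M) (cyclic-pr M s V⊑⊤ cycV)) 0⊑) (pr⊑ M))
        comp : Complement G ⊤ˢ A′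
        comp = complement-line (cover s) (noncyclic⇒⊑line irrA a∈A a≉0 ¬cyc)
          (noncyclic⇒⊑line irrG g∈G g≉0 (λ cycG → g∉A′ (at (cyclic⊑A′ G ⊑⊤ cycG) g∈G))) g∈G g∉A′
        dis = proj₁ (proj₂ comp)
        cov = proj₂ (proj₂ comp)

      -- A nonzero loop spans `A`, so `a` and its component `g` are loops, and `g` spans `G`.
      exchange-loop : NonzeroSubspace (A ⊓ loops) → Splits M ⊤ˢ G A′
      exchange-loop (x , x∈ , x≉0) = splits-rank0 M ⊑⊤
        (complement-line (cover s) A⊑x G⊑g g∈G g∉A′) (ℤ.≤-trans (ρ-mono M G⊑g) (lower g∈L))
        where
        A⊑x : A ⊑ line x
        A⊑x = loop⇒⊑line irrA (at ⊓-incˡ x∈) x≉0 (at ⊓-incʳ x∈)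
        g∈L : g ∈ loops
        g∈L = loops-component t g∈G g′∈G′
          (respects loops (≈ᴹ-sym g+g′≈a) (at {W = loops} (⊑-trans A⊑x (line⊑ (at ⊓-incʳ x∈))) a∈A))
        G⊑g : G ⊑ line g
        G⊑g = loop⇒⊑line irrG g∈G g≉0 g∈L

      -- The components in `G′` of vectors of `A`, and in `A′` of vectors of `G`, are loops. Loops
      -- lie in `A′` and leave ranks unchanged, so the additivity of `s` carries over to `G` and
      -- `A′`.
      exchange-loopless : Cyclic M A → A ⊓ loops ⊑ 0ˢ → Splits M ⊤ˢ G A′
      exchange-loopless cycA looplessA = record
        { left     = ⊑⊤
        ; right    = ⊑⊤
        ; cover    = ⊑-trans (cover s) (⊔-least (incl λ {x} x∈A →
            let y , z , y∈G , z∈G′ , y+z≈x = ∈⊔⁻ (at (cover t) {x} tt)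
            in respects (G ⊔ A′) y+z≈x
                 (∈⊔⁺ y∈G (at loops⊑A′ (A-component x∈A y∈G z∈G′ y+z≈x)))) ⊔-incʳ)
        ; disjoint = incl λ {x} p → at looplessG (∈⊓⁺ (at ⊓-incˡ p)
            (G-component (at ⊓-incˡ p) (0-closed A) (at ⊓-incʳ p) (+ᴹ-identityˡ x)))
        ; additive = λ V _ cycV → ℤ.≤-trans
            (ℤ.+-mono-≤
              (ℤ.≤-trans (ρ-mono M (prG⊑ V)) (ρ-⊔-rank0 M (pr M A A′ V) ρ-loops))
              (ℤ.≤-trans (ρ-mono M (prA′⊑ V)) (ρ-⊔-rank0 M (pr M A′ A V) ρ-loops)))
            (additive s V ⊑⊤ cycV)
        }
        where
        loops⊑A′ : loops ⊑ A′
        loops⊑A′ = loops⊑complement s looplessA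
        -- Otherwise the projection of the cyclic `A` to `G` would be zero, yet it contains `g`.
        cycG : Cyclic M G
        cycG = Dec.decidable-stable (Cyclic? M G) λ ¬cyc → g≉0
          (at (noncyclic⇒cyclic⊑0 irrG ¬cyc (pr M G G′ A) (pr⊑ M) (cyclic-pr M t ⊑⊤ cycA))
            (∈pr⁺ M g∈G g′∈G′ (respects A (≈ᴹ-sym g+g′≈a) a∈A)))
        -- A nonzero loop would span `G` and put `g` in `A′`.
        looplessG : G ⊓ loops ⊑ 0ˢ
        looplessG = ¬nonzero⇒⊑0 λ (x , x∈ , x≉0) → g∉A′ (at (⊑-trans
          (loop⇒⊑line irrG (at ⊓-incˡ x∈) x≉0 (at ⊓-incʳ x∈))
          (⊑-trans (line⊑ (at ⊓-incʳ x∈)) loops⊑A′)) g∈G)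
        A-component : ∀ {x y z} → x ∈ A → y ∈ G → z ∈ G′ → y +ᴹ z ≈ᴹ x → z ∈ loops
        A-component = component∈loops s t cycA looplessA irrA a∈A g∈G g′∈G′ g+g′≈a g∉A′
        a-g′≈g : a +ᴹ -ᴹ g′ ≈ᴹ g
        a-g′≈g = ≈ᴹ-trans (+ᴹ-congʳ (≈ᴹ-sym g+g′≈a)) (x+y-y≈x {E = E} g g′)
        a∉G′ : ¬ (a ∈ G′)
        a∉G′ a∈G′ = g≉0 (at (disjoint t) (∈⊓⁺ g∈G
          (respects G′ a-g′≈g (+-closed G′ a∈G′ (-ᴹ-closed G′ g′∈G′)))))
        -- The roles of the two splittings are exchanged: `g` has components `a` and `-g′`, the
        -- latter in `A′` because `g′` is a loop.
        G-component : ∀ {x y z} → x ∈ G → y ∈ A → z ∈ A′ → y +ᴹ z ≈ᴹ x → z ∈ loops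
        G-component = component∈loops t s cycG looplessG irrG g∈G a∈A
          (-ᴹ-closed A′ (at loops⊑A′ (A-component a∈A g∈G g′∈G′ g+g′≈a))) a-g′≈g a∉G′
        module _ (V : Subspace E) where
          prG⊑ : pr M G A′ V ⊑ pr M A A′ V ⊔ loops
          prG⊑ = incl λ {x} p →
            let x∈G , b , b∈A′ , x+b∈V = ∈pr⁻ M p
                y , z , y∈A , z∈A′ , y+z≈x = ∈⊔⁻ (at (cover s) {x} tt)
            in respects (pr M A A′ V ⊔ loops) y+z≈x (∈⊔⁺
                 (∈pr⁺ M y∈A (+-closed A′ z∈A′ b∈A′)
                   (respects V (≈ᴹ-trans (+ᴹ-congʳ (≈ᴹ-sym y+z≈x)) (+ᴹ-assoc y z b)) x+b∈V))
                 (G-component x∈G y∈A z∈A′ y+z≈x))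
          prA′⊑ : pr M A′ G V ⊑ pr M A′ A V ⊔ loops
          prA′⊑ = incl λ {b} p →
            let b∈A′ , x , x∈G , b+x∈V = ∈pr⁻ M p
                y , z , y∈A , z∈A′ , y+z≈x = ∈⊔⁻ (at (cover s) {x} tt)
                P = pr M A′ A V ⊔ loops
            in ∈-cancelʳ P (at ⊔-incʳ (G-component x∈G y∈A z∈A′ y+z≈x)) (at ⊔-incˡ
                 (∈pr⁺ M (+-closed A′ b∈A′ z∈A′) y∈A (respects V (≈ᴹ-trans
                   (+ᴹ-congˡ (≈ᴹ-trans (≈ᴹ-sym y+z≈x) (+ᴹ-comm y z))) (≈ᴹ-sym (+ᴹ-assoc b z y))) b+x∈V)))

    exchange : Splits M ⊤ˢ G A′
    exchange with Cyclic? M A | nonzero? (A ⊓ loops)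
    ... | no ¬cyc  | _         = exchange-noncyclic ¬cyc
    ... | yes _    | yes loop  = exchange-loop loop
    ... | yes cycA | no ¬loop  = exchange-loopless cycA (¬nonzero⇒⊑0 ¬loop)

-- Rank-preserving injections

module _ {ℓ} {F : FiniteField ℓ} where
  open FiniteField F using (K)

  infix 4 _↪_

  -- Summands live on spaces of their own. Each is represented by an injection into one ambient
  -- space, so that statements about them become statements about ranges, to which `Splits` applies.
  record _↪_ (D E : FiniteDimensionalSpace F) : Set ℓ where
    private
      module D = FiniteDimensionalSpace D
      module E = FiniteDimensionalSpace E
    field
      fun       : D.Carrierᴹ → E.Carrierᴹ
      isLinear  : IsLinear D E fun
      injective : ∀ {v w} → fun v E.≈ᴹ fun w → v D.≈ᴹ w
    open LeftModuleMorphisms.IsLeftModuleHomomorphism isLinear public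
      using (⟦⟧-cong; +ᴹ-homo; *ₗ-homo; 0ᴹ-homo)
  open _↪_

  module _ {D E : FiniteDimensionalSpace F} (φ : D ↪ E) where
    private
      module D = FiniteDimensionalSpace D
      module E = FiniteDimensionalSpace E
      module φ = _↪_ φ
    open Subspace

    pull : Subspace E → Subspace D
    pull W = record
      { Member    = λ v → φ.fun v ∈ W
      ; member?   = λ v → member? W (φ.fun v)
      ; respects  = λ eq → respects W (φ.⟦⟧-cong eq)
      ; 0-closed  = respects W (E.≈ᴹ-sym φ.0ᴹ-homo) (0-closed W)
      ; +-closed  = λ p q → respects W (E.≈ᴹ-sym (φ.+ᴹ-homo _ _)) (+-closed W p q)
      ; *ₗ-closed = λ c p → respects W (E.≈ᴹ-sym (φ.*ₗ-homo c _)) (*ₗ-closed W c p)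
      }

    fun-linComb : ∀ {n} (a : Fin n → K) (b : Fin n → D.Carrierᴹ) →
                  φ.fun (D.linComb a b) E.≈ᴹ E.linComb a (φ.fun ∘ b)
    fun-linComb {zero}  a b = φ.0ᴹ-homo
    fun-linComb {suc n} a b = E.≈ᴹ-trans (φ.+ᴹ-homo _ _)
      (E.+ᴹ-cong (φ.*ₗ-homo _ _) (fun-linComb (a ∘ suc) (b ∘ suc)))

    opaque
      push : Subspace D → Subspace E
      push = image {E₁ = D} {E₂ = E} φ.isLinear

      ∈push⁺ : ∀ {V v} → v ∈ V → φ.fun v ∈ push V
      ∈push⁺ p = _ , p , E.≈ᴹ-refl

      ∈push⁻ : ∀ {V w} → w ∈ push V → ∃ λ v → v ∈ V × φ.fun v E.≈ᴹ w
      ∈push⁻ = id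

      push≡image : ∀ V → push V ≡ image {E₁ = D} {E₂ = E} φ.isLinear V
      push≡image V = ≡.refl

    range : Subspace E
    range = push ⊤ˢ

    ∈range : ∀ v → φ.fun v ∈ range
    ∈range v = ∈push⁺ {⊤ˢ} {v} tt

    push⊑ : ∀ {V W} → V ⊑ pull W → push V ⊑ W
    push⊑ {V} {W} p = incl λ q →
      let v , v∈V , eq = ∈push⁻ q in respects W eq (at p v∈V)

    push-mono : ∀ {V W} → V ⊑ W → push V ⊑ push W
    push-mono p = push⊑ (incl λ q → ∈push⁺ (at p q))

    push⊑range : ∀ {V} → push V ⊑ range
    push⊑range = push-mono ⊑⊤

    pull-push : ∀ {V} → pull (push V) ⊑ V
    pull-push {V} = incl λ p → let v , v∈V , eq = ∈push⁻ p in respects V (φ.injective eq) v∈V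

    push-pull : ∀ {W} → W ⊑ range → W ⊑ push (pull W)
    push-pull {W} p = incl λ q →
      let v , _ , eq = ∈push⁻ (at p q)
      in respects (push (pull W)) eq (∈push⁺ (respects W (E.≈ᴹ-sym eq) q))

    d-push : ∀ V → d (push V) ≡ d V
    d-push V = ≡.cong ℤ.+_ (≡.sym (size-unique record
      { size        = B.size
      ; vectors     = φ.fun ∘ B.vectors
      ; vectors∈    = λ i → ∈push⁺ (B.vectors∈ i)
      ; independent = λ a eq → B.independent a (φ.injective
          (E.≈ᴹ-trans (fun-linComb a B.vectors) (E.≈ᴹ-trans eq (E.≈ᴹ-sym φ.0ᴹ-homo))))
      ; spans       = λ w p →
          let v , v∈V , eq = ∈push⁻ p
              a , eq′ = B.spans v v∈V
          in a , E.≈ᴹ-trans (E.≈ᴹ-sym eq) (E.≈ᴹ-trans (φ.⟦⟧-cong eq′) (fun-linComb a B.vectors))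
      }))
      where module B = Basis (basisOf V)

    PreservesRank : QMatroid D → QMatroid E → Set (lsuc ℓ)
    PreservesRank N M = ∀ V → ρ M (push V) ≡ ρ N V

    opaque
      unfolding _⊔_ ρ

      push-⊔ : ∀ {V W} → push (V ⊔ W) ⊑ push V ⊔ push W
      push-⊔ {V} {W} = push⊑ {V ⊔ W} {push V ⊔ push W} (incl λ (x , y , x∈V , y∈W , eq) →
        φ.fun x , φ.fun y , ∈push⁺ x∈V , ∈push⁺ y∈W ,
        E.≈ᴹ-trans (E.≈ᴹ-sym (φ.+ᴹ-homo x y)) (φ.⟦⟧-cong eq))

      pullback : QMatroid E → QMatroid D
      pullback M = record
        { rank       = λ V → ρ M (push V)
        ; 0≤rank     = λ V → 0≤ρ M (push V)
        ; rank≤dim   = λ V → ℤ.≤-trans (ρ≤d M (push V)) (ℤ.≤-reflexive (d-push V))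
        ; monotone   = λ {V} {W} p → ρ-mono M (push-mono {V} {W} (incl p))
        ; submodular = λ V W → ℤ.≤-trans
            (ℤ.+-mono-≤ (ρ-mono M (push-⊔ {V} {W}))
              (ρ-mono M (⊓-greatest {U = push (V ⊓ W)} {push V} {push W}
                (push-mono {V ⊓ W} {V} (⊓-incˡ {V = V} {W})) (push-mono {V ⊓ W} {W} (⊓-incʳ {V = V} {W})))))
            (ρ-submodular M (push V) (push W))
        }

      pullback-preserves : ∀ M → PreservesRank (pullback M) M
      pullback-preserves M V = ≡.refl

  module _ {C D E : FiniteDimensionalSpace F} where
    private
      module E = FiniteDimensionalSpace E

    infixr 9 _∘↪_

    _∘↪_ : D ↪ E → C ↪ D → C ↪ E
    ψ ∘↪ φ = record
      { fun       = fun ψ ∘ fun φ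
      ; isLinear  = linear C E (λ eq → ⟦⟧-cong ψ (⟦⟧-cong φ eq))
          (λ v w → E.≈ᴹ-trans (⟦⟧-cong ψ (+ᴹ-homo φ v w)) (+ᴹ-homo ψ _ _))
          (λ c v → E.≈ᴹ-trans (⟦⟧-cong ψ (*ₗ-homo φ c v)) (*ₗ-homo ψ c _))
      ; injective = λ eq → injective φ (injective ψ eq)
      }

    push-∘ : ∀ (ψ : D ↪ E) (φ : C ↪ D) {V} → push (ψ ∘↪ φ) V ≋ push ψ (push φ V)
    push-∘ ψ φ {V} =
      push⊑ (ψ ∘↪ φ) (incl λ p → ∈push⁺ ψ (∈push⁺ φ p)) ,
      push⊑ ψ (push⊑ φ (incl λ p → ∈push⁺ (ψ ∘↪ φ) p))

    ∘-preserves : ∀ {L : QMatroid C} {N : QMatroid D} {M : QMatroid E} {ψ : D ↪ E} {φ : C ↪ D} →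
      PreservesRank ψ N M → PreservesRank φ L N → PreservesRank (ψ ∘↪ φ) L M
    ∘-preserves {M = M} {ψ} {φ} p q V =
      ≡.trans (ρ-cong M (push-∘ ψ φ)) (≡.trans (p (push φ V)) (q V))

  inclusion : ∀ {E : FiniteDimensionalSpace F} (V : Subspace E) → ⌊ V ⌋ ↪ E
  inclusion {E} V = record
    { fun       = proj₁
    ; isLinear  = linear ⌊ V ⌋ E id (λ _ _ → ≈ᴹ-refl) (λ _ _ → ≈ᴹ-refl)
    ; injective = id
    }
    where open FiniteDimensionalSpace E

  range-inclusion : ∀ {E : FiniteDimensionalSpace F} (V : Subspace E) → range (inclusion V) ≋ V
  range-inclusion {E} V =
    push⊑ (inclusion V) (incl λ {x} _ → proj₂ x) , incl λ p → ∈range (inclusion V) (_ , p)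

  -- P has the rank function of M₁ ⊕ M₂. Comparing q-matroids for equality
  -- would also compare the proofs inside them.
  record IsSum {D₁ D₂ : FiniteDimensionalSpace F} (M₁ : QMatroid D₁) (M₂ : QMatroid D₂)
               (P : QMatroid (D₁ ⊕ˢ D₂)) : Set (lsuc ℓ) where
    constructor isSum
    field
      rank-sum : ∀ V → QMatroid.rank P V ≡ ⊕-rank {E₁ = D₁} {E₂ = D₂} M₁ M₂ V
  open IsSum public

  -- Explicit parameters, since D₁ and D₂ cannot be inferred from D₁ ⊕ˢ D₂.
  module DirectSum (D₁ D₂ : FiniteDimensionalSpace F) where
    private
      module D₁ = FiniteDimensionalSpace D₁
      module D₂ = FiniteDimensionalSpace D₂

    ι₁ : D₁ ↪ D₁ ⊕ˢ D₂
    ι₁ = record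
      { fun       = λ x → x , D₂.0ᴹ
      ; isLinear  = linear D₁ (D₁ ⊕ˢ D₂) (λ eq → eq , D₂.≈ᴹ-refl)
          (λ _ _ → D₁.≈ᴹ-refl , D₂.≈ᴹ-sym (D₂.+ᴹ-identityˡ D₂.0ᴹ))
          (λ c _ → D₁.≈ᴹ-refl , D₂.≈ᴹ-sym (D₂.*ₗ-zeroʳ c))
      ; injective = proj₁
      }

    ι₂ : D₂ ↪ D₁ ⊕ˢ D₂
    ι₂ = record
      { fun       = λ y → D₁.0ᴹ , y
      ; isLinear  = linear D₂ (D₁ ⊕ˢ D₂) (λ eq → D₁.≈ᴹ-refl , eq)
          (λ _ _ → D₁.≈ᴹ-sym (D₁.+ᴹ-identityˡ D₁.0ᴹ) , D₂.≈ᴹ-refl)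
          (λ c _ → D₁.≈ᴹ-sym (D₁.*ₗ-zeroʳ c) , D₂.≈ᴹ-refl)
      ; injective = proj₂
      }

    opaque
      π₁ : Subspace (D₁ ⊕ˢ D₂) → Subspace D₁
      π₁ = image {E₁ = D₁ ⊕ˢ D₂} {E₂ = D₁} (proj₁-linear D₁ D₂)

      π₂ : Subspace (D₁ ⊕ˢ D₂) → Subspace D₂
      π₂ = image {E₁ = D₁ ⊕ˢ D₂} {E₂ = D₂} (proj₂-linear D₁ D₂)

      ∈π₁⁺ : ∀ {X x y} → (x , y) ∈ X → x ∈ π₁ X
      ∈π₁⁺ p = _ , p , D₁.≈ᴹ-refl

      ∈π₂⁺ : ∀ {X x y} → (x , y) ∈ X → y ∈ π₂ X
      ∈π₂⁺ p = _ , p , D₂.≈ᴹ-refl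

      π₁⊑ : ∀ {X V} → (∀ {x y} → (x , y) ∈ X → x ∈ V) → π₁ X ⊑ V
      π₁⊑ {X} {V} f = incl λ (_ , p , eq) → Subspace.respects V eq (f p)

      π₂⊑ : ∀ {X V} → (∀ {x y} → (x , y) ∈ X → y ∈ V) → π₂ X ⊑ V
      π₂⊑ {X} {V} f = incl λ (_ , p , eq) → Subspace.respects V eq (f p)

    module _ {P : QMatroid (D₁ ⊕ˢ D₂)} {M₁ : QMatroid D₁} {M₂ : QMatroid D₂} (sum : IsSum M₁ M₂ P) where

      opaque
        unfolding π₁ ρ

        -- Together with `⊕-rank-attained` this replaces the minimum in the rank of a direct sum,
        -- without subtraction and without reference to the chosen minimiser.
        ⊕-rank≤ : ∀ {X V} → X ⊑ V → ρ P V + d X ≤ d V + (ρ M₁ (π₁ X) + ρ M₂ (π₂ X))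
        ⊕-rank≤ {X} {V} p rewrite rank-sum sum V with ⊕-minimiser {E₁ = D₁} {E₂ = D₂} M₁ M₂ V
        ... | Y , _ , least = ≤-shift (d V + e + d X) (d V + (ρ M₁ (π₁ X) + ρ M₂ (π₂ X)))
          (least X (at p)) (ring (d V) e (d X) (ρ M₁ (π₁ X) + ρ M₂ (π₂ X)))
          where
          e : ℤ
          e = ⊕-excess {E₁ = D₁} {E₂ = D₂} M₁ M₂ Y
          ring : ∀ v e x r → v + e + x + (r - x) ≡ v + r + e
          ring = solve-∀

        ⊕-rank-attained : ∀ V → ∃ λ X → X ⊑ V × d V + (ρ M₁ (π₁ X) + ρ M₂ (π₂ X)) ≤ ρ P V + d X
        ⊕-rank-attained V rewrite rank-sum sum V with ⊕-minimiser {E₁ = D₁} {E₂ = D₂} M₁ M₂ V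
        ... | X , X⊆V , _ = X , incl X⊆V ,
          ℤ.≤-reflexive (ring (d V) (ρ M₁ (π₁ X) + ρ M₂ (π₂ X)) (d X))
          where
          ring : ∀ v r x → v + r ≡ v + (r - x) + x
          ring = solve-∀

-- Splittings and direct sums

module _ {ℓ} {F : FiniteField ℓ} where
  open _↪_
  open Subspace

  module SumProperties {D₁ D₂ : FiniteDimensionalSpace F} {P : QMatroid (D₁ ⊕ˢ D₂)}
    {M₁ : QMatroid D₁} {M₂ : QMatroid D₂} (sum : IsSum M₁ M₂ P) where
    private
      module D₁ = FiniteDimensionalSpace D₁
      module D₂ = FiniteDimensionalSpace D₂
    open DirectSum D₁ D₂

    -- The bound at `X = V′` gives one inequality. For the other, a minimiser lies in the image of
    -- its first projection, which is a subspace of `V`, and `nullity-mono` shows that it does no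
    -- better than `V` itself.
    ι₁-preserves : PreservesRank ι₁ M₁ P
    ι₁-preserves V = ℤ.≤-antisym
      (≤-shift (ρ P V′) (ρ M₁ V)
        (ℤ.+-mono-≤ (⊕-rank≤ sum {V′} {V′} ⊑-refl)
          (ℤ.+-mono-≤ (ρ-mono M₁ (π₁⊑ {X = V′} {V} in₁))
            (ℤ.≤-trans (ρ-mono M₂ π₂⊑0) (ℤ.≤-reflexive (ρ-0ˢ M₂)))))
        (ring₁ (ρ P V′) (d V′) (ρ M₁ (π₁ V′)) (ρ M₂ (π₂ V′)) (ρ M₁ V)))
      lower-bound
      where
      V′ = push ι₁ V
      in₁ : ∀ {x y} → (x , y) ∈ V′ → x ∈ V
      in₁ p = let _ , v∈V , eq , _ = ∈push⁻ ι₁ p in respects V eq v∈V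
      in₂ : ∀ {x y} → (x , y) ∈ V′ → y D₂.≈ᴹ D₂.0ᴹ
      in₂ p = let _ , _ , _ , eq = ∈push⁻ ι₁ p in D₂.≈ᴹ-sym eq
      π₂⊑0 : π₂ V′ ⊑ 0ˢ
      π₂⊑0 = π₂⊑ {X = V′} {0ˢ} in₂
      ring₁ : ∀ r v a b c → r + (v + (a + b) + (c + 0ℤ)) ≡ c + (r + v + (a + b))
      ring₁ = solve-∀
      ring₂ : ∀ w r a b x v v′ y → w + (r + x + (b + (y + (a + v + v′)))) ≡
                                   r + (v′ + (a + b) + (0ℤ + (x + (w + y + v))))
      ring₂ = solve-∀
      lower-bound : ρ M₁ V ≤ ρ P V′
      lower-bound with ⊕-rank-attained sum V′
      ... | X , X⊑V′ , attained = ≤-shift (ρ M₁ V) (ρ P V′)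
        (ℤ.+-mono-≤ attained
        (ℤ.+-mono-≤ (0≤ρ M₂ (π₂ X))
        (ℤ.+-mono-≤ (ℤ.≤-trans (d-mono X⊑) (ℤ.≤-reflexive (d-push ι₁ (π₁ X))))
        (ℤ.+-mono-≤ (nullity-mono M₁ (π₁⊑ {X = X} {V} (λ p → in₁ (at X⊑V′ p))))
          (ℤ.≤-reflexive (≡.sym (d-push ι₁ V)))))))
        (ring₂ (ρ M₁ V) (ρ P V′) (ρ M₁ (π₁ X)) (ρ M₂ (π₂ X)) (d X) (d V) (d V′) (d (π₁ X)))
        where
        X⊑ : X ⊑ push ι₁ (π₁ X)
        X⊑ = incl λ {u} p → respects (push ι₁ (π₁ X)) (D₁.≈ᴹ-refl , D₂.≈ᴹ-sym (in₂ (at X⊑V′ p)))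
          (∈push⁺ ι₁ (∈π₁⁺ {X = X} p))

    ι₂-preserves : PreservesRank ι₂ M₂ P
    ι₂-preserves V = ℤ.≤-antisym
      (≤-shift (ρ P V′) (ρ M₂ V)
        (ℤ.+-mono-≤ (⊕-rank≤ sum {V′} {V′} ⊑-refl)
          (ℤ.+-mono-≤ (ρ-mono M₂ (π₂⊑ {X = V′} {V} in₂))
            (ℤ.≤-trans (ρ-mono M₁ π₁⊑0) (ℤ.≤-reflexive (ρ-0ˢ M₁)))))
        (ring₁ (ρ P V′) (d V′) (ρ M₁ (π₁ V′)) (ρ M₂ (π₂ V′)) (ρ M₂ V)))
      lower-bound
      where
      V′ = push ι₂ V
      in₁ : ∀ {x y} → (x , y) ∈ V′ → x D₁.≈ᴹ D₁.0ᴹ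
      in₁ p = let _ , _ , eq , _ = ∈push⁻ ι₂ p in D₁.≈ᴹ-sym eq
      in₂ : ∀ {x y} → (x , y) ∈ V′ → y ∈ V
      in₂ p = let _ , v∈V , _ , eq = ∈push⁻ ι₂ p in respects V eq v∈V
      π₁⊑0 : π₁ V′ ⊑ 0ˢ
      π₁⊑0 = π₁⊑ {X = V′} {0ˢ} in₁
      ring₁ : ∀ r v a b c → r + (v + (a + b) + (c + 0ℤ)) ≡ c + (r + v + (b + a))
      ring₁ = solve-∀
      ring₂ : ∀ w r a b x v v′ y → w + (r + x + (a + (y + (b + v + v′)))) ≡
                                   r + (v′ + (a + b) + (0ℤ + (x + (w + y + v))))
      ring₂ = solve-∀
      lower-bound : ρ M₂ V ≤ ρ P V′
      lower-bound with ⊕-rank-attained sum V′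
      ... | X , X⊑V′ , attained = ≤-shift (ρ M₂ V) (ρ P V′)
        (ℤ.+-mono-≤ attained
        (ℤ.+-mono-≤ (0≤ρ M₁ (π₁ X))
        (ℤ.+-mono-≤ (ℤ.≤-trans (d-mono X⊑) (ℤ.≤-reflexive (d-push ι₂ (π₂ X))))
        (ℤ.+-mono-≤ (nullity-mono M₂ (π₂⊑ {X = X} {V} (λ p → in₂ (at X⊑V′ p))))
          (ℤ.≤-reflexive (≡.sym (d-push ι₂ V)))))))
        (ring₂ (ρ M₂ V) (ρ P V′) (ρ M₁ (π₁ X)) (ρ M₂ (π₂ X)) (d X) (d V) (d V′) (d (π₂ X)))
        where
        X⊑ : X ⊑ push ι₂ (π₂ X)
        X⊑ = incl λ {u} p → respects (push ι₂ (π₂ X)) (D₁.≈ᴹ-sym (in₁ (at X⊑V′ p)) , D₂.≈ᴹ-refl)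
          (∈push⁺ ι₂ (∈π₂⁺ {X = X} p))

    module _ {E : FiniteDimensionalSpace F} (M : QMatroid E) where
      private module E = FiniteDimensionalSpace E

      -- The image of a minimiser `X` for a cyclic `V` has full nullity in `V`, hence fills it, and
      -- the minimum attained there is the sum of the ranks of the two projections.
      range-splits : (φ : D₁ ⊕ˢ D₂ ↪ E) → PreservesRank φ P M →
                     Splits M (range φ) (range (φ ∘↪ ι₁)) (range (φ ∘↪ ι₂))
      range-splits φ pres = record
        { left     = push⊑ (φ ∘↪ ι₁) (incl λ {x} _ → ∈range φ (x , D₂.0ᴹ))
        ; right    = push⊑ (φ ∘↪ ι₂) (incl λ {y} _ → ∈range φ (D₁.0ᴹ , y))
        ; cover    = push⊑ φ (incl λ {(x , y)} _ → respects (A ⊔ B) (φ-split x y)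
            (∈⊔⁺ (∈range (φ ∘↪ ι₁) x) (∈range (φ ∘↪ ι₂) y)))
        ; disjoint = incl λ p →
            let x , _ , eq₁ = ∈push⁻ (φ ∘↪ ι₁) (at ⊓-incˡ p)
                y , _ , eq₂ = ∈push⁻ (φ ∘↪ ι₂) (at ⊓-incʳ p)
                x≈0 , _ = injective φ (E.≈ᴹ-trans eq₁ (E.≈ᴹ-sym eq₂))
            in E.≈ᴹ-trans (E.≈ᴹ-sym eq₁) (E.≈ᴹ-trans (⟦⟧-cong φ (x≈0 , D₂.≈ᴹ-refl)) (0ᴹ-homo φ))
        ; additive = additive
        }
        where
        A B : Subspace E
        A = range (φ ∘↪ ι₁)
        B = range (φ ∘↪ ι₂)
        φ-split : ∀ x y → fun φ (x , D₂.0ᴹ) E.+ᴹ fun φ (D₁.0ᴹ , y) E.≈ᴹ fun φ (x , y)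
        φ-split x y = E.≈ᴹ-trans (E.≈ᴹ-sym (+ᴹ-homo φ _ _))
          (⟦⟧-cong φ (D₁.+ᴹ-identityʳ x , D₂.+ᴹ-identityˡ y))
        pr₁ : ∀ X → pr M A B (push φ X) ⊑ push (φ ∘↪ ι₁) (π₁ X)
        pr₁ X = incl λ p →
          let a∈A , b , b∈B , a+b∈ = ∈pr⁻ M p
              x , _ , eq₁ = ∈push⁻ (φ ∘↪ ι₁) a∈A
              y , _ , eq₂ = ∈push⁻ (φ ∘↪ ι₂) b∈B
              _ , u∈X , eq = ∈push⁻ φ a+b∈
              xy∈X = respects X (injective φ (E.≈ᴹ-trans eq (E.≈ᴹ-trans
                (E.+ᴹ-cong (E.≈ᴹ-sym eq₁) (E.≈ᴹ-sym eq₂)) (φ-split x y)))) u∈X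
          in respects (push (φ ∘↪ ι₁) (π₁ X)) eq₁ (∈push⁺ (φ ∘↪ ι₁) (∈π₁⁺ {X = X} xy∈X))
        pr₂ : ∀ X → pr M B A (push φ X) ⊑ push (φ ∘↪ ι₂) (π₂ X)
        pr₂ X = incl λ p →
          let b∈B , a , a∈A , b+a∈ = ∈pr⁻ M p
              x , _ , eq₁ = ∈push⁻ (φ ∘↪ ι₁) a∈A
              y , _ , eq₂ = ∈push⁻ (φ ∘↪ ι₂) b∈B
              _ , u∈X , eq = ∈push⁻ φ b+a∈
              xy∈X = respects X (injective φ (E.≈ᴹ-trans eq (E.≈ᴹ-trans (E.+ᴹ-comm _ _) (E.≈ᴹ-trans
                (E.+ᴹ-cong (E.≈ᴹ-sym eq₁) (E.≈ᴹ-sym eq₂)) (φ-split x y))))) u∈X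
          in respects (push (φ ∘↪ ι₂) (π₂ X)) eq₂ (∈push⁺ (φ ∘↪ ι₂) (∈π₂⁺ {X = X} xy∈X))
        rank₁ : ∀ W → ρ M (push (φ ∘↪ ι₁) W) ≡ ρ M₁ W
        rank₁ = ∘-preserves {M = M} {φ} {ι₁} pres ι₁-preserves
        rank₂ : ∀ W → ρ M (push (φ ∘↪ ι₂) W) ≡ ρ M₂ W
        rank₂ = ∘-preserves {M = M} {φ} {ι₂} pres ι₂-preserves
        additive : ∀ V → V ⊑ range φ → Cyclic M V → ρ M (pr M A B V) + ρ M (pr M B A V) ≤ ρ M V
        additive V V⊑ cyc with ⊕-rank-attained sum (pull φ V)
        ... | X , X⊑ , attained = ≤-shift (ρ M (pr M A B V) + ρ M (pr M B A V)) (ρ M V)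
          (ℤ.+-mono-≤ attained′ (ℤ.+-mono-≤ (d-mono X⊑)
            (ℤ.+-mono-≤ (ℤ.≤-trans (ρ-mono M (⊑-trans (pr-mono M ⊑-refl ⊑-refl V⊑φX) (pr₁ X)))
                          (ℤ.≤-reflexive (rank₁ (π₁ X))))
                        (ℤ.≤-trans (ρ-mono M (⊑-trans (pr-mono M ⊑-refl ⊑-refl V⊑φX) (pr₂ X)))
                          (ℤ.≤-reflexive (rank₂ (π₂ X)))))))
          (ring′ (ρ M V) (ρ M (pr M A B V)) (ρ M (pr M B A V)) (ρ M₁ (π₁ X)) (ρ M₂ (π₂ X)) (d (pull φ V)) (d X))
          where
          ring′ : ∀ r p q a b v x → p + q + (r + x + (v + (a + b))) ≡ r + (v + (a + b) + (x + (p + q)))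
          ring′ = solve-∀
          φpull : push φ (pull φ V) ≋ V
          φpull = push⊑ φ ⊑-refl , push-pull φ V⊑
          attained′ : d (pull φ V) + (ρ M₁ (π₁ X) + ρ M₂ (π₂ X)) ≤ ρ M V + d X
          attained′ = ≡.subst (λ r → d (pull φ V) + (ρ M₁ (π₁ X) + ρ M₂ (π₂ X)) ≤ r + d X)
            (≡.trans (≡.sym (pres (pull φ V))) (ρ-cong M φpull)) attained
          φX⊑ : push φ X ⊑ push (φ ∘↪ ι₁) (π₁ X) ⊔ push (φ ∘↪ ι₂) (π₂ X)
          φX⊑ = push⊑ φ (incl λ {(x , y)} p →
            respects (push (φ ∘↪ ι₁) (π₁ X) ⊔ push (φ ∘↪ ι₂) (π₂ X)) (φ-split x y)
              (∈⊔⁺ (∈push⁺ (φ ∘↪ ι₁) (∈π₁⁺ {X = X} p)) (∈push⁺ (φ ∘↪ ι₂) (∈π₂⁺ {X = X} p))))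
          V⊑φX : V ⊑ push φ X
          V⊑φX = cyc (push φ X) (push⊑ φ X⊑) (≤-shift (ρ M (push φ X) + d V) (ρ M V + d (push φ X))
            (ℤ.+-mono-≤ attained′
            (ℤ.+-mono-≤ (ℤ.≤-trans (ρ-mono M φX⊑) (ℤ.≤-trans (ρ-⊔≤ M _ _)
              (ℤ.≤-reflexive (≡.cong₂ _+_ (rank₁ (π₁ X)) (rank₂ (π₂ X))))))
            (ℤ.+-mono-≤ (ℤ.≤-trans (d-mono (proj₂ φpull)) (ℤ.≤-reflexive (d-push φ (pull φ V))))
              (ℤ.≤-reflexive (≡.sym (d-push φ X))))))
            (ring″ (ρ M (push φ X)) (ρ M V) (ρ M₁ (π₁ X)) (ρ M₂ (π₂ X)) (d V) (d (pull φ V)) (d X) (d (push φ X))))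
            where
            ring″ : ∀ s r a b v p x y →
              s + v + (r + x + (a + b + (p + y))) ≡ r + y + (p + (a + b) + (s + (v + x)))
            ring″ = solve-∀

  module _ {D₁ D₂ E : FiniteDimensionalSpace F} where
    private
      module D₁ = FiniteDimensionalSpace D₁
      module D₂ = FiniteDimensionalSpace D₂
      module E = FiniteDimensionalSpace E
      module +ᴹ = CommutativeSemigroupProperties
        (CommutativeMonoid.commutativeSemigroup E.+ᴹ-commutativeMonoid)
    open DirectSum D₁ D₂

    join : (φ₁ : D₁ ↪ E) (φ₂ : D₂ ↪ E) → range φ₁ ⊓ range φ₂ ⊑ 0ˢ → D₁ ⊕ˢ D₂ ↪ E
    join φ₁ φ₂ dis = record
      { fun       = λ (x , y) → fun φ₁ x E.+ᴹ fun φ₂ y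
      ; isLinear  = linear (D₁ ⊕ˢ D₂) E
          (λ (eq₁ , eq₂) → E.+ᴹ-cong (⟦⟧-cong φ₁ eq₁) (⟦⟧-cong φ₂ eq₂))
          (λ (x , y) (x′ , y′) → E.≈ᴹ-trans (E.+ᴹ-cong (+ᴹ-homo φ₁ x x′) (+ᴹ-homo φ₂ y y′))
            (+ᴹ.interchange _ _ _ _))
          (λ c (x , y) → E.≈ᴹ-trans (E.+ᴹ-cong (*ₗ-homo φ₁ c x) (*ₗ-homo φ₂ c y))
            (E.≈ᴹ-sym (E.*ₗ-distribˡ c _ _)))
      ; injective = λ {(x , y)} {(x′ , y′)} eq →
          injective φ₁ (components-unique dis (∈range φ₁ x) (∈range φ₂ y) (∈range φ₁ x′) (∈range φ₂ y′) eq) ,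
          injective φ₂ (components-unique (⊑-trans ⊓-swap dis)
            (∈range φ₂ y) (∈range φ₁ x) (∈range φ₂ y′) (∈range φ₁ x′)
            (E.≈ᴹ-trans (E.+ᴹ-comm _ _) (E.≈ᴹ-trans eq (E.+ᴹ-comm _ _))))
      }

    module _ {M : QMatroid E} {U} {φ₁ : D₁ ↪ E} {φ₂ : D₂ ↪ E}
             (s : Splits M U (range φ₁) (range φ₂)) where
      private
        open Splits s
        j : D₁ ⊕ˢ D₂ ↪ E
        j = join φ₁ φ₂ disjoint

      range-join : range j ≋ U
      range-join = push⊑ j (incl λ {(x , y)} _ → +-closed U (at left (∈range φ₁ x)) (at right (∈range φ₂ y))) ,
        incl λ u∈U →
          let _ , _ , p , q , eq = ∈⊔⁻ (at cover u∈U)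
              x , _ , eq₁ = ∈push⁻ φ₁ p
              y , _ , eq₂ = ∈push⁻ φ₂ q
          in respects (range j) (E.≈ᴹ-trans (E.+ᴹ-cong eq₁ eq₂) eq) (∈range j (x , y))

    module _ {P : QMatroid (D₁ ⊕ˢ D₂)} {M₁ : QMatroid D₁} {M₂ : QMatroid D₂} (sum : IsSum M₁ M₂ P)
             {M : QMatroid E} {U} {φ₁ : D₁ ↪ E} {φ₂ : D₂ ↪ E}
             (pres₁ : PreservesRank φ₁ M₁ M) (pres₂ : PreservesRank φ₂ M₂ M)
             (s : Splits M U (range φ₁) (range φ₂)) where
      private
        open Splits s
        j : D₁ ⊕ˢ D₂ ↪ E
        j = join φ₁ φ₂ disjoint

      -- The converse of `range-splits`. A minimiser bounds the rank of the image from above,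
      -- through `nullity-mono`. From below, the rank formula is tested on the preimage of the
      -- cyclic core of the image, where additivity is available.
      join-preserves : PreservesRank j P M
      join-preserves V = ℤ.≤-antisym upper lower′
        where
        ρ⊕ = ρ P V
        jV = push j V
        upper : ρ M jV ≤ ρ⊕
        upper with ⊕-rank-attained sum V
        ... | X , X⊑V , attained = ≤-shift (ρ M jV) ρ⊕
          (ℤ.+-mono-≤ attained
          (ℤ.+-mono-≤ (nullity-mono M (push-mono j X⊑V))
          (ℤ.+-mono-≤ (ℤ.≤-trans (ρ-mono M jX⊑) (ℤ.≤-trans (ρ-⊔≤ M _ _)
            (ℤ.≤-reflexive (≡.cong₂ _+_ (pres₁ (π₁ X)) (pres₂ (π₂ X))))))
          (ℤ.+-mono-≤ (ℤ.≤-reflexive (d-push j V)) (ℤ.≤-reflexive (≡.sym (d-push j X)))))))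
          (ring (ρ M jV) ρ⊕ (ρ M (push j X)) (ρ M₁ (π₁ X)) (ρ M₂ (π₂ X)) (d V) (d X) (d jV) (d (push j X)))
          where
          ring : ∀ r o s a b v x w y →
            r + (o + x + (s + w + (a + b + (v + y)))) ≡ o + (v + (a + b) + (r + y + (s + (w + x))))
          ring = solve-∀
          jX⊑ : push j X ⊑ push φ₁ (π₁ X) ⊔ push φ₂ (π₂ X)
          jX⊑ = push⊑ j (incl λ p →
            ∈⊔⁺ (∈push⁺ φ₁ (∈π₁⁺ {X = X} p)) (∈push⁺ φ₂ (∈π₂⁺ {X = X} p)))
        lower′ : ρ⊕ ≤ ρ M jV
        lower′ with cyclicCore M jV
        ... | C , C⊑jV , cyc , full = ≤-shift ρ⊕ (ρ M jV)
          (ℤ.+-mono-≤ (⊕-rank≤ sum X⊑V)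
          (ℤ.+-mono-≤ full
          (ℤ.+-mono-≤ (additive C (⊑-trans C⊑jV (⊑-trans (push⊑range j) (proj₁ (range-join s)))) cyc)
          (ℤ.+-mono-≤ (ℤ.≤-trans (ℤ.≤-reflexive (≡.sym (pres₁ (π₁ X)))) (ρ-mono M pr₁))
          (ℤ.+-mono-≤ (ℤ.≤-trans (ℤ.≤-reflexive (≡.sym (pres₂ (π₂ X)))) (ρ-mono M pr₂))
          (ℤ.+-mono-≤ (ℤ.≤-reflexive (≡.sym (d-push j V)))
            (ℤ.≤-trans (d-mono (push-pull j (⊑-trans C⊑jV (push⊑range j)))) (ℤ.≤-reflexive (d-push j X)))))))))
          (ring (ρ M jV) ρ⊕ (ρ M C) (ρ M (pr M A B C)) (ρ M (pr M B A C)) (ρ M₁ (π₁ X)) (ρ M₂ (π₂ X))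
                (d V) (d X) (d jV) (d C))
          where
          A B : Subspace E
          A = range φ₁
          B = range φ₂
          X : Subspace (D₁ ⊕ˢ D₂)
          X = pull j C
          X⊑V : X ⊑ V
          X⊑V = ⊑-trans (incl λ p → at C⊑jV p) (pull-push j)
          pr₁ : push φ₁ (π₁ X) ⊑ pr M A B C
          pr₁ = push⊑ φ₁ (π₁⊑ {X = X} {pull φ₁ (pr M A B C)} λ {x} {y} p →
            ∈pr⁺ M (∈range φ₁ x) (∈range φ₂ y) p)
          pr₂ : push φ₂ (π₂ X) ⊑ pr M B A C
          pr₂ = push⊑ φ₂ (π₂⊑ {X = X} {pull φ₂ (pr M B A C)} λ {x} {y} p →
            ∈pr⁺ M (∈range φ₂ y) (∈range φ₁ x) (respects C (E.+ᴹ-comm _ _) p))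
          ring : ∀ r o c p q a b v x w k →
            o + (v + (a + b) + (r + k + (c + (p + (q + (w + x)))))) ≡
            r + (o + x + (c + w + (p + q + (a + (b + (v + k))))))
          ring = solve-∀

-- Equivalence and reducibility

module _ {ℓ} {F : FiniteField ℓ} where
  open _↪_
  open Subspace
  open Splits
  open FiniteDimensionalSpace using (Carrierᴹ)

  module _ {E₁ E₂ : FiniteDimensionalSpace F} {M₁ : QMatroid E₁} {M₂ : QMatroid E₂} where
    private
      module E₁ = FiniteDimensionalSpace E₁
      module E₂ = FiniteDimensionalSpace E₂

    module _ {α : E₁.Carrierᴹ → E₂.Carrierᴹ} (eq : IsEquivalence {E₁ = E₁} {E₂ = E₂} M₁ M₂ α) where
      open IsEquivalence eq

      embedding : E₁ ↪ E₂
      embedding = record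
        { fun       = α
        ; isLinear  = linearity
        ; injective = LeftModuleMorphisms.IsLeftModuleIsomorphism.injective isomorphism
        }

      embedding-surjective : ⊤ˢ ⊑ range embedding
      embedding-surjective = incl λ {y} _ →
        let x , h = LeftModuleMorphisms.IsLeftModuleIsomorphism.surjective isomorphism y
        in respects (range embedding) (h E₁.≈ᴹ-refl) (∈range embedding x)

      embedding-preserves : PreservesRank embedding M₁ M₂
      embedding-preserves V = ≡.trans (ρ≡rank M₂ (push embedding V))
        (≡.trans (≡.cong (QMatroid.rank M₂) (push≡image embedding V))
        (≡.trans (rank-preserving V) (≡.sym (ρ≡rank M₁ V))))

    isEquivalence : (φ : E₁ ↪ E₂) → PreservesRank φ M₁ M₂ → ⊤ˢ ⊑ range φ →
                    IsEquivalence {E₁ = E₁} {E₂ = E₂} M₁ M₂ (fun φ)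
    isEquivalence φ pres surj = record
      { isomorphism = record
        { isLeftModuleMonomorphism = record
          { isLeftModuleHomomorphism = isLinear φ ; injective = injective φ }
        ; surjective = λ y →
            let x , _ , eq = ∈push⁻ φ (at surj {y} tt)
            in x , λ z≈x → E₂.≈ᴹ-trans (⟦⟧-cong φ z≈x) eq
        }
      ; rank-preserving = λ V → ≡.trans (≡.cong (QMatroid.rank M₂) (≡.sym (push≡image φ V)))
          (≡.trans (≡.sym (ρ≡rank M₂ (push φ V))) (≡.trans (pres V) (ρ≡rank M₁ V)))
      }

  module _ {C D E : FiniteDimensionalSpace F} (φ : D ↪ E) (j : C ↪ E)
           (h : Carrierᴹ C → Carrierᴹ D)
           (φh≈j : ∀ x → FiniteDimensionalSpace._≈ᴹ_ E (fun φ (h x)) (fun j x)) where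
    private
      module C = FiniteDimensionalSpace C
      module D = FiniteDimensionalSpace D
      module E = FiniteDimensionalSpace E

    -- Linearity and injectivity of `h` are read off after applying the injective `φ`. The
    -- underlying function stays exactly `h`, as needed for the maps prescribed in `Reducible` and
    -- `IsInternalDirectSum`.
    factor : C ↪ D
    factor = record
      { fun       = h
      ; isLinear  = linear C D
          (λ eq → injective φ (E.≈ᴹ-trans (φh≈j _) (E.≈ᴹ-trans (⟦⟧-cong j eq) (E.≈ᴹ-sym (φh≈j _)))))
          (λ v w → injective φ (E.≈ᴹ-trans (φh≈j _) (E.≈ᴹ-trans (+ᴹ-homo j v w)
            (E.≈ᴹ-trans (E.+ᴹ-cong (E.≈ᴹ-sym (φh≈j v)) (E.≈ᴹ-sym (φh≈j w))) (E.≈ᴹ-sym (+ᴹ-homo φ _ _))))))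
          (λ c v → injective φ (E.≈ᴹ-trans (φh≈j _) (E.≈ᴹ-trans (*ₗ-homo j c v)
            (E.≈ᴹ-trans (E.*ₗ-congˡ (E.≈ᴹ-sym (φh≈j v))) (E.≈ᴹ-sym (*ₗ-homo φ c _))))))
      ; injective = λ eq → injective j
          (E.≈ᴹ-trans (E.≈ᴹ-sym (φh≈j _)) (E.≈ᴹ-trans (⟦⟧-cong φ eq) (φh≈j _)))
      }

    push-factor : ∀ {V} → push φ (push factor V) ≋ push j V
    push-factor {V} =
      push⊑ φ (push⊑ factor (incl λ {v} p → respects (push j V) (E.≈ᴹ-sym (φh≈j v)) (∈push⁺ j p))) ,
      push⊑ j (incl λ {v} p →
        respects (push φ (push factor V)) (φh≈j v) (∈push⁺ φ (∈push⁺ factor p)))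

    factor-preserves : ∀ {L : QMatroid C} {N : QMatroid D} {M : QMatroid E} →
      PreservesRank φ N M → PreservesRank j L M → PreservesRank factor L N
    factor-preserves {M = M} presφ presj V =
      ≡.trans (≡.sym (presφ (push factor V))) (≡.trans (ρ-cong M push-factor) (presj V))

    factor-surjective : range φ ⊑ range j → ⊤ˢ ⊑ range factor
    factor-surjective p = incl λ {y} _ →
      let x , _ , eq = ∈push⁻ j (at p (∈range φ y))
      in respects (range factor) (injective φ (E.≈ᴹ-trans (φh≈j x) eq)) (∈range factor x)

  -- Projecting along a common complement B identifies the ranges of φ and φ′.
  module _ {D D′ E : FiniteDimensionalSpace F} {N : QMatroid D} {N′ : QMatroid D′} {M : QMatroid E}
           {φ : D ↪ E} {φ′ : D′ ↪ E} (pres : PreservesRank φ N M) (pres′ : PreservesRank φ′ N′ M)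
           {U B} (s : Splits M U (range φ) B) (s′ : Splits M U (range φ′) B) where
    private
      module D = FiniteDimensionalSpace D
      module D′ = FiniteDimensionalSpace D′
      module E = FiniteDimensionalSpace E
      module +ᴹ = CommutativeSemigroupProperties
        (CommutativeMonoid.commutativeSemigroup E.+ᴹ-commutativeMonoid)

      project : ∀ x → ∃₂ λ x′ b → b ∈ B × fun φ′ x′ E.+ᴹ b E.≈ᴹ fun φ x
      project x =
        let _ , b , p , b∈B , eq = ∈⊔⁻ (at (⊑-trans (left s) (cover s′)) (∈range φ x))
            x′ , _ , eq′ = ∈push⁻ φ′ p
        in x′ , b , b∈B , E.≈ᴹ-trans (E.+ᴹ-congʳ eq′) eq

      χ : D.Carrierᴹ → D′.Carrierᴹ
      χ x = proj₁ (project x)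

      -- `χ` comes from a choice of components; their uniqueness is what makes it respect equality,
      -- addition and scalars.
      χ-unique : ∀ {x y′ c} → c ∈ B → fun φ x E.≈ᴹ fun φ′ y′ E.+ᴹ c → χ x D′.≈ᴹ y′
      χ-unique {x} {y′} c∈B eq = let x′ , b , b∈B , eq′ = project x in injective φ′
        (components-unique (disjoint s′) (∈range φ′ x′) b∈B (∈range φ′ y′) c∈B (E.≈ᴹ-trans eq′ eq))

      χ-spec : ∀ x → ∃ λ b → b ∈ B × fun φ′ (χ x) E.+ᴹ b E.≈ᴹ fun φ x
      χ-spec x = proj₂ (project x)

      projection : D ↪ D′
      projection = record
        { fun       = χ
        ; isLinear  = linear D D′
            (λ {v} {w} v≈w → let _ , b∈B , eq = χ-spec w in
              χ-unique b∈B (E.≈ᴹ-trans (⟦⟧-cong φ v≈w) (E.≈ᴹ-sym eq)))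
            (λ v w → let _ , b∈B , eq = χ-spec v ; _ , c∈B , eq′ = χ-spec w in
              χ-unique (+-closed B b∈B c∈B) (E.≈ᴹ-trans (+ᴹ-homo φ v w)
                (E.≈ᴹ-trans (E.+ᴹ-cong (E.≈ᴹ-sym eq) (E.≈ᴹ-sym eq′))
                (E.≈ᴹ-trans (+ᴹ.interchange _ _ _ _) (E.+ᴹ-congʳ (E.≈ᴹ-sym (+ᴹ-homo φ′ _ _)))))))
            (λ c v → let _ , b∈B , eq = χ-spec v in
              χ-unique (*ₗ-closed B c b∈B) (E.≈ᴹ-trans (*ₗ-homo φ c v)
                (E.≈ᴹ-trans (E.*ₗ-congˡ (E.≈ᴹ-sym eq))
                (E.≈ᴹ-trans (E.*ₗ-distribˡ c _ _) (E.+ᴹ-congʳ (E.≈ᴹ-sym (*ₗ-homo φ′ c _)))))))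
        ; injective = λ {v} {w} χv≈χw →
            let b , b∈B , eq = χ-spec v
                c , c∈B , eq′ = χ-spec w
            in injective φ (components-unique (disjoint s) (∈range φ v) c∈B (∈range φ w) b∈B
                 (E.≈ᴹ-trans (E.+ᴹ-congʳ (E.≈ᴹ-sym eq)) (E.≈ᴹ-trans (+ᴹ.xy∙z≈xz∙y _ b c)
                   (E.+ᴹ-congʳ (E.≈ᴹ-trans (E.+ᴹ-congʳ (⟦⟧-cong φ′ χv≈χw)) eq′)))))
        }

      -- The image of `V` under `φ` and the projected image differ by vectors of `B`, so
      -- `splits-shift` applies in both directions.
      projection-preserves : PreservesRank projection N N′
      projection-preserves V = ≡.trans (≡.sym (pres′ (push projection V))) (≡.trans (ℤ.≤-antisym
        (splits-shift M s′ (push⊑range φ′) (push⊑ φ′ (push⊑ projection (incl λ {v} v∈V →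
          let _ , b∈B , eq = χ-spec v
          in ∈-cancelʳ (push φ V ⊔ B) (at ⊔-incʳ b∈B)
               (respects (push φ V ⊔ B) (E.≈ᴹ-sym eq) (at ⊔-incˡ (∈push⁺ φ v∈V)))))))
        (splits-shift M s (push⊑range φ) (push⊑ φ (incl λ {v} v∈V →
          let _ , b∈B , eq = χ-spec v
          in respects (push φ′ (push projection V) ⊔ B) eq
               (∈⊔⁺ (∈push⁺ φ′ (∈push⁺ projection v∈V)) b∈B)))))
        (pres V))

      projection-surjective : ⊤ˢ ⊑ range projection
      projection-surjective = incl λ {y} _ →
        let a , b , p , b∈B , eq = ∈⊔⁻ (at (⊑-trans (left s′) (cover s)) (∈range φ′ y))
            x , _ , eq′ = ∈push⁻ φ p
        in respects (range projection)
             (χ-unique (-ᴹ-closed B b∈B) (E.≈ᴹ-trans eq′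
               (E.≈ᴹ-trans (E.≈ᴹ-sym (x+y-y≈x {E = E} a b)) (E.+ᴹ-congʳ eq))))
             (∈range projection x)

    common-complement : N ≃ N′
    common-complement = χ , isEquivalence projection projection-preserves projection-surjective

  module _ {D E : FiniteDimensionalSpace F} {N : QMatroid D} {M : QMatroid E} {φ : D ↪ E}
           (pres : PreservesRank φ N M) where
    private
      module D = FiniteDimensionalSpace D
      module E = FiniteDimensionalSpace E

    reducible⇒reduces : Reducible N → Reduces M (range φ)
    reducible⇒reduces (E₁ , E₂ , M₁ , M₂ , (x , x≉0) , (y , y≉0) , eq) =
      range (ψ ∘↪ ι₁) , range (ψ ∘↪ ι₂) ,
      (_ , ∈range (ψ ∘↪ ι₁) x , λ z → x≉0
        (injective (ψ ∘↪ ι₁) {x} {FiniteDimensionalSpace.0ᴹ ⌊ E₁ ⌋}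
          (E.≈ᴹ-trans z (E.≈ᴹ-sym (0ᴹ-homo (ψ ∘↪ ι₁)))))) ,
      (_ , ∈range (ψ ∘↪ ι₂) y , λ z → y≉0
        (injective (ψ ∘↪ ι₂) {y} {FiniteDimensionalSpace.0ᴹ ⌊ E₂ ⌋}
          (E.≈ᴹ-trans z (E.≈ᴹ-sym (0ᴹ-homo (ψ ∘↪ ι₂)))))) ,
      splits-resp M range≋ (⊑-refl , ⊑-refl) (⊑-refl , ⊑-refl)
        (SumProperties.range-splits {D₁ = ⌊ E₁ ⌋} {⌊ E₂ ⌋} (isSum {M₁ = M₁} {M₂} (λ V → ≡.refl)) M ψ
          (∘-preserves {M = M} {φ} {α} pres (embedding-preserves eq)))
      where
      open DirectSum ⌊ E₁ ⌋ ⌊ E₂ ⌋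
      α : ⌊ E₁ ⌋ ⊕ˢ ⌊ E₂ ⌋ ↪ D
      α = embedding eq
      ψ : ⌊ E₁ ⌋ ⊕ˢ ⌊ E₂ ⌋ ↪ E
      ψ = φ ∘↪ α
      range≋ : range ψ ≋ range φ
      range≋ = ⊑-trans (proj₁ (push-∘ φ α)) (push⊑range φ) ,
        ⊑-trans (push-mono φ (embedding-surjective eq)) (proj₂ (push-∘ φ α))

    -- `Reducible` asks for subspaces of `D`, hence the preimages of `S` and `T`; `factor` replaces
    -- the join into `E` by addition inside `D`.
    reduces⇒reducible : Reduces M (range φ) → Reducible N
    reduces⇒reducible (S , T , (v , v∈S , v≉0) , (w , w∈T , w≉0) , s) =
      E₁ , E₂ , pullback φ₁ M , pullback φ₂ M , nonzero S (left s) v∈S v≉0 , nonzero T (right s) w∈T w≉0 ,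
      isEquivalence h
        (factor-preserves φ j (λ (v , w) → proj₁ v D.+ᴹ proj₁ w) φh≈j pres
          (join-preserves {D₁ = ⌊ E₁ ⌋} {⌊ E₂ ⌋} {E} (isSum {M₁ = pullback φ₁ M} {pullback φ₂ M} (λ V → ≡.refl))
            (pullback-preserves φ₁ M) (pullback-preserves φ₂ M) s′))
        (factor-surjective φ j (λ (v , w) → proj₁ v D.+ᴹ proj₁ w) φh≈j
          (proj₂ (range-join {D₁ = ⌊ E₁ ⌋} {⌊ E₂ ⌋} s′)))
      where
      E₁ E₂ : Subspace D
      E₁ = pull φ S
      E₂ = pull φ T
      φ₁ : ⌊ E₁ ⌋ ↪ E
      φ₁ = φ ∘↪ inclusion E₁
      φ₂ : ⌊ E₂ ⌋ ↪ E
      φ₂ = φ ∘↪ inclusion E₂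
      range≋ : ∀ {W} → W ⊑ range φ → W ≋ range (φ ∘↪ inclusion (pull φ W))
      range≋ {W} p =
        ⊑-trans (push-pull φ p)
          (⊑-trans (push-mono φ (proj₂ (range-inclusion (pull φ W)))) (proj₂ (push-∘ φ (inclusion (pull φ W))))) ,
        push⊑ (φ ∘↪ inclusion (pull φ W)) (incl λ {x} _ → proj₂ x)
      s′ : Splits M (range φ) (range φ₁) (range φ₂)
      s′ = splits-resp M (⊑-refl , ⊑-refl) (range≋ (left s)) (range≋ (right s)) s
      j : ⌊ E₁ ⌋ ⊕ˢ ⌊ E₂ ⌋ ↪ E
      j = join {D₁ = ⌊ E₁ ⌋} {⌊ E₂ ⌋} φ₁ φ₂ (disjoint s′)
      φh≈j : ∀ u → fun φ (proj₁ (proj₁ u) D.+ᴹ proj₁ (proj₂ u)) E.≈ᴹ fun j u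
      φh≈j u = +ᴹ-homo φ _ _
      h : ⌊ E₁ ⌋ ⊕ˢ ⌊ E₂ ⌋ ↪ D
      h = factor φ j (λ (v , w) → proj₁ v D.+ᴹ proj₁ w) φh≈j
      nonzero : ∀ W → W ⊑ range φ → ∀ {v} → v ∈ W → ¬ (v E.≈ᴹ E.0ᴹ) → Nonzero ⌊ pull φ W ⌋
      nonzero W p {v} v∈W v≉0 =
        let x , _ , eq = ∈push⁻ φ (at p v∈W)
        in (x , respects W (E.≈ᴹ-sym eq) v∈W) ,
           λ x≈0 → v≉0 (E.≈ᴹ-trans (E.≈ᴹ-sym eq) (E.≈ᴹ-trans (⟦⟧-cong φ x≈0) (0ᴹ-homo φ)))

-- Moving a summand of a nested direct sum to the front

module _ {ℓ} {F : FiniteField ℓ} where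
  open _↪_
  open Subspace
  open Splits

  id↪ : ∀ {E : FiniteDimensionalSpace F} → E ↪ E
  id↪ {E} = record
    { fun       = id
    ; isLinear  = linear E E id (λ _ _ → ≈ᴹ-refl) (λ _ _ → ≈ᴹ-refl)
    ; injective = id
    }
    where open FiniteDimensionalSpace E

  module _ {E : FiniteDimensionalSpace F} where
    open FiniteDimensionalSpace E using (≈ᴹ-refl)

    push-id : ∀ {V : Subspace E} → push id↪ V ≋ V
    push-id = push⊑ id↪ (incl id) , incl (∈push⁺ id↪)

    id-preserves : ∀ {M : QMatroid E} → PreservesRank id↪ M M
    id-preserves {M} V = ρ-cong M push-id

  module _ {D E : FiniteDimensionalSpace F} {φ ψ : D ↪ E}
           (φ≈ψ : ∀ x → FiniteDimensionalSpace._≈ᴹ_ E (fun φ x) (fun ψ x)) where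
    private module E = FiniteDimensionalSpace E

    preserves-resp : ∀ {N : QMatroid D} {M : QMatroid E} → PreservesRank φ N M → PreservesRank ψ N M
    preserves-resp {M = M} pres V = ≡.trans (ρ-cong M
      ( push⊑ ψ (incl λ {x} p → respects (push φ V) (φ≈ψ x) (∈push⁺ φ p))
      , push⊑ φ (incl λ {x} p → respects (push ψ V) (E.≈ᴹ-sym (φ≈ψ x)) (∈push⁺ ψ p)))) (pres V)

  module _ {D₁ D₂ : FiniteDimensionalSpace F} {P : QMatroid (D₁ ⊕ˢ D₂)}
    {M₁ : QMatroid D₁} {M₂ : QMatroid D₂} (sum : IsSum M₁ M₂ P) where
    open DirectSum D₁ D₂

    ι-splits : Splits P ⊤ˢ (range ι₁) (range ι₂)
    ι-splits = splits-resp P push-id (range-id∘ ι₁) (range-id∘ ι₂)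
      (SumProperties.range-splits {D₁ = D₁} {D₂} sum P id↪ id-preserves)
      where
      range-id∘ : ∀ {D} (ι : D ↪ D₁ ⊕ˢ D₂) → range (id↪ ∘↪ ι) ≋ range ι
      range-id∘ ι = push⊑ (id↪ ∘↪ ι) (incl (∈push⁺ ι)) , push⊑ ι (incl (∈push⁺ (id↪ ∘↪ ι)))

  -- When `T` replaces `B`, both projections of `V` shrink, so additivity is inherited.
  splits-sub : ∀ {E : FiniteDimensionalSpace F} (M : QMatroid E) {U A B T : Subspace E} →
               Splits M U A B → T ⊑ B → Splits M (A ⊔ T) A T
  splits-sub M s T⊑B = record
    { left     = ⊔-incˡ
    ; right    = ⊔-incʳ
    ; cover    = ⊑-refl
    ; disjoint = ⊓-zero ⊑-refl T⊑B (disjoint s)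
    ; additive = λ V V⊑ cyc → ℤ.≤-trans
        (ℤ.+-mono-≤ (ρ-mono M (pr-mono M ⊑-refl T⊑B ⊑-refl)) (ρ-mono M (pr-mono M T⊑B ⊑-refl ⊑-refl)))
        (additive s V (⊑-trans V⊑ (⊔-least (left s) (⊑-trans T⊑B (right s)))) cyc)
    }

  opaque
    directSum : ∀ {D₁ D₂ : FiniteDimensionalSpace F} → QMatroid D₁ → QMatroid D₂ → QMatroid (D₁ ⊕ˢ D₂)
    directSum {D₁} {D₂} M₁ M₂ = _⊕_ {E₁ = D₁} {D₂} M₁ M₂

    directSum-isSum : ∀ {D₁ D₂ : FiniteDimensionalSpace F} (M₁ : QMatroid D₁) (M₂ : QMatroid D₂) →
                      IsSum M₁ M₂ (directSum M₁ M₂)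
    directSum-isSum M₁ M₂ = isSum (λ V → ≡.refl)

  module _ {A B R R′ : FiniteDimensionalSpace F} (φ : B ⊕ˢ R′ ↪ R) where
    private
      module A = FiniteDimensionalSpace A
      module R = FiniteDimensionalSpace R

    under : B ⊕ˢ (A ⊕ˢ R′) ↪ A ⊕ˢ R
    under = record
      { fun       = λ (x , y , r) → y , fun φ (x , r)
      ; isLinear  = linear (B ⊕ˢ (A ⊕ˢ R′)) (A ⊕ˢ R)
          (λ (e₁ , e₂ , e₃) → e₂ , ⟦⟧-cong φ (e₁ , e₃))
          (λ (x , y , r) (x′ , y′ , r′) → A.≈ᴹ-refl , +ᴹ-homo φ (x , r) (x′ , r′))
          (λ c (x , y , r) → A.≈ᴹ-refl , *ₗ-homo φ c (x , r))
      ; injective = λ (e , e′) → let e₁ , e₃ = injective φ e′ in e₁ , e , e₃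
      }

    under-surjective : ⊤ˢ ⊑ range φ → ⊤ˢ ⊑ range under
    under-surjective surj = incl λ {(y , z)} _ →
      let (x , r) , _ , eq = ∈push⁻ φ (at surj {z} tt)
      in respects (range under) (A.≈ᴹ-refl , eq) (∈range under (x , y , r))

    module _ {K : QMatroid A} {N : QMatroid B} {X : QMatroid R} {X′ : QMatroid R′}
             {NX′ : QMatroid (B ⊕ˢ R′)} {KX : QMatroid (A ⊕ˢ R)} {KX′ : QMatroid (A ⊕ˢ R′)}
             {NKX′ : QMatroid (B ⊕ˢ (A ⊕ˢ R′))}
             (NX′-sum : IsSum N X′ NX′) (KX-sum : IsSum K X KX) (KX′-sum : IsSum K X′ KX′)
             (NKX′-sum : IsSum N KX′ NKX′)
             (pres : PreservesRank φ NX′ X) (surj : ⊤ˢ ⊑ range φ) where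
      private
        module S = DirectSum A R
        module J = DirectSum B R′
        module Σ₁ = SumProperties {D₁ = A} {R} KX-sum
        module Σ₂ = SumProperties {D₁ = B} {R′} NX′-sum

        γ : B ⊕ˢ R′ ↪ A ⊕ˢ R
        γ = S.ι₂ ∘↪ φ

        γ-preserves : PreservesRank γ NX′ KX
        γ-preserves = ∘-preserves {M = KX} {S.ι₂} {φ} Σ₁.ι₂-preserves pres

        range-γ : range γ ≋ range S.ι₂
        range-γ = ⊑-trans (proj₁ (push-∘ S.ι₂ φ)) (push⊑range S.ι₂) ,
          ⊑-trans (push-mono S.ι₂ surj) (proj₂ (push-∘ S.ι₂ φ))

        s₁ : Splits KX ⊤ˢ (range S.ι₁) (range S.ι₂)
        s₁ = ι-splits {D₁ = A} {R} KX-sum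

        s₂ : Splits KX (range S.ι₂) (range (γ ∘↪ J.ι₁)) (range (γ ∘↪ J.ι₂))
        s₂ = splits-resp KX range-γ (⊑-refl , ⊑-refl) (⊑-refl , ⊑-refl)
          (Σ₂.range-splits KX γ γ-preserves)

        s₃ : Splits KX (range S.ι₁ ⊔ range (γ ∘↪ J.ι₂)) (range S.ι₁) (range (γ ∘↪ J.ι₂))
        s₃ = splits-sub KX s₁ (right s₂)

        η : A ⊕ˢ R′ ↪ A ⊕ˢ R
        η = join {D₁ = A} {R′} S.ι₁ (γ ∘↪ J.ι₂) (disjoint s₃)

        η-preserves : PreservesRank η KX′ KX
        η-preserves = join-preserves {D₁ = A} {R′} {A ⊕ˢ R} KX′-sum {KX}
          {φ₁ = S.ι₁} {γ ∘↪ J.ι₂} Σ₁.ι₁-preserves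
          (∘-preserves {M = KX} {γ} {J.ι₂} γ-preserves Σ₂.ι₂-preserves) s₃

        s₄ : Splits KX ⊤ˢ (range (γ ∘↪ J.ι₁)) (range η)
        s₄ = splits-resp KX (⊑-refl , ⊑-refl) (⊑-refl , ⊑-refl)
          (≋-sym (range-join {D₁ = A} {R′} {A ⊕ˢ R} {KX} {φ₁ = S.ι₁} {γ ∘↪ J.ι₂} s₃))
          (splits-assoc KX s₁ s₂)

        β : B ⊕ˢ (A ⊕ˢ R′) ↪ A ⊕ˢ R
        β = join {D₁ = B} {A ⊕ˢ R′} (γ ∘↪ J.ι₁) η (disjoint s₄)

        β≈under : ∀ x y r → FiniteDimensionalSpace._≈ᴹ_ (A ⊕ˢ R) (fun β (x , y , r)) (y , fun φ (x , r))
        β≈under x y r =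
          A.≈ᴹ-trans (A.+ᴹ-identityˡ _) (A.+ᴹ-identityʳ y) ,
          R.≈ᴹ-trans (R.+ᴹ-congˡ (R.+ᴹ-identityˡ _)) (R.≈ᴹ-trans (R.≈ᴹ-sym (+ᴹ-homo φ _ _))
            (⟦⟧-cong φ (FiniteDimensionalSpace.+ᴹ-identityʳ B x , FiniteDimensionalSpace.+ᴹ-identityˡ R′ r)))

      -- The two nested splittings are regrouped by `splits-assoc` and turned back into a direct sum
      -- by `join`. The map `β` so obtained agrees with `under` on every vector.
      under-preserves : PreservesRank under NKX′ KX
      under-preserves = preserves-resp {φ = β} {under} (λ (x , y , r) → β≈under x y r)
        (join-preserves {D₁ = B} {A ⊕ˢ R′} {A ⊕ˢ R} NKX′-sum {KX} {φ₁ = γ ∘↪ J.ι₁} {η}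
          (∘-preserves {M = KX} {γ} {J.ι₁} γ-preserves Σ₂.ι₁-preserves) η-preserves s₄)

-- Iterated direct sums

module _ {ℓ} {F : FiniteField ℓ} where
  open _↪_
  open Subspace
  open Splits
  open FiniteDimensionalSpace using (_≈ᴹ_; 0ᴹ)

  -- P is, up to equality of rank functions, the iterated direct sum of the Ms.
  data SumOf : ∀ {t} {D : Fin t → FiniteDimensionalSpace F} (Ms : ∀ i → QMatroid (D i))
               {X : FiniteDimensionalSpace F} (P : QMatroid X) → Set (lsuc ℓ) where
    nil  : ∀ {D : Fin zero → FiniteDimensionalSpace F} {Ms : ∀ i → QMatroid (D i)}
             {X} {P : QMatroid X} → (∀ v → _≈ᴹ_ X v (0ᴹ X)) → SumOf Ms P
    cons : ∀ {t} {D : Fin (suc t) → FiniteDimensionalSpace F} {Ms : ∀ i → QMatroid (D i)}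
             {R} {Q : QMatroid R} {P : QMatroid (D zero ⊕ˢ R)} →
             IsSum (Ms zero) Q P → SumOf (λ i → Ms (suc i)) Q → SumOf Ms P

  ⨁-sumOf : ∀ {t} {D : Fin t → FiniteDimensionalSpace F} (Ms : ∀ i → QMatroid (D i)) → SumOf Ms (⨁ Ms)
  ⨁-sumOf {zero}      Ms = nil (λ _ → tt)
  ⨁-sumOf {suc t} {D} Ms = cons {D = D} {Ms} {⨁ˢ (λ i → D (suc i))} {⨁ {E = λ i → D (suc i)} (λ i → Ms (suc i))}
    (isSum (λ V → ≡.refl)) (⨁-sumOf (λ i → Ms (suc i)))

  -- The space `rest` depends on how the summand was moved to the front; all that is recorded of
  -- `others` is that it is a `SumOf` the remaining summands.
  record Peeled {s} {G : Fin (suc s) → FiniteDimensionalSpace F} (Ns : ∀ i → QMatroid (G i))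
                {Z : FiniteDimensionalSpace F} (Q : QMatroid Z) (j : Fin (suc s)) : Set (lsuc ℓ) where
    field
      {rest}     : FiniteDimensionalSpace F
      {others}   : QMatroid rest
      {whole}    : QMatroid (G j ⊕ˢ rest)
      sumOf      : SumOf (λ k → Ns (punchIn j k)) others
      whole-sum  : IsSum (Ns j) others whole
      inject     : G j ⊕ˢ rest ↪ Z
      preserves  : PreservesRank inject whole Q
      surjective : ⊤ˢ ⊑ range inject

  record Selected {s} {G : Fin (suc s) → FiniteDimensionalSpace F} (Ns : ∀ i → QMatroid (G i))
                  {Z : FiniteDimensionalSpace F} (Q : QMatroid Z)
                  (W : Subspace Z) (v : FiniteDimensionalSpace.Carrierᴹ Z) : Set (lsuc ℓ) where
    field
      index   : Fin (suc s)
      peeled  : Peeled Ns Q index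
    open Peeled peeled public
    field
      component : FiniteDimensionalSpace.Carrierᴹ (G index)
      remainder : FiniteDimensionalSpace.Carrierᴹ rest
      sum≈      : _≈ᴹ_ Z (fun inject (component , remainder)) v
      outside   : ¬ (fun inject (component , 0ᴹ rest) ∈ W)

  -- If every component of `v` lay in `W`, so would `v`; the search tries the first component and
  -- otherwise continues in the tail with the preimage of `W`. With `W = A′` it provides the vector
  -- that the exchange property asks for.
  select : ∀ {s} {G : Fin (suc s) → FiniteDimensionalSpace F} {Ns : ∀ i → QMatroid (G i)}
             {Z} {Q : QMatroid Z} → SumOf Ns Q → (W : Subspace Z) → ∀ v → ¬ (v ∈ W) → Selected Ns Q W v
  select {s} {G} {Ns} {_} {Q} (cons {R = R} {X} sum rest) W (v , u) vu∉W with member? W (v , 0ᴹ R)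
  ... | no v0∉W = record
    { index = zero
    ; peeled = record
      { sumOf = rest ; whole-sum = sum ; inject = id↪ ; preserves = id-preserves ; surjective = proj₂ push-id }
    ; component = v
    ; remainder = u
    ; sum≈ = FiniteDimensionalSpace.≈ᴹ-refl (G zero ⊕ˢ R)
    ; outside = v0∉W
    }
  ... | yes v0∈W = later rest
    where
    module G₀ = FiniteDimensionalSpace (G zero)
    module R = FiniteDimensionalSpace R
    open DirectSum (G zero) R
    u∉W : ¬ ((G₀.0ᴹ , u) ∈ W)
    u∉W p = vu∉W (respects W (G₀.+ᴹ-identityʳ v , R.+ᴹ-identityˡ u) (+-closed W v0∈W p))
    later : SumOf (λ i → Ns (suc i)) X → Selected Ns Q W (v , u)
    -- With no summands left, the tail component is zero and would lie in `W`.
    later (nil trivial) = contradiction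
      (respects W (G₀.≈ᴹ-refl , R.≈ᴹ-sym (trivial u)) (0-closed W)) u∉W
    later rest@(cons _ _) = record
      { index = suc S.index
      ; peeled = record
        { rest = G zero ⊕ˢ S.rest
        ; others = KX′
        ; whole = NKX′
        ; sumOf = cons {D = λ k → G (punchIn (suc S.index) k)} {λ k → Ns (punchIn (suc S.index) k)}
            {S.rest} {S.others} {KX′} KX′-sum S.sumOf
        ; whole-sum = NKX′-sum
        ; inject = under {A = G zero} {G (suc S.index)} {R} {S.rest} S.inject
        ; preserves = under-preserves {A = G zero} {G (suc S.index)} {R} {S.rest} S.inject
            S.whole-sum sum KX′-sum NKX′-sum S.preserves S.surjective
        ; surjective = under-surjective {A = G zero} {G (suc S.index)} {R} {S.rest} S.inject S.surjective
        }
      ; component = S.component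
      ; remainder = v , S.remainder
      ; sum≈ = G₀.≈ᴹ-refl , S.sum≈
      ; outside = S.outside
      }
      where
      module S = Selected (select rest (pull ι₂ W) u u∉W)
      KX′ : QMatroid (G zero ⊕ˢ S.rest)
      KX′ = directSum {D₁ = G zero} {S.rest} (Ns zero) S.others
      NKX′ : QMatroid (G (suc S.index) ⊕ˢ (G zero ⊕ˢ S.rest))
      NKX′ = directSum {D₁ = G (suc S.index)} {G zero ⊕ˢ S.rest} (Ns (suc S.index)) KX′
      KX′-sum : IsSum (Ns zero) S.others KX′
      KX′-sum = directSum-isSum (Ns zero) S.others
      NKX′-sum : IsSum (Ns (suc S.index)) KX′ NKX′
      NKX′-sum = directSum-isSum (Ns (suc S.index)) KX′

-- Uniqueness and existence of decompositions

module _ {ℓ} {F : FiniteField ℓ} where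
  open _↪_
  open Subspace
  open Splits
  open FiniteDimensionalSpace using (Carrierᴹ; _≈ᴹ_; 0ᴹ; ≈ᴹ-refl; ≈ᴹ-sym; ≈ᴹ-trans)

  range-∘ : ∀ {C D E : FiniteDimensionalSpace F} (ψ : D ↪ E) (φ : C ↪ D) →
            ⊤ˢ ⊑ range φ → range ψ ⊑ range (ψ ∘↪ φ)
  range-∘ ψ φ surj = ⊑-trans (push-mono ψ surj) (proj₂ (push-∘ ψ φ))

  -- `SumOf` takes the place of `⨁` for the sake of the induction: after one summand is removed on
  -- each side, `X` is compared with `S.others`, which is an iterated sum only up to its rank
  -- function.
  sums-unique :
    ∀ {t s} {D : Fin t → FiniteDimensionalSpace F} {G : Fin s → FiniteDimensionalSpace F}
      {Ms : ∀ i → QMatroid (D i)} {Ns : ∀ j → QMatroid (G j)}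
      {X Z : FiniteDimensionalSpace F} {P : QMatroid X} {Q : QMatroid Z} →
    SumOf Ms P → SumOf Ns Q →
    (∀ i → Nonzero (D i)) → (∀ j → Nonzero (G j)) →
    (∀ i → Irreducible (Ms i)) → (∀ j → Irreducible (Ns j)) →
    (ψ : X ↪ Z) → PreservesRank ψ P Q → ⊤ˢ ⊑ range ψ →
    s ≡ t × Σ (Permutation t s) λ σ → ∀ i → Ms i ≃ Ns (σ ⟨$⟩ʳ i)
  sums-unique (nil _) (nil _) _ _ _ _ _ _ _ = ≡.refl , Permutation.id , λ ()
  sums-unique {G = G} {X = X} (nil trivial) (cons {R = R} _ _) _ nzG _ _ ψ _ surj =
    let y , y≉0 = nzG zero
        u , _ , eq = ∈push⁻ ψ (at surj {y , 0ᴹ R} tt)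
    in contradiction (proj₁ (≈ᴹ-trans (G zero ⊕ˢ R) (≈ᴹ-sym (G zero ⊕ˢ R) eq)
         (≈ᴹ-trans (G zero ⊕ˢ R) (⟦⟧-cong ψ (trivial u)) (0ᴹ-homo ψ)))) y≉0
  sums-unique {D = D} {Z = Z} (cons {R = R} _ _) (nil trivial) nzD _ _ _ ψ _ _ =
    let x , x≉0 = nzD zero
    in contradiction (proj₁ (injective ψ {x , 0ᴹ R} {0ᴹ (D zero) , 0ᴹ R}
         (≈ᴹ-trans Z (trivial _) (≈ᴹ-sym Z (trivial _))))) x≉0
  sums-unique {suc t} {suc s} {D} {G} {Ms} {Ns} {_} {Z} {P} {Q}
    (cons {R = R} {X} sum rest) sumQ@(cons _ _) nzD nzG irrD irrG ψ pres surj =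
    let s≡t , σ , equiv = recurse
    in ≡.cong suc s≡t , Permutation.insert zero S.index σ ,
       λ { zero → first σ ; (suc i) → ≡.subst (λ j → Ms (suc i) ≃ Ns j)
             (≡.sym (Permutation.insert-punchIn zero S.index σ i)) (equiv i) }
    where
    module I = DirectSum (D zero) R
    module Σ₁ = SumProperties {D₁ = D zero} {R} sum
    x : Carrierᴹ (D zero)
    x = proj₁ (nzD zero)
    v : Carrierᴹ Z
    v = fun ψ (x , 0ᴹ R)
    A A′ : Subspace Z
    A = range (ψ ∘↪ I.ι₁)
    A′ = range (ψ ∘↪ I.ι₂)
    sA : Splits Q ⊤ˢ A A′
    sA = splits-resp Q (⊑⊤ , surj) (⊑-refl , ⊑-refl) (⊑-refl , ⊑-refl) (Σ₁.range-splits Q ψ pres)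
    v∉A′ : ¬ (v ∈ A′)
    v∉A′ p = proj₂ (nzD zero) (injective (ψ ∘↪ I.ι₁) {x} {0ᴹ (D zero)} (≈ᴹ-trans Z
      (at (disjoint sA) (∈⊓⁺ (∈range (ψ ∘↪ I.ι₁) x) p)) (≈ᴹ-sym Z (0ᴹ-homo (ψ ∘↪ I.ι₁)))))
    module S = Selected (select sumQ A′ v v∉A′)
    module J = DirectSum (G S.index) S.rest
    module Σ₂ = SumProperties {D₁ = G S.index} {S.rest} S.whole-sum
    module GJ = FiniteDimensionalSpace (G S.index ⊕ˢ S.rest)
    B B′ : Subspace Z
    B = range (S.inject ∘↪ J.ι₁)
    B′ = range (S.inject ∘↪ J.ι₂)
    sB : Splits Q ⊤ˢ B B′
    sB = splits-resp Q (⊑⊤ , S.surjective) (⊑-refl , ⊑-refl) (⊑-refl , ⊑-refl)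
      (Σ₂.range-splits Q S.inject S.preserves)
    pres₁ : PreservesRank (ψ ∘↪ I.ι₁) (Ms zero) Q
    pres₁ = ∘-preserves {M = Q} {ψ} {I.ι₁} pres Σ₁.ι₁-preserves
    pres₂ : PreservesRank (ψ ∘↪ I.ι₂) X Q
    pres₂ = ∘-preserves {M = Q} {ψ} {I.ι₂} pres Σ₁.ι₂-preserves
    pres₁′ : PreservesRank (S.inject ∘↪ J.ι₁) (Ns S.index) Q
    pres₁′ = ∘-preserves {M = Q} {S.inject} {J.ι₁} S.preserves Σ₂.ι₁-preserves
    pres₂′ : PreservesRank (S.inject ∘↪ J.ι₂) S.others Q
    pres₂′ = ∘-preserves {M = Q} {S.inject} {J.ι₂} S.preserves Σ₂.ι₂-preserves
    g+g′≈v : FiniteDimensionalSpace._≈ᴹ_ Z (FiniteDimensionalSpace._+ᴹ_ Z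
      (fun S.inject (S.component , 0ᴹ S.rest)) (fun S.inject (0ᴹ (G S.index) , S.remainder))) v
    g+g′≈v = ≈ᴹ-trans Z (≈ᴹ-sym Z (+ᴹ-homo S.inject _ _)) (≈ᴹ-trans Z
      (⟦⟧-cong S.inject (FiniteDimensionalSpace.+ᴹ-identityʳ (G S.index) S.component ,
                         FiniteDimensionalSpace.+ᴹ-identityˡ S.rest S.remainder)) S.sum≈)
    exchanged : Splits Q ⊤ˢ B A′
    exchanged = exchange Q sA sB
      (λ r → irrD zero (reduces⇒reducible {φ = ψ ∘↪ I.ι₁} pres₁ r))
      (λ r → irrG S.index (reduces⇒reducible {φ = S.inject ∘↪ J.ι₁} pres₁′ r))
      (∈range (ψ ∘↪ I.ι₁) x) (∈range (S.inject ∘↪ J.ι₁) S.component)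
      (∈range (S.inject ∘↪ J.ι₂) S.remainder) g+g′≈v S.outside
    -- `A′` and `B′` are both complements of `B`, the former thanks to the exchange; likewise `A`
    -- and `B` are both complements of `A′`.
    complements : X ≃ S.others
    complements = common-complement {φ = ψ ∘↪ I.ι₂} {S.inject ∘↪ J.ι₂} pres₂ pres₂′
      (splits-swap Q exchanged) (splits-swap Q sB)
    first : (σ : Permutation t s) → Ms zero ≃ Ns (Permutation.insert zero S.index σ ⟨$⟩ʳ zero)
    first σ = common-complement {φ = ψ ∘↪ I.ι₁} {S.inject ∘↪ J.ι₁} pres₁ pres₁′ sA exchanged
    recurse : s ≡ t × Σ (Permutation t s) λ σ → ∀ i → Ms (suc i) ≃ Ns (punchIn S.index (σ ⟨$⟩ʳ i))
    recurse = sums-unique rest S.sumOf (λ i → nzD (suc i)) (λ k → nzG (punchIn S.index k))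
      (λ i → irrD (suc i)) (λ k → irrG (punchIn S.index k))
      (embedding (proj₂ complements)) (embedding-preserves (proj₂ complements))
      (embedding-surjective (proj₂ complements))

  module _ {E X Z : FiniteDimensionalSpace F} {M : QMatroid E} {P : QMatroid X} {Q : QMatroid Z} where

    -- The inverse of the first equivalence is obtained by factoring the identity of `X` through it.
    ≃-span : M ≃ P → M ≃ Q → Σ (X ↪ Z) λ ψ → PreservesRank ψ P Q × ⊤ˢ ⊑ range ψ
    ≃-span (_ , eqP) (_ , eqQ) =
      β ∘↪ χ ,
      ∘-preserves {M = Q} {β} {χ} (embedding-preserves eqQ)
        (factor-preserves α id↪ α⁻¹ αα⁻¹ (embedding-preserves eqP) id-preserves) ,
      ⊑-trans (embedding-surjective eqQ) (range-∘ β χ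
        (factor-surjective α id↪ α⁻¹ αα⁻¹ (⊑-trans ⊑⊤ (proj₂ push-id))))
      where
      α : E ↪ X
      α = embedding eqP
      β : E ↪ Z
      β = embedding eqQ
      preimage : ∀ x → ∃ λ v → v ∈ ⊤ˢ {E = E} × _≈ᴹ_ X (fun α v) x
      preimage x = ∈push⁻ α (at (embedding-surjective eqP) {x} tt)
      α⁻¹ : Carrierᴹ X → Carrierᴹ E
      α⁻¹ x = proj₁ (preimage x)
      αα⁻¹ : ∀ x → _≈ᴹ_ X (fun α (α⁻¹ x)) x
      αα⁻¹ x = proj₂ (proj₂ (preimage x))
      χ : X ↪ E
      χ = factor α id↪ α⁻¹ αα⁻¹

  module _ {E : FiniteDimensionalSpace F} (M : QMatroid E) where
    private module E = FiniteDimensionalSpace E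

    restrict : (V : Subspace E) → QMatroid ⌊ V ⌋
    restrict V = pullback (inclusion V) M

    dim-summand : ∀ {U A B} → Splits M U A B → NonzeroSubspace A → dim B ℕ.< dim U
    dim-summand s (v , v∈A , v≉0) = dim-strict (right s)
      (λ U⊑B → v≉0 (at (disjoint s) (∈⊓⁺ v∈A (at U⊑B (at (left s) v∈A)))))

    -- If `U` splits into `S` and `T`, an irreducible part `A` of `S` is found by recursion, and
    -- `splits-assoc` collects `T` with what remains of `S`. An irreducible `U` is split trivially,
    -- with zero as the complement.
    irreducible-summand : ∀ n U → dim U ℕ.≤ n → NonzeroSubspace U →
      ∃₂ λ A B → NonzeroSubspace A × ¬ Reduces M A × Splits M U A B
    irreducible-summand n U dimU≤n U≠0 with reduces? M U
    ... | no irr = U , 0ˢ , U≠0 , irr ,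
      splits-cyclic M ⊑-refl (0⊑ , ⊓-incʳ {V = U} {0ˢ} , ⊔-incˡ {V = U} {0ˢ}) (λ V V⊑U _ → V⊑U)
    irreducible-summand zero U dimU≤0 _ | yes (S , T , _ , T≠0 , s) =
      contradiction (ℕ.≤-trans (dim-summand (splits-swap M s) T≠0) dimU≤0) λ ()
    irreducible-summand (suc n) U dimU≤n _ | yes (S , T , S≠0 , T≠0 , s)
      with irreducible-summand n S (ℕ.s≤s⁻¹ (ℕ.≤-trans (dim-summand (splits-swap M s) T≠0) dimU≤n)) S≠0
    ... | A , B , A≠0 , irr , s′ = A , T ⊔ B , A≠0 , irr , splits-assoc M (splits-swap M s) s′

    -- Only `U` varies, so that the recursion continues on a complement without changing the ambient
    -- space. `total≈` links the injection built by `join` to the map `total D` fixed in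
    -- `IsInternalDirectSum`.
    record Decomposition {t} (D : Fin t → Subspace E) (U : Subspace E) : Set (lsuc ℓ) where
      field
        nonzero     : ∀ i → NonzeroSubspace (D i)
        irreducible : ∀ i → ¬ Reduces M (D i)
        inject      : ⨁ˢ (λ i → ⌊ D i ⌋) ↪ E
        preserves   : PreservesRank inject (⨁ {E = λ i → ⌊ D i ⌋} (λ i → restrict (D i))) M
        range≋      : range inject ≋ U
        total≈      : ∀ v → total D v E.≈ᴹ fun inject v

    decompose-zero : ∀ {U} (D : Fin zero → Subspace E) → U ⊑ 0ˢ → Decomposition D U
    decompose-zero {U} D U⊑0 = record
      { nonzero     = λ ()
      ; irreducible = λ ()
      ; inject      = φ
      ; preserves   = λ V → ≡.trans
          (ℤ.≤-antisym (ℤ.≤-trans (ρ-mono M φ⊑0) (ℤ.≤-reflexive (ρ-0ˢ M))) (0≤ρ M (push φ V)))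
          (≡.sym (ρ≡rank zeroMatroid V))
      ; range≋      = ⊑-trans φ⊑0 0⊑ , ⊑-trans U⊑0 0⊑
      ; total≈      = λ _ → E.≈ᴹ-refl
      }
      where
      φ : zeroSpace ↪ E
      φ = record
        { fun       = λ _ → E.0ᴹ
        ; isLinear  = linear zeroSpace E (λ _ → E.≈ᴹ-refl)
            (λ _ _ → E.≈ᴹ-sym (E.+ᴹ-identityˡ E.0ᴹ)) (λ c _ → E.≈ᴹ-sym (E.*ₗ-zeroʳ c))
        ; injective = λ _ → tt
        }
      φ⊑0 : ∀ {V} → push φ V ⊑ 0ˢ
      φ⊑0 {V} = push⊑ φ {V} {0ˢ} (incl λ _ → E.≈ᴹ-refl)

    decompose-suc : ∀ {t} (D : Fin (suc t) → Subspace E) {U B} → NonzeroSubspace (D zero) →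
      ¬ Reduces M (D zero) → Splits M U (D zero) B → Decomposition (λ i → D (suc i)) B → Decomposition D U
    decompose-suc D {U} {B} D₀≠0 irr s dec = record
      { nonzero     = λ { zero → D₀≠0 ; (suc i) → R.nonzero i }
      ; irreducible = λ { zero → irr ; (suc i) → R.irreducible i }
      ; inject      = φ
      ; preserves   = join-preserves {D₁ = ⌊ D zero ⌋} {⨁ˢ (λ i → ⌊ D (suc i) ⌋)} {E} sum {M}
          {φ₁ = inclusion (D zero)} {R.inject} (pullback-preserves (inclusion (D zero)) M) R.preserves s′
      ; range≋      = range-join {D₁ = ⌊ D zero ⌋} {⨁ˢ (λ i → ⌊ D (suc i) ⌋)} {E} {M}
          {φ₁ = inclusion (D zero)} {R.inject} s′
      ; total≈      = λ (v , vs) → E.+ᴹ-congˡ (R.total≈ vs)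
      }
      where
      module R = Decomposition dec
      s′ : Splits M U (range (inclusion (D zero))) (range R.inject)
      s′ = splits-resp M (⊑-refl , ⊑-refl) (≋-sym (range-inclusion (D zero))) (≋-sym R.range≋) s
      φ : ⌊ D zero ⌋ ⊕ˢ ⨁ˢ (λ i → ⌊ D (suc i) ⌋) ↪ E
      φ = join {D₁ = ⌊ D zero ⌋} {⨁ˢ (λ i → ⌊ D (suc i) ⌋)} (inclusion (D zero)) R.inject (disjoint s′)
      sum : IsSum {D₁ = ⌊ D zero ⌋} {⨁ˢ (λ i → ⌊ D (suc i) ⌋)} (restrict (D zero))
        (⨁ {E = λ i → ⌊ D (suc i) ⌋} (λ i → restrict (D (suc i))))
        (⨁ {E = λ i → ⌊ D i ⌋} (λ i → restrict (D i)))
      sum = isSum (λ V → ≡.refl)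

    opaque
      -- Only the complement `B` of an irreducible part is decomposed further; its dimension is
      -- smaller since that part is nonzero. The zero subspace is the empty sum.
      decompose : ∀ n U → dim U ℕ.≤ n → ∃ λ t → Σ (Fin t → Subspace E) λ D → Decomposition D U
      decompose n U dimU≤n with nonzero? U
      ... | no U≈0 = zero , (λ ()) , decompose-zero (λ ()) (¬nonzero⇒⊑0 U≈0)
      ... | yes U≠0 with irreducible-summand n U dimU≤n U≠0
      decompose zero U dimU≤0 | yes _ | A , B , A≠0 , irr , s =
        contradiction (ℕ.≤-trans (dim-summand s A≠0) dimU≤0) λ ()
      decompose (suc n) U dimU≤n | yes _ | A , B , A≠0 , irr , s
        with decompose n B (ℕ.s≤s⁻¹ (ℕ.≤-trans (dim-summand s A≠0) dimU≤n))
      ... | t , D , dec = suc t , A Vector.∷ D , decompose-suc (A Vector.∷ D) A≠0 irr s dec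

    decomposition⇒internalDirectSum : ∀ {t} {D : Fin t → Subspace E} → Decomposition D ⊤ˢ →
      (∀ i → Nonzero ⌊ D i ⌋) × (∀ i → Irreducible (restrict (D i))) ×
      IsInternalDirectSum M {D} (λ i → restrict (D i))
    decomposition⇒internalDirectSum {t} {D} dec =
      (λ i → let v , v∈ , v≉0 = C.nonzero i in (v , v∈) , v≉0) ,
      (λ i red → C.irreducible i (reduces i red)) ,
      isEquivalence {E₁ = ⨁ˢ (λ i → ⌊ D i ⌋)} {E} total↪
        (factor-preserves id↪ C.inject (total D) C.total≈ id-preserves C.preserves)
        (factor-surjective id↪ C.inject (total D) C.total≈ (⊑-trans ⊑⊤ (proj₂ C.range≋)))
      where
      module C = Decomposition dec
      total↪ : ⨁ˢ (λ i → ⌊ D i ⌋) ↪ E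
      total↪ = factor id↪ C.inject (total D) C.total≈
      reduces : ∀ i → Reducible (restrict (D i)) → Reduces M (D i)
      reduces i red = reduces-resp M (range-inclusion (D i))
        (reducible⇒reduces {D = ⌊ D i ⌋} {E} {restrict (D i)} {M} {inclusion (D i)}
          (pullback-preserves (inclusion (D i)) M) red)

theorem7p15 : ∀ {ℓ} {F : FiniteField ℓ} {E : FiniteDimensionalSpace F} (M : QMatroid E) →
    (∃[ t ] Σ (Fin t → Subspace E) λ D → Σ (∀ i → QMatroid ⌊ D i ⌋) λ Ms →
    (∀ i → Nonzero ⌊ D i ⌋) × (∀ i → Irreducible (Ms i)) × IsInternalDirectSum M Ms)
    ×
    (∀ {t s : ℕ} {D : Fin t → FiniteDimensionalSpace F} {G : Fin s → FiniteDimensionalSpace F}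
    (Ms : ∀ i → QMatroid (D i)) (Ns : ∀ j → QMatroid (G j)) →
    (∀ i → Nonzero (D i)) → (∀ j → Nonzero (G j)) →
    (∀ i → Irreducible (Ms i)) → (∀ j → Irreducible (Ns j)) →
    M ≃ ⨁ Ms → M ≃ ⨁ Ns →
    s ≡ t × Σ (Permutation t s) λ σ → ∀ i → Ms i ≃ Ns (σ ⟨$⟩ʳ i))
theorem7p15 {E = E} M =
  (let _ , D , dec = decompose M (dim (⊤ˢ {E = E})) ⊤ˢ ℕ.≤-refl
   in _ , D , (λ i → restrict M (D i)) , decomposition⇒internalDirectSum M dec) ,
  λ Ms Ns nzD nzG irrD irrG M≃⨁Ms M≃⨁Ns →
    let ψ , pres , surj = ≃-span M≃⨁Ms M≃⨁Ns
    in sums-unique (⨁-sumOf Ms) (⨁-sumOf Ns) nzD nzG irrD irrG ψ pres surj
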